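{- Let $d\ge 2$ and let $\gamma_d$ be the infimum of the set of all $\gamma\ge 0$ for which the equation $\exp(-\gamma(1-x)^d)=x$ has a solution $x<1$. Let $\delta>0$ and $0<c<\gamma_d$ be fixed and $p=\frac{c}{n}$. Then for $Y\in Y_d(n,p)$, $$\Pr\big[f_d(R_\infty(Y))>\delta n^d\big]=o(1)\quad (n\to\infty),$$ where $f_d(R_\infty(Y))$ is the number of $d$-simplices of $R_\infty(Y)$.
   Context: $\Delta_{n-1}$ denotes the $(n-1)$-simplex on vertex set $[n]$. $Y_d(n,p)$ is the probability space of complexes $\Delta_{n-1}^{(d-1)}\subset Y\subset\Delta_{n-1}^{(d)}$ in which each $d$-simplex is included independently with probability $p$. A $(d-1)$-simplex is a free face of $Y$ if it lies in exactly one $d$-simplex of $Y$; $R(Y)$ is obtained from $Y$ by removing all free $(d-1)$-faces together with the $d$-simplices containing them; $R_0(Y)=Y$, $R_i(Y)=R(R_{i-1}(Y))$, and $R_\infty(Y)$ is the eventual stable complex (obtained after performing all possible such collapse steps). -}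

module Defs where

open import Algebra.Bundles using (CommutativeRing; Semiring)
import Algebra.Definitions.RawSemiring as RawSemiringDefinitions
import Data.Bool.Properties as Bool
open import Data.Empty using (⊥-elim)
open import Data.Fin using (toℕ)
import Data.Fin.Properties as Fin
open import Data.Fin.Subset using (Subset; inside; outside; _∈_; _⊆_; ∣_∣; ∁; Nonempty)
open import Data.Fin.Subset.Properties using (_∈?_; _⊆?_; nonempty?; anySubset?; ⊆-trans; p⊆q⇒∣p∣≤∣q∣; drop-∷-⊆)
open import Data.List using (List; []; _∷_; _++_; map; filter; foldr; length; lookup)
open import Data.List.Properties using (filter-≐)
open import Data.List.Membership.Propositional using () renaming (_∈_ to _∈ˡ_)
open import Data.List.Membership.Propositional.Properties using (∈-++⁺ˡ; ∈-++⁺ʳ; ∈-map⁺; ∈-filter⁻; ∈-lookup)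
open import Data.List.Relation.Unary.Any using (here; there)
open import Data.Nat as ℕ using (ℕ; zero; suc; z≤n; s≤s)
import Data.Nat.Properties as ℕ
open import Data.Product using (∃; _×_; _,_; proj₁; proj₂)
open import Data.Sum using (_⊎_; inj₁; inj₂)
open import Data.Vec using ([]; _∷_; here)
import Data.Vec.Properties as Vec
open import Level using (0ℓ)
open import Relation.Binary using (Rel; IsStrictTotalOrder)
open import Relation.Binary.PropositionalEquality using (_≡_; refl; sym; trans; cong; subst)
open import Relation.Nullary using (¬_; yes; no)
open import Relation.Nullary.Decidable using (_×-dec_; _⊎-dec_; ¬?)
open import Relation.Unary using (Pred; Decidable; Satisfiable)

------------------------------------------------------------------------
-- The real numbers, axiomatised as a complete ordered field
--
-- The order is decidable (trichotomous) and suprema are approximated by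
-- elements of the set, as they are classically; `complete` thereby
-- implies excluded middle for types in Set.  Equality is the ring's
-- setoid equality, and the value of the inverse at 0 is unspecified.

record CompleteOrderedField : Set₁ where
  infix 8 _⁻¹
  infix 4 _<_ _≤_ _≥_
  field
    commutativeRing : CommutativeRing 0ℓ 0ℓ

  open CommutativeRing commutativeRing public

  field
    _<_                : Rel Carrier 0ℓ
    isStrictTotalOrder : IsStrictTotalOrder _≈_ _<_
    0<1                : 0# < 1#
    +-monoʳ-<          : ∀ x {y z} → y < z → x + y < x + z
    *-pos              : ∀ {x y} → 0# < x → 0# < y → 0# < x * y
    _⁻¹                : Carrier → Carrier
    ⁻¹-inverseʳ        : ∀ {x} → ¬ (x ≈ 0#) → x * x ⁻¹ ≈ 1#

  open IsStrictTotalOrder isStrictTotalOrder public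
    using (compare; _<?_)

  _≤_ : Rel Carrier 0ℓ
  x ≤ y = ¬ (y < x)

  _≥_ : Rel Carrier 0ℓ
  x ≥ y = y ≤ x

  IsSupremum : Pred Carrier 0ℓ → Pred Carrier 0ℓ
  IsSupremum P s = (∀ x → P x → x ≤ s) × (∀ y → y < s → ∃ λ x → P x × y < x)

  IsInfimum : Pred Carrier 0ℓ → Pred Carrier 0ℓ
  IsInfimum P i = (∀ x → P x → i ≤ x) × (∀ y → i < y → ∃ λ x → P x × x < y)

  field
    complete : ∀ (P : Pred Carrier 0ℓ) → Satisfiable P →
               (∃ λ b → ∀ x → P x → x ≤ b) → ∃ (IsSupremum P)

  open RawSemiringDefinitions
    (Semiring.rawSemiring semiring) public
    using (_^_; sum) renaming (_×_ to _·_)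

  fromℕ : ℕ → Carrier
  fromℕ n = n · 1#

  infix 4 _⟶_
  _⟶_ : (ℕ → Carrier) → Carrier → Set
  f ⟶ l = ∀ ε → 0# < ε →
          ∃ λ N → ∀ n → N ℕ.≤ n → l - ε < f n × f n < l + ε

  expSum : Carrier → ℕ → Carrier
  expSum z N = sum {N} (λ k → z ^ toℕ k * fromℕ (toℕ k ℕ.!) ⁻¹)

  -- Exp z y states that y = exp(z).
  Exp : Carrier → Carrier → Set
  Exp z y = expSum z ⟶ y

  CoreEquationSolvable : ℕ → Pred Carrier 0ℓ
  CoreEquationSolvable d γ =
    γ ≥ 0# × ∃ λ x → x < 1# × Exp (- (γ * (1# - x) ^ d)) x

  IsThreshold : ℕ → Pred Carrier 0ℓ
  IsThreshold d = IsInfimum (CoreEquationSolvable d)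

------------------------------------------------------------------------
-- Finite subsets

subsets : ∀ n → List (Subset n)
subsets zero    = [] ∷ []
subsets (suc n) = map (inside ∷_) (subsets n) ++ map (outside ∷_) (subsets n)

∈-subsets : ∀ {n} (σ : Subset n) → σ ∈ˡ subsets n
∈-subsets []            = here refl
∈-subsets (inside  ∷ σ) = ∈-++⁺ˡ (∈-map⁺ _ (∈-subsets σ))
∈-subsets (outside ∷ σ) =
  ∈-++⁺ʳ (map (inside ∷_) (subsets _)) (∈-map⁺ _ (∈-subsets σ))

⊆∧∣∣≥⇒≡ : ∀ {n} {σ τ : Subset n} → σ ⊆ τ → ∣ τ ∣ ℕ.≤ ∣ σ ∣ → σ ≡ τ
⊆∧∣∣≥⇒≡ {σ = []}          {[]}          σ⊆τ le = refl
⊆∧∣∣≥⇒≡ {σ = inside ∷ _}  {inside ∷ _}  σ⊆τ (s≤s le) =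
  cong (inside ∷_) (⊆∧∣∣≥⇒≡ (drop-∷-⊆ σ⊆τ) le)
⊆∧∣∣≥⇒≡ {σ = inside ∷ _}  {outside ∷ _} σ⊆τ le with () ← σ⊆τ here
⊆∧∣∣≥⇒≡ {σ = outside ∷ _} {inside ∷ _}  σ⊆τ le =
  ⊥-elim (ℕ.<⇒≱ le (p⊆q⇒∣p∣≤∣q∣ (drop-∷-⊆ σ⊆τ)))
⊆∧∣∣≥⇒≡ {σ = outside ∷ _} {outside ∷ _} σ⊆τ le =
  cong (outside ∷_) (⊆∧∣∣≥⇒≡ (drop-∷-⊆ σ⊆τ) le)

------------------------------------------------------------------------
-- Simplicial complexes of dimension at most d on a subset of Fin n
--
-- A k-simplex is a face with k + 1 vertices; the empty face is excluded.

record Complex (d n : ℕ) : Set₁ where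
  field
    Face     : Pred (Subset n) 0ℓ
    face?    : Decidable Face
    nonempty : ∀ {σ} → Face σ → Nonempty σ
    closed   : ∀ {σ τ} → Face σ → τ ⊆ σ → Nonempty τ → Face τ
    dim≤     : ∀ {σ} → Face σ → ∣ σ ∣ ℕ.≤ suc d

open Complex public

module _ {d n : ℕ} (Y : Complex d n) where

  Simplex : ℕ → Pred (Subset n) 0ℓ
  Simplex k σ = Face Y σ × ∣ σ ∣ ≡ suc k

  simplex? : ∀ k → Decidable (Simplex k)
  simplex? k σ = face? Y σ ×-dec ∣ σ ∣ ℕ.≟ suc k

  simplices : ℕ → List (Subset n)
  simplices k = filter (simplex? k) (subsets n)

  -- f k is the number f_k(Y) of k-simplices.
  f : ℕ → ℕ
  f k = length (simplices k)

  degree : Subset n → ℕ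
  degree τ = length (filter (τ ⊆?_) (simplices d))

  -- ∣ τ ∣ ≡ d says that τ is a (d-1)-simplex.
  FreeFace : Pred (Subset n) 0ℓ
  FreeFace τ = Face Y τ × ∣ τ ∣ ≡ d × degree τ ≡ 1

  freeFace? : Decidable FreeFace
  freeFace? τ = face? Y τ ×-dec ∣ τ ∣ ℕ.≟ d ×-dec degree τ ℕ.≟ 1

  ContainsFreeFace : Pred (Subset n) 0ℓ
  ContainsFreeFace σ = ∃ λ τ → FreeFace τ × τ ⊆ σ

  containsFreeFace? : Decidable ContainsFreeFace
  containsFreeFace? σ = anySubset? (λ τ → freeFace? τ ×-dec τ ⊆? σ)

  -- As Y has dimension at most d, the faces of Y that contain a free
  -- face τ are τ itself and the d-simplex containing it.
  R : Complex d n
  R .Face σ = Face Y σ × ¬ ContainsFreeFace σ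
  R .face? σ = face? Y σ ×-dec ¬? (containsFreeFace? σ)
  R .nonempty (σ∈Y , _) = nonempty Y σ∈Y
  R .closed (σ∈Y , kept) τ⊆σ τ≢∅ =
    closed Y σ∈Y τ⊆σ τ≢∅ ,
    λ (ρ , free , ρ⊆τ) → kept (ρ , free , ⊆-trans ρ⊆τ τ⊆σ)
  R .dim≤ (σ∈Y , _) = dim≤ Y σ∈Y

R^ : ∀ {d n} → ℕ → Complex d n → Complex d n
R^ zero    Y = Y
R^ (suc i) Y = R (R^ i Y)

-- While there is a free face, R removes at least one d-simplex, so the
-- sequence R^ i Y is constant from i = f_d(Y) on; see R^-stable below.
R∞ : ∀ {d n} → Complex d n → Complex d n
R∞ {d} Y = R^ (f Y d) Y

------------------------------------------------------------------------
-- Stabilisation of the collapsing sequence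

NoFreeFace : ∀ {d n} → Complex d n → Set
NoFreeFace Y = ∀ τ → ¬ FreeFace Y τ

_≐_ : ∀ {d n} → Complex d n → Complex d n → Set
Y ≐ Z = ∀ σ → (Face Y σ → Face Z σ) × (Face Z σ → Face Y σ)

private
  length-filter-mono : ∀ {A : Set} {P Q : Pred A 0ℓ} (P? : Decidable P)
    (Q? : Decidable Q) → (∀ x → P x → Q x) → ∀ xs →
    length (filter P? xs) ℕ.≤ length (filter Q? xs)
  length-filter-mono P? Q? P⇒Q []       = z≤n
  length-filter-mono P? Q? P⇒Q (x ∷ xs)
    with P? x | Q? x | length-filter-mono P? Q? P⇒Q xs
  ... | yes _ | yes _ | ih = s≤s ih
  ... | yes p | no ¬q | ih = ⊥-elim (¬q (P⇒Q x p))
  ... | no _  | yes _ | ih = ℕ.m≤n⇒m≤1+n ih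
  ... | no _  | no _  | ih = ih

  length-filter-strict : ∀ {A : Set} {P Q : Pred A 0ℓ} (P? : Decidable P)
    (Q? : Decidable Q) → (∀ x → P x → Q x) → ∀ {x xs} → x ∈ˡ xs →
    Q x → ¬ P x → length (filter P? xs) ℕ.< length (filter Q? xs)
  length-filter-strict P? Q? P⇒Q {x} {_ ∷ xs} (here refl) q ¬p
    with P? x | Q? x
  ... | yes p | _     = ⊥-elim (¬p p)
  ... | no _  | yes _ = s≤s (length-filter-mono P? Q? P⇒Q xs)
  ... | no _  | no ¬q = ⊥-elim (¬q q)
  length-filter-strict P? Q? P⇒Q {x} {y ∷ xs} (there x∈xs) q ¬p
    with P? y | Q? y | length-filter-strict P? Q? P⇒Q x∈xs q ¬p
  ... | yes _ | yes _  | ih = s≤s ih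
  ... | yes p | no ¬q′ | ih = ⊥-elim (¬q′ (P⇒Q y p))
  ... | no _  | yes _  | ih = ℕ.m≤n⇒m≤1+n ih
  ... | no _  | no _   | ih = ih

  nonempty-list : ∀ {A : Set} (xs : List A) → length xs ≡ 1 → ∃ (_∈ˡ xs)
  nonempty-list (x ∷ _) _ = x , here refl

module _ {d n : ℕ} (Y : Complex d n) where

  freeFace⇒coface : ∀ {τ} → FreeFace Y τ → ∃ λ σ → Simplex Y d σ × τ ⊆ σ
  freeFace⇒coface {τ} (_ , _ , deg≡1) =
    let σ , σ∈   = nonempty-list (filter (τ ⊆?_) (simplices Y d)) deg≡1
        σ∈Y , τ⊆σ = ∈-filter⁻ (τ ⊆?_) {xs = simplices Y d} σ∈
    in  σ , proj₂ (∈-filter⁻ (simplex? Y d) {xs = subsets n} σ∈Y) , τ⊆σ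

  f-R-< : ∀ {τ} → FreeFace Y τ → f (R Y) d ℕ.< f Y d
  f-R-< {τ} free =
    let σ , simplex , τ⊆σ = freeFace⇒coface free
    in  length-filter-strict (simplex? (R Y) d) (simplex? Y d)
          (λ _ ((σ∈Y , _) , size) → σ∈Y , size) (∈-subsets σ) simplex
          (λ ((_ , kept) , _) → kept (τ , free , τ⊆σ))

  f≡0⇒noFreeFace : f Y d ≡ 0 → NoFreeFace Y
  f≡0⇒noFreeFace f≡0 τ free with () ← subst (f (R Y) d ℕ.<_) f≡0 (f-R-< free)

  noFreeFace⇒R≐ : NoFreeFace Y → R Y ≐ Y
  noFreeFace⇒R≐ none σ = proj₁ , λ σ∈Y → σ∈Y , λ (τ , free , _) → none τ free

module _ {d n : ℕ} where

  simplices-R : (Y : Complex d n) → NoFreeFace Y →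
                simplices (R Y) d ≡ simplices Y d
  simplices-R Y none = filter-≐ (simplex? (R Y) d) (simplex? Y d)
    ((λ ((σ∈Y , _) , size) → σ∈Y , size) ,
     (λ {σ} (σ∈Y , size) → proj₂ (noFreeFace⇒R≐ Y none σ) σ∈Y , size))
    (subsets n)

  noFreeFace-R : (Y : Complex d n) → NoFreeFace Y → NoFreeFace (R Y)
  noFreeFace-R Y none τ ((τ∈Y , _) , size , deg≡1) =
    none τ (τ∈Y , size ,
      trans (cong (λ σs → length (filter (τ ⊆?_) σs)) (sym (simplices-R Y none)))
            deg≡1)

  R^-progress : (Y : Complex d n) → ∀ i →
                NoFreeFace (R^ i Y) ⊎ f (R^ i Y) d ℕ.+ i ℕ.≤ f Y d
  R^-progress Y zero = inj₂ (ℕ.≤-reflexive (ℕ.+-identityʳ _))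
  R^-progress Y (suc i) with R^-progress Y i
  ... | inj₁ none = inj₁ (noFreeFace-R (R^ i Y) none)
  ... | inj₂ bound with anySubset? (freeFace? (R^ i Y))
  ...   | no none = inj₁ (noFreeFace-R (R^ i Y) λ τ free → none (τ , free))
  ...   | yes (_ , free) = inj₂ (begin
    f (R (R^ i Y)) d ℕ.+ suc i   ≡⟨ ℕ.+-suc _ i ⟩
    suc (f (R (R^ i Y)) d) ℕ.+ i ≤⟨ ℕ.+-monoˡ-≤ i (f-R-< (R^ i Y) free) ⟩
    f (R^ i Y) d ℕ.+ i           ≤⟨ bound ⟩
    f Y d                        ∎)
    where open ℕ.≤-Reasoning

  R∞-noFreeFace : (Y : Complex d n) → NoFreeFace (R∞ Y)
  R∞-noFreeFace Y with R^-progress Y (f Y d)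
  ... | inj₁ none  = none
  ... | inj₂ bound = f≡0⇒noFreeFace (R∞ Y)
    (ℕ.n≤0⇒n≡0 (ℕ.+-cancelʳ-≤ (f Y d) _ 0 bound))

  R^-stable : (Y : Complex d n) → ∀ k → R^ (k ℕ.+ f Y d) Y ≐ R∞ Y
  R^-stable Y k = proj₂ (go k)
    where
    go : ∀ k → NoFreeFace (R^ (k ℕ.+ f Y d) Y) × R^ (k ℕ.+ f Y d) Y ≐ R∞ Y
    go zero    = R∞-noFreeFace Y , λ σ → (λ σ∈ → σ∈) , (λ σ∈ → σ∈)
    go (suc k) =
      let none , same = go k
          Z           = R^ (k ℕ.+ f Y d) Y
      in  noFreeFace-R Z none ,
          λ σ → (λ (σ∈Z , _) → proj₁ (same σ) σ∈Z) ,
                (λ σ∈R∞ → proj₂ (noFreeFace⇒R≐ Z none σ) (proj₂ (same σ) σ∈R∞))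

------------------------------------------------------------------------
-- The random complex Y_d(n,p)

-- The d-simplices of the full simplex on Fin n.
dSimplices : ∀ d n → List (Subset n)
dSimplices d n = filter (λ σ → ∣ σ ∣ ℕ.≟ suc d) (subsets n)

-- An outcome is the set of (indices of) included d-simplices.
Outcome : ℕ → ℕ → Set
Outcome d n = Subset (length (dSimplices d n))

module _ {d n : ℕ} (ω : Outcome d n) where

  Included : Pred (Subset n) 0ℓ
  Included σ = ∃ λ i → i ∈ ω × lookup (dSimplices d n) i ≡ σ

  included? : Decidable Included
  included? σ = Fin.any? λ i →
    i ∈? ω ×-dec Vec.≡-dec Bool._≟_ (lookup (dSimplices d n) i) σ

  included-size : ∀ {σ} → Included σ → ∣ σ ∣ ≡ suc d
  included-size (i , _ , refl) =
    proj₂ (∈-filter⁻ (λ σ → ∣ σ ∣ ℕ.≟ suc d) {xs = subsets n} (∈-lookup i))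

  -- The full (d-1)-skeleton together with the included d-simplices.
  complex : Complex d n
  complex .Face σ = Nonempty σ × (∣ σ ∣ ℕ.≤ d ⊎ Included σ)
  complex .face? σ = nonempty? σ ×-dec (∣ σ ∣ ℕ.≤? d ⊎-dec included? σ)
  complex .nonempty = proj₁
  complex .closed (_ , inj₁ small) τ⊆σ τ≢∅ =
    τ≢∅ , inj₁ (ℕ.≤-trans (p⊆q⇒∣p∣≤∣q∣ τ⊆σ) small)
  complex .closed {σ} {τ} (_ , inj₂ inc) τ⊆σ τ≢∅ with ∣ τ ∣ ℕ.≤? d
  ... | yes small = τ≢∅ , inj₁ small
  ... | no large  = τ≢∅ , inj₂ (subst Included (sym τ≡σ) inc)
    where
    τ≡σ : τ ≡ σ
    τ≡σ = ⊆∧∣∣≥⇒≡ τ⊆σ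
      (ℕ.≤-trans (ℕ.≤-reflexive (included-size inc)) (ℕ.≰⇒> large))
  complex .dim≤ (_ , inj₁ small) = ℕ.m≤n⇒m≤1+n small
  complex .dim≤ (_ , inj₂ inc)   = ℕ.≤-reflexive (included-size inc)

module Probability (ℝ : CompleteOrderedField) where
  open CompleteOrderedField ℝ

  weight : ∀ {m} → Carrier → Subset m → Carrier
  weight p ω = p ^ ∣ ω ∣ * (1# - p) ^ ∣ ∁ ω ∣

  -- The probability that Y ∈ Y_d(n,p) satisfies E.
  Pr : ∀ d n (p : Carrier) {E : Pred (Complex d n) 0ℓ} → Decidable E → Carrier
  Pr d n p E? =
    foldr _+_ 0# (map (weight p) (filter (λ ω → E? (complex ω)) (subsets _)))

{-# OPTIONS --safe #-}
module Submission where

-- By Markov's inequality it suffices to bound the probability that a given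
-- d-simplex lies in R∞.  As R∞ has no free face, every facet of such a simplex
-- leads on to another simplex of R∞, for any number k of rounds (Survive).
-- Explore these branches depth first, revealing a simplex only when it is met.
-- A newly found vertex makes the facets through it unexplored, so the branches
-- are independent unless a revealed simplex has all its vertices among those
-- met before, which happens with probability O(1/n).  Hence a branch survives
-- k rounds with probability at most q_k + O(1/n), where q_0 = 1 and
-- q_{k+1} = 1 - (1 - (c/n) q_k^d)^n → 1 - exp(-c q_k^d).  If the q_k did not
-- tend to 0, the map x ↦ 1 - exp(-c x^d) would have a positive fixed point and
-- the core equation would be solvable for c < γ_d.

open import Defs
open import Algebra.Bundles using (CommutativeRing; RawRing)
import Algebra.Properties.CommutativeMonoid.Sum as SumProperties
import Algebra.Properties.Ring as RingProperties
import Algebra.Properties.Semiring.Exp as ExpProperties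
import Algebra.Properties.Semiring.Mult as MultProperties
import Algebra.Properties.Semiring.Mult.TCOptimised as MultTCProperties
import Algebra.Solver.Ring as RingSolver
open import Algebra.Solver.Ring.AlmostCommutativeRing using (fromCommutativeRing; _-Raw-AlmostCommutative⟶_)
open import Data.Bool using (Bool; true; false; if_then_else_; _∧_; _∨_)
open import Data.Empty using (⊥; ⊥-elim)
open import Data.Fin using (Fin; zero; suc; toℕ)
import Data.Fin.Properties as Fin
open import Data.Fin.Subset as Subset using (Subset; inside; outside; ∣_∣; _∈_; _∉_; _⊆_; _∪_; ⁅_⁆)
  renaming (_-_ to infixl 6 _∖_)
open import Data.Fin.Subset.Properties
  using ( _∈?_; _⊆?_; ∣⊥∣≡0; ∪-identityʳ; p─⊥≡p; p─q⊆p; x∈p∪q⁺; x∈p∪q⁻; x∈⁅x⁆; x∈⁅y⁆⇒x≡y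
        ; x∈p∧x≢y⇒x∈p-y; p⊆q⇒∣p∣≤∣q∣)
open import Data.Integer as ℤ using (ℤ; +_; -[1+_]; _⊖_; _◃_)
import Data.Integer.Properties as ℤ
open import Data.List as List using (List; []; _∷_; _++_)
open import Data.List.Membership.Propositional using () renaming (_∈_ to _∈ˡ_; _∉_ to _∉ˡ_)
open import Data.List.Membership.Propositional.Properties
  using (∈-filter⁺; ∈-filter⁻; ∈-allFin; ∈-map⁻; ∈-lookup)
import Data.List.Properties as List
open import Data.List.Relation.Unary.All as All using (All; []; _∷_)
import Data.List.Relation.Unary.All.Properties as All
open import Data.List.Relation.Unary.AllPairs as AllPairs using (AllPairs; []; _∷_)
import Data.List.Relation.Unary.AllPairs.Properties as AllPairs
open import Data.List.Relation.Unary.Any as Any using (Any; here; there; any?)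
import Data.List.Relation.Unary.Any.Properties as Any
open import Data.List.Relation.Unary.Unique.Propositional using (Unique)
import Data.List.Relation.Unary.Unique.Propositional.Properties as Unique
open import Data.Maybe using (Maybe; just; nothing)
open import Data.Maybe.Properties using (just-injective)
open import Data.Nat as ℕ using (ℕ; zero; suc; z≤n; s≤s)
import Data.Nat.Properties as ℕ
open import Data.Product using (∃; _×_; _,_; proj₁; proj₂)
import Data.Sign as Sign
open import Data.Sum using (_⊎_; inj₁; inj₂)
open import Data.Unit using (⊤; tt)
open import Data.Vec as Vec using (Vec; []; _∷_; lookup; _[_]≔_; here; there)
import Data.Vec.Properties as Vec
open import Function using (_∘_; _⟨_⟩_)
open import Level using (0ℓ)
open import Relation.Binary using (IsPreorder; IsStrictTotalOrder; tri<; tri≈; tri>)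
open import Relation.Binary.PropositionalEquality as ≡ using (_≡_)
import Relation.Binary.Reasoning.Base.Triple as TripleReasoning
open import Relation.Nullary using (¬_; Dec; yes; no)
open import Relation.Nullary.Decidable using (does; _×-dec_; ¬?)
open import Relation.Unary using (Pred; Decidable)

-- Independence is never stated as a product formula. `SurvivalBound` quantifies over all payoffs
-- that depend on the fate of one branch and on the rest of the complex, given a bound for what is
-- pending in every reachable state. In this form it can be applied with the other facets and
-- simplices folded into the payoff, so conjunctions and disjunctions of branches compose. The error
-- has to survive this composition although the set `U` of vertices met is random and may be large.
-- A weight exponential in the size of `U` achieves this: one level multiplies it by about (1 +
-- O(1/n))^n, which stays bounded for fixed k. The exponential is only a relation, the convergence
-- of its series. At arguments -z with z nonnegative, existence of its value and convergence of (1 -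
-- z/n)^n to that value are proved together, and the order properties of exp are then read off from
-- the powers. No limit of q_k in n is formed: the infimum of all bounds that hold at some depth for
-- all large n takes its place.

-- Ring solving with integer coefficients

module RingSolving (R : CommutativeRing 0ℓ 0ℓ) where
  open CommutativeRing R hiding (zero)
  open RingProperties ring
  open MultTCProperties semiring using (1+×; ×1-homo-*) renaming (_×_ to _×′_; ×-homo-+ to ×′-homo-+)
  open import Relation.Binary.Reasoning.Setoid setoid

  -- With the optimised multiple `_×′_`, `con (+ 1)` and `con (+ 2)` reduce to `1#` and `1# + 1#`,
  -- so solved identities match goals written with these terms.
  fromℤ : ℤ → Carrier
  fromℤ (+ n)    = n ×′ 1#
  fromℤ -[1+ n ] = - (suc n ×′ 1#)

  private
    fromℤ-neg : ∀ i → fromℤ (ℤ.- i) ≈ - fromℤ i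
    fromℤ-neg (+ zero)  = sym -0#≈0#
    fromℤ-neg (+ suc n) = refl
    fromℤ-neg -[1+ n ]  = sym (-‿involutive _)

    cancel : ∀ a b c → (a + b) + (- (a + c)) ≈ b - c
    cancel a b c = begin
      (a + b) + (- (a + c))     ≈⟨ +-congˡ (-‿+-comm a c) ⟨
      (a + b) + (- a + - c)     ≈⟨ +-congʳ (+-comm a b) ⟩
      (b + a) + (- a + - c)     ≈⟨ +-assoc b a _ ⟩
      b + (a + (- a + - c))     ≈⟨ +-congˡ (+-assoc a (- a) (- c)) ⟨
      b + ((a + - a) + - c)     ≈⟨ +-congˡ (+-congʳ (-‿inverseʳ a)) ⟩
      b + (0# + - c)            ≈⟨ +-congˡ (+-identityˡ _) ⟩
      b - c                     ∎

    fromℤ-⊖ : ∀ m n → fromℤ (m ⊖ n) ≈ m ×′ 1# - n ×′ 1#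
    fromℤ-⊖ m       zero    = sym (trans (+-congˡ -0#≈0#) (+-identityʳ _))
    fromℤ-⊖ zero    (suc n) = sym (+-identityˡ _)
    fromℤ-⊖ (suc m) (suc n) = begin
      fromℤ (suc m ⊖ suc n)              ≡⟨ ≡.cong fromℤ (ℤ.[1+m]⊖[1+n]≡m⊖n m n) ⟩
      fromℤ (m ⊖ n)                      ≈⟨ fromℤ-⊖ m n ⟩
      m ×′ 1# - n ×′ 1#                  ≈⟨ cancel 1# _ _ ⟨
      1# + m ×′ 1# - (1# + n ×′ 1#)      ≈⟨ +-cong (1+× m 1#) (-‿cong (1+× n 1#)) ⟨
      suc m ×′ 1# - suc n ×′ 1#          ∎

    fromℤ-+ : ∀ i j → fromℤ (i ℤ.+ j) ≈ fromℤ i + fromℤ j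
    fromℤ-+ (+ m)    (+ n)    = ×′-homo-+ 1# m n
    fromℤ-+ (+ m)    -[1+ n ] = fromℤ-⊖ m (suc n)
    fromℤ-+ -[1+ m ] (+ n)    = trans (fromℤ-⊖ n (suc m)) (+-comm _ _)
    fromℤ-+ -[1+ m ] -[1+ n ] = begin
      - (suc (suc (m ℕ.+ n)) ×′ 1#)      ≡⟨ ≡.cong (λ k → - (suc k ×′ 1#)) (ℕ.+-suc m n) ⟨
      - ((suc m ℕ.+ suc n) ×′ 1#)        ≈⟨ -‿cong (×′-homo-+ 1# (suc m) (suc n)) ⟩
      - (suc m ×′ 1# + suc n ×′ 1#)      ≈⟨ -‿+-comm _ _ ⟨
      - (suc m ×′ 1#) - (suc n ×′ 1#)    ∎

    fromℤ-* : ∀ i j → fromℤ (i ℤ.* j) ≈ fromℤ i * fromℤ j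
    fromℤ-* (+ m)    (+ n)    = trans (reflexive (≡.cong fromℤ (ℤ.+◃n≡+n (m ℕ.* n)))) (×1-homo-* m n)
    fromℤ-* (+ m)    -[1+ n ] = begin
      fromℤ (Sign.- ◃ (m ℕ.* suc n))     ≡⟨ ≡.cong fromℤ (ℤ.-◃n≡-n (m ℕ.* suc n)) ⟩
      fromℤ (ℤ.- (+ (m ℕ.* suc n)))      ≈⟨ fromℤ-neg (+ (m ℕ.* suc n)) ⟩
      - ((m ℕ.* suc n) ×′ 1#)            ≈⟨ -‿cong (×1-homo-* m (suc n)) ⟩
      - (m ×′ 1# * (suc n ×′ 1#))        ≈⟨ -‿distribʳ-* _ _ ⟩
      m ×′ 1# * - (suc n ×′ 1#)          ∎
    fromℤ-* -[1+ m ] (+ n)    = begin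
      fromℤ (Sign.- ◃ (suc m ℕ.* n))     ≡⟨ ≡.cong fromℤ (ℤ.-◃n≡-n (suc m ℕ.* n)) ⟩
      fromℤ (ℤ.- (+ (suc m ℕ.* n)))      ≈⟨ fromℤ-neg (+ (suc m ℕ.* n)) ⟩
      - ((suc m ℕ.* n) ×′ 1#)            ≈⟨ -‿cong (×1-homo-* (suc m) n) ⟩
      - (suc m ×′ 1# * (n ×′ 1#))        ≈⟨ -‿distribˡ-* _ _ ⟩
      - (suc m ×′ 1#) * (n ×′ 1#)        ∎
    fromℤ-* -[1+ m ] -[1+ n ] = begin
      fromℤ (Sign.+ ◃ (suc m ℕ.* suc n)) ≡⟨ ≡.cong fromℤ (ℤ.+◃n≡+n (suc m ℕ.* suc n)) ⟩
      (suc m ℕ.* suc n) ×′ 1#            ≈⟨ ×1-homo-* (suc m) (suc n) ⟩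
      suc m ×′ 1# * suc n ×′ 1#          ≈⟨ -‿involutive _ ⟨
      - - (suc m ×′ 1# * suc n ×′ 1#)    ≈⟨ -‿cong (-‿distribˡ-* _ _) ⟩
      - (- (suc m ×′ 1#) * suc n ×′ 1#)  ≈⟨ -‿distribʳ-* _ _ ⟩
      - (suc m ×′ 1#) * - (suc n ×′ 1#)  ∎

    ℤ-rawRing : RawRing 0ℓ 0ℓ
    ℤ-rawRing = CommutativeRing.rawRing ℤ.+-*-commutativeRing

    homomorphism : ℤ-rawRing -Raw-AlmostCommutative⟶ fromCommutativeRing R
    homomorphism = record
      { ⟦_⟧    = fromℤ
      ; +-homo = fromℤ-+
      ; *-homo = fromℤ-*
      ; -‿homo = fromℤ-neg
      ; 0-homo = refl
      ; 1-homo = refl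
      }

    fromℤ≟ : ∀ i j → Maybe (fromℤ i ≈ fromℤ j)
    fromℤ≟ i j with i ℤ.≟ j
    ... | yes i≡j = just (reflexive (≡.cong fromℤ i≡j))
    ... | no _    = nothing

  open RingSolver ℤ-rawRing (fromCommutativeRing R) homomorphism fromℤ≟ public
    using (solve; _:=_; _:+_; _:*_; _:-_; :-_; con; _:^_)

-- Ordered-field arithmetic and the Archimedean property

module OrderedFieldProperties (ℝ : CompleteOrderedField) where
  open CompleteOrderedField ℝ hiding (zero)
  open RingSolving commutativeRing public
  open MultProperties semiring using (×1-homo-*)
  open ExpProperties semiring public using (^-congˡ; ^-assocʳ)

  module STO = IsStrictTotalOrder isStrictTotalOrder

  <⇒≤ : ∀ {x y} → x < y → x ≤ y
  <⇒≤ x<y y<x = STO.irrefl refl (STO.trans x<y y<x)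

  ≤-reflexive : ∀ {x y} → x ≈ y → x ≤ y
  ≤-reflexive x≈y y<x = STO.irrefl (sym x≈y) y<x

  ≤-refl : ∀ {x} → x ≤ x
  ≤-refl = ≤-reflexive refl

  ≤⇒<⊎≈ : ∀ {x y} → x ≤ y → x < y ⊎ x ≈ y
  ≤⇒<⊎≈ {x} {y} x≤y with compare x y
  ... | tri< x<y _ _ = inj₁ x<y
  ... | tri≈ _ x≈y _ = inj₂ x≈y
  ... | tri> _ _ y<x = ⊥-elim (x≤y y<x)

  <-≤-trans : ∀ {x y z} → x < y → y ≤ z → x < z
  <-≤-trans x<y y≤z with ≤⇒<⊎≈ y≤z
  ... | inj₁ y<z = STO.trans x<y y<z
  ... | inj₂ y≈z = proj₁ STO.<-resp-≈ y≈z x<y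

  ≤-<-trans : ∀ {x y z} → x ≤ y → y < z → x < z
  ≤-<-trans x≤y y<z with ≤⇒<⊎≈ x≤y
  ... | inj₁ x<y = STO.trans x<y y<z
  ... | inj₂ x≈y = proj₂ STO.<-resp-≈ (sym x≈y) y<z

  ≤-trans : ∀ {x y z} → x ≤ y → y ≤ z → x ≤ z
  ≤-trans x≤y y≤z z<x = x≤y (≤-<-trans y≤z z<x)

  ≤-antisym : ∀ {x y} → x ≤ y → y ≤ x → x ≈ y
  ≤-antisym x≤y y≤x with ≤⇒<⊎≈ x≤y
  ... | inj₁ x<y = ⊥-elim (y≤x x<y)
  ... | inj₂ x≈y = x≈y

  ≤-total : ∀ x y → x ≤ y ⊎ y ≤ x
  ≤-total x y with compare x y
  ... | tri< x<y _ _ = inj₁ (<⇒≤ x<y)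
  ... | tri≈ _ x≈y _ = inj₁ (≤-reflexive x≈y)
  ... | tri> _ _ y<x = inj₂ (<⇒≤ y<x)

  ≤-isPreorder : IsPreorder _≈_ _≤_
  ≤-isPreorder = record
    { isEquivalence = isEquivalence
    ; reflexive     = ≤-reflexive
    ; trans         = ≤-trans
    }

  module ≤-Reasoning = TripleReasoning ≤-isPreorder
    (λ x<y y<x → <⇒≤ x<y y<x) STO.trans STO.<-resp-≈ <⇒≤ <-≤-trans ≤-<-trans

  +-monoʳ-≤ : ∀ x {y z} → y ≤ z → x + y ≤ x + z
  +-monoʳ-≤ x y≤z with ≤⇒<⊎≈ y≤z
  ... | inj₁ y<z = <⇒≤ (+-monoʳ-< x y<z)
  ... | inj₂ y≈z = ≤-reflexive (+-congˡ y≈z)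

  +-monoˡ-≤ : ∀ x {y z} → y ≤ z → y + x ≤ z + x
  +-monoˡ-≤ x {y} {z} y≤z = begin
    y + x ≈⟨ +-comm y x ⟩
    x + y ≤⟨ +-monoʳ-≤ x y≤z ⟩
    x + z ≈⟨ +-comm x z ⟩
    z + x ∎
    where open ≤-Reasoning

  +-mono-≤ : ∀ {w x y z} → w ≤ x → y ≤ z → w + y ≤ x + z
  +-mono-≤ w≤x y≤z = ≤-trans (+-monoˡ-≤ _ w≤x) (+-monoʳ-≤ _ y≤z)

  +-monoˡ-< : ∀ x {y z} → y < z → y + x < z + x
  +-monoˡ-< x {y} {z} y<z = begin-strict
    y + x ≈⟨ +-comm y x ⟩
    x + y <⟨ +-monoʳ-< x y<z ⟩
    x + z ≈⟨ +-comm x z ⟩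
    z + x ∎
    where open ≤-Reasoning

  0≤y-x : ∀ {x y} → x ≤ y → 0# ≤ y - x
  0≤y-x {x} {y} x≤y = ≤-trans (≤-reflexive (sym (-‿inverseʳ x))) (+-monoˡ-≤ (- x) x≤y)

  0<y-x : ∀ {x y} → x < y → 0# < y - x
  0<y-x {x} {y} x<y = ≤-<-trans (≤-reflexive (sym (-‿inverseʳ x))) (+-monoˡ-< (- x) x<y)

  -- An inequality is reduced to the ring identity y ≈ x + e with 0 ≤ e.
  ≤-by : ∀ {x y e} → 0# ≤ e → y ≈ x + e → x ≤ y
  ≤-by {x} {y} {e} 0≤e y≈x+e = begin
    x      ≈⟨ +-identityʳ x ⟨
    x + 0# ≤⟨ +-monoʳ-≤ x 0≤e ⟩
    x + e  ≈⟨ y≈x+e ⟨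
    y      ∎
    where open ≤-Reasoning

  <-by : ∀ {x y e} → 0# < e → y ≈ x + e → x < y
  <-by {x} {y} {e} 0<e y≈x+e = begin-strict
    x      ≈⟨ +-identityʳ x ⟨
    x + 0# <⟨ +-monoʳ-< x 0<e ⟩
    x + e  ≈⟨ y≈x+e ⟨
    y      ∎
    where open ≤-Reasoning

  0≤x+y : ∀ {x y} → 0# ≤ x → 0# ≤ y → 0# ≤ x + y
  0≤x+y 0≤x 0≤y = ≤-trans (≤-reflexive (sym (+-identityʳ 0#))) (+-mono-≤ 0≤x 0≤y)

  0≤x*y : ∀ {x y} → 0# ≤ x → 0# ≤ y → 0# ≤ x * y
  0≤x*y {x} {y} 0≤x 0≤y with ≤⇒<⊎≈ 0≤x | ≤⇒<⊎≈ 0≤y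
  ... | inj₁ 0<x | inj₁ 0<y = <⇒≤ (*-pos 0<x 0<y)
  ... | inj₂ 0≈x | _        = ≤-reflexive (trans (sym (zeroˡ y)) (*-congʳ 0≈x))
  ... | inj₁ _   | inj₂ 0≈y = ≤-reflexive (trans (sym (zeroʳ x)) (*-congˡ 0≈y))

  *-monoʳ-≤ : ∀ {x y z} → 0# ≤ x → y ≤ z → x * y ≤ x * z
  *-monoʳ-≤ {x} {y} {z} 0≤x y≤z = ≤-by (0≤x*y 0≤x (0≤y-x y≤z))
    (solve 3 (λ x y z → x :* z := x :* y :+ x :* (z :- y)) refl x y z)

  *-monoˡ-≤ : ∀ {x y z} → 0# ≤ x → y ≤ z → y * x ≤ z * x
  *-monoˡ-≤ {x} {y} {z} 0≤x y≤z = ≤-by (0≤x*y (0≤y-x y≤z) 0≤x)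
    (solve 3 (λ x y z → z :* x := y :* x :+ (z :- y) :* x) refl x y z)

  *-mono-≤ : ∀ {w x y z} → 0# ≤ w → 0# ≤ y → w ≤ x → y ≤ z → w * y ≤ x * z
  *-mono-≤ 0≤w 0≤y w≤x y≤z =
    ≤-trans (*-monoˡ-≤ 0≤y w≤x) (*-monoʳ-≤ (≤-trans 0≤w w≤x) y≤z)

  *-monoʳ-< : ∀ {x y z} → 0# < x → y < z → x * y < x * z
  *-monoʳ-< {x} {y} {z} 0<x y<z = <-by (*-pos 0<x (0<y-x y<z))
    (solve 3 (λ x y z → x :* z := x :* y :+ x :* (z :- y)) refl x y z)

  *-cancelˡ-≤ : ∀ {x y z} → 0# < x → x * y ≤ x * z → y ≤ z
  *-cancelˡ-≤ 0<x xy≤xz z<y = xy≤xz (*-monoʳ-< 0<x z<y)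

  neg-mono-≤ : ∀ {x y} → x ≤ y → - y ≤ - x
  neg-mono-≤ {x} {y} x≤y = ≤-by (0≤y-x x≤y)
    (solve 2 (λ x y → :- x := :- y :+ (y :- x)) refl x y)

  neg-mono-< : ∀ {x y} → x < y → - y < - x
  neg-mono-< {x} {y} x<y = <-by (0<y-x x<y)
    (solve 2 (λ x y → :- x := :- y :+ (y :- x)) refl x y)

  0≤1 : 0# ≤ 1#
  0≤1 = <⇒≤ 0<1

  1≤2 : 1# ≤ 1# + 1#
  1≤2 = ≤-by 0≤1 refl

  0<2 : 0# < 1# + 1#
  0<2 = <-≤-trans 0<1 1≤2

  x-y≤x : ∀ {x y} → 0# ≤ y → x - y ≤ x
  x-y≤x {x} {y} 0≤y = ≤-by 0≤y (solve 2 (λ x y → x := (x :- y) :+ y) refl x y)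

  0<⇒≉0 : ∀ {x} → 0# < x → ¬ (x ≈ 0#)
  0<⇒≉0 0<x x≈0 = STO.irrefl (sym x≈0) 0<x

  ⁻¹-pos : ∀ {x} → 0# < x → 0# < x ⁻¹
  ⁻¹-pos {x} 0<x with compare 0# (x ⁻¹)
  ... | tri< 0<x⁻¹ _ _ = 0<x⁻¹
  ... | tri≈ _ 0≈x⁻¹ _ = ⊥-elim (STO.irrefl
    (trans (sym (zeroʳ x)) (trans (*-congˡ 0≈x⁻¹) (⁻¹-inverseʳ (0<⇒≉0 0<x)))) 0<1)
  ... | tri> _ _ x⁻¹<0 = ⊥-elim (<⇒≤ 0<1 (begin-strict
    1#         ≈⟨ ⁻¹-inverseʳ (0<⇒≉0 0<x) ⟨
    x * x ⁻¹   <⟨ *-monoʳ-< 0<x x⁻¹<0 ⟩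
    x * 0#     ≈⟨ zeroʳ x ⟩
    0#         ∎))
    where open ≤-Reasoning

  x*y⁻¹*y≈x : ∀ x {y} → 0# < y → x * y ⁻¹ * y ≈ x
  x*y⁻¹*y≈x x {y} 0<y = begin
    x * y ⁻¹ * y   ≈⟨ *-assoc x (y ⁻¹) y ⟩
    x * (y ⁻¹ * y) ≈⟨ *-congˡ (*-comm (y ⁻¹) y) ⟩
    x * (y * y ⁻¹) ≈⟨ *-congˡ (⁻¹-inverseʳ (0<⇒≉0 0<y)) ⟩
    x * 1#         ≈⟨ *-identityʳ x ⟩
    x              ∎
    where open import Relation.Binary.Reasoning.Setoid setoid

  x≤y*z⇒x*z⁻¹≤y : ∀ {x y z} → 0# < z → x ≤ y * z → x * z ⁻¹ ≤ y
  x≤y*z⇒x*z⁻¹≤y {x} {y} {z} 0<z x≤y*z = *-cancelˡ-≤ 0<z (begin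
    z * (x * z ⁻¹) ≈⟨ *-comm z _ ⟩
    x * z ⁻¹ * z   ≈⟨ x*y⁻¹*y≈x x 0<z ⟩
    x              ≤⟨ x≤y*z ⟩
    y * z          ≈⟨ *-comm y z ⟩
    z * y          ∎)
    where open ≤-Reasoning

  half-pos : ∀ {ε} → 0# < ε → 0# < ε * (1# + 1#) ⁻¹
  half-pos 0<ε = *-pos 0<ε (⁻¹-pos 0<2)

  half+half : ∀ ε → ε * (1# + 1#) ⁻¹ + ε * (1# + 1#) ⁻¹ ≈ ε
  half+half ε = trans (solve 1 (λ h → h :+ h := h :* con (+ 2)) refl (ε * (1# + 1#) ⁻¹))
                      (x*y⁻¹*y≈x ε 0<2)

  0≤^ : ∀ {x} n → 0# ≤ x → 0# ≤ x ^ n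
  0≤^ zero    0≤x = 0≤1
  0≤^ (suc n) 0≤x = 0≤x*y 0≤x (0≤^ n 0≤x)

  0<^ : ∀ {x} n → 0# < x → 0# < x ^ n
  0<^ zero    0<x = 0<1
  0<^ (suc n) 0<x = *-pos 0<x (0<^ n 0<x)

  ^-mono-≤ : ∀ {x y} n → 0# ≤ x → x ≤ y → x ^ n ≤ y ^ n
  ^-mono-≤ zero    0≤x x≤y = ≤-refl
  ^-mono-≤ (suc n) 0≤x x≤y = *-mono-≤ 0≤x (0≤^ n 0≤x) x≤y (^-mono-≤ n 0≤x x≤y)

  1^n≈1 : ∀ n → 1# ^ n ≈ 1#
  1^n≈1 zero    = refl
  1^n≈1 (suc n) = trans (*-identityˡ _) (1^n≈1 n)

  ^≤1 : ∀ {x} n → 0# ≤ x → x ≤ 1# → x ^ n ≤ 1#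
  ^≤1 n 0≤x x≤1 = ≤-trans (^-mono-≤ n 0≤x x≤1) (≤-reflexive (1^n≈1 n))

  1≤^ : ∀ {x} n → 1# ≤ x → 1# ≤ x ^ n
  1≤^ n 1≤x = ≤-trans (≤-reflexive (sym (1^n≈1 n))) (^-mono-≤ n 0≤1 1≤x)

  fromℕ-* : ∀ m n → fromℕ (m ℕ.* n) ≈ fromℕ m * fromℕ n
  fromℕ-* = ×1-homo-*

  fromℕ-^ : ∀ m n → fromℕ (m ℕ.^ n) ≈ fromℕ m ^ n
  fromℕ-^ m zero    = +-identityʳ 1#
  fromℕ-^ m (suc n) = trans (fromℕ-* m (m ℕ.^ n)) (*-congˡ (fromℕ-^ m n))

  0≤fromℕ : ∀ n → 0# ≤ fromℕ n
  0≤fromℕ zero    = ≤-refl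
  0≤fromℕ (suc n) = 0≤x+y 0≤1 (0≤fromℕ n)

  0<fromℕ-suc : ∀ n → 0# < fromℕ (suc n)
  0<fromℕ-suc n = <-≤-trans 0<1 (≤-by (0≤fromℕ n) refl)

  0<fromℕ : ∀ {n} → 0 ℕ.< n → 0# < fromℕ n
  0<fromℕ {suc n} _ = 0<fromℕ-suc n

  fromℕ-mono-≤ : ∀ {m n} → m ℕ.≤ n → fromℕ m ≤ fromℕ n
  fromℕ-mono-≤ {n = n} z≤n       = 0≤fromℕ n
  fromℕ-mono-≤         (s≤s m≤n) = +-monoʳ-≤ 1# (fromℕ-mono-≤ m≤n)

  -- The naturals not above `x` have a supremum `s`. One of them exceeds `s - 1`, so its successor
  -- exceeds `s` and no longer belongs to the set.
  archimedean : ∀ x → ∃ λ n → x < fromℕ n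
  archimedean x with x <? 0#
  ... | yes x<0 = 0 , x<0
  ... | no 0≤x = suc n , x<1+n
    where
    P : Carrier → Set
    P y = ∃ λ n → y ≈ fromℕ n × y ≤ x

    supremum : ∃ (IsSupremum P)
    supremum = complete P (0# , 0 , refl , 0≤x) (x , λ y (_ , _ , y≤x) → y≤x)

    s : Carrier
    s = proj₁ supremum

    nearby : ∃ λ y → P y × s - 1# < y
    nearby = proj₂ (proj₂ supremum) (s - 1#)
      (<-by 0<1 (solve 1 (λ s → s := (s :- con (+ 1)) :+ con (+ 1)) refl s))

    n : ℕ
    n = proj₁ (proj₁ (proj₂ nearby))

    s<1+n : s < fromℕ (suc n)
    s<1+n = begin-strict
      s                      ≈⟨ solve 1 (λ s → s := con (+ 1) :+ (s :- con (+ 1))) refl s ⟩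
      1# + (s - 1#)          <⟨ +-monoʳ-< 1# (proj₂ (proj₂ nearby)) ⟩
      1# + proj₁ nearby      ≈⟨ +-congˡ (proj₁ (proj₂ (proj₁ (proj₂ nearby)))) ⟩
      fromℕ (suc n)          ∎
      where open ≤-Reasoning

    x<1+n : x < fromℕ (suc n)
    x<1+n with x <? fromℕ (suc n)
    ... | yes x<1+n = x<1+n
    ... | no 1+n≤x  = ⊥-elim (proj₁ (proj₂ supremum) _ (suc n , refl , 1+n≤x) s<1+n)

  eventually-small : ∀ x {ε} → 0# < ε → ∃ λ N → ∀ n → N ℕ.≤ n → x < ε * fromℕ n
  eventually-small x {ε} 0<ε =
    let N , x/ε<N = archimedean (x * ε ⁻¹)
    in  N , λ n N≤n → begin-strict
      x               ≈⟨ x*y⁻¹*y≈x x 0<ε ⟨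
      x * ε ⁻¹ * ε    ≈⟨ *-comm _ ε ⟩
      ε * (x * ε ⁻¹)  <⟨ *-monoʳ-< 0<ε x/ε<N ⟩
      ε * fromℕ N     ≤⟨ *-monoʳ-≤ (<⇒≤ 0<ε) (fromℕ-mono-≤ N≤n) ⟩
      ε * fromℕ n     ∎
    where open ≤-Reasoning

-- Expectation conditional on the revealed coordinates

-- The state of each coordinate: revealed (just), or still random (nothing).
Knowledge : ℕ → Set
Knowledge = Vec (Maybe Bool)

_⊑_ : ∀ {m} → Knowledge m → Subset m → Set
ρ ⊑ Y = ∀ i b → lookup ρ i ≡ just b → lookup Y i ≡ b

module Expectation (ℝ : CompleteOrderedField) (p : CompleteOrderedField.Carrier ℝ)
  (0≤p : CompleteOrderedField._≤_ ℝ (CompleteOrderedField.0# ℝ) p)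
  (p≤1 : CompleteOrderedField._≤_ ℝ p (CompleteOrderedField.1# ℝ)) where
  open CompleteOrderedField ℝ hiding (zero)
  open OrderedFieldProperties ℝ

  -- Conditional expectation given `ρ`: revealed coordinates are substituted and only the others
  -- averaged, so that learning one more coordinate is an update of `ρ`.
  𝔼 : ∀ {m} → Knowledge m → (Subset m → Carrier) → Carrier
  𝔼 []            F = F []
  𝔼 (just b  ∷ ρ) F = 𝔼 ρ (λ Y → F (b ∷ Y))
  𝔼 (nothing ∷ ρ) F = p * 𝔼 ρ (λ Y → F (true ∷ Y)) + (1# - p) * 𝔼 ρ (λ Y → F (false ∷ Y))

  0≤1-p : 0# ≤ 1# - p
  0≤1-p = 0≤y-x p≤1

  p+[1-p] : ∀ x → p * x + (1# - p) * x ≈ x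
  p+[1-p] x = solve 2 (λ p x → p :* x :+ (con (+ 1) :- p) :* x := x) refl p x

  private
    ⊑-just : ∀ {m} {ρ : Knowledge m} {Y b} → ρ ⊑ Y → (just b ∷ ρ) ⊑ (b ∷ Y)
    ⊑-just ρ⊑Y zero    _ ≡.refl = ≡.refl
    ⊑-just ρ⊑Y (suc i) b eq     = ρ⊑Y i b eq

    ⊑-nothing : ∀ {m} {ρ : Knowledge m} {Y b} → ρ ⊑ Y → (nothing ∷ ρ) ⊑ (b ∷ Y)
    ⊑-nothing ρ⊑Y (suc i) b eq = ρ⊑Y i b eq

  -- The comparison is required only on outcomes that agree with `ρ`. This is how revealed facts
  -- enter an estimate.
  𝔼-mono : ∀ {m} (ρ : Knowledge m) {F G} → (∀ Y → ρ ⊑ Y → F Y ≤ G Y) → 𝔼 ρ F ≤ 𝔼 ρ G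
  𝔼-mono []            F≤G = F≤G [] (λ ())
  𝔼-mono (just b  ∷ ρ) F≤G = 𝔼-mono ρ λ Y ρ⊑Y → F≤G (b ∷ Y) (⊑-just ρ⊑Y)
  𝔼-mono (nothing ∷ ρ) F≤G = +-mono-≤
    (*-monoʳ-≤ 0≤p   (𝔼-mono ρ λ Y ρ⊑Y → F≤G (true ∷ Y)  (⊑-nothing ρ⊑Y)))
    (*-monoʳ-≤ 0≤1-p (𝔼-mono ρ λ Y ρ⊑Y → F≤G (false ∷ Y) (⊑-nothing ρ⊑Y)))

  𝔼-const : ∀ {m} (ρ : Knowledge m) x → 𝔼 ρ (λ _ → x) ≈ x
  𝔼-const []            x = refl
  𝔼-const (just b  ∷ ρ) x = 𝔼-const ρ x
  𝔼-const (nothing ∷ ρ) x =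
    trans (+-cong (*-congˡ (𝔼-const ρ x)) (*-congˡ (𝔼-const ρ x))) (p+[1-p] x)

  𝔼-+ : ∀ {m} (ρ : Knowledge m) F G → 𝔼 ρ (λ Y → F Y + G Y) ≈ 𝔼 ρ F + 𝔼 ρ G
  𝔼-+ []            F G = refl
  𝔼-+ (just b  ∷ ρ) F G = 𝔼-+ ρ _ _
  𝔼-+ (nothing ∷ ρ) F G =
    trans (+-cong (*-congˡ (𝔼-+ ρ _ _)) (*-congˡ (𝔼-+ ρ _ _)))
      (solve 6 (λ p q a b c d → p :* (a :+ b) :+ q :* (c :+ d)
                             := (p :* a :+ q :* c) :+ (p :* b :+ q :* d)) refl p (1# - p) _ _ _ _)

  𝔼-* : ∀ {m} (ρ : Knowledge m) x F → 𝔼 ρ (λ Y → x * F Y) ≈ x * 𝔼 ρ F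
  𝔼-* []            x F = refl
  𝔼-* (just b  ∷ ρ) x F = 𝔼-* ρ x _
  𝔼-* (nothing ∷ ρ) x F =
    trans (+-cong (*-congˡ (𝔼-* ρ x _)) (*-congˡ (𝔼-* ρ x _)))
      (solve 5 (λ p q x a b → p :* (x :* a) :+ q :* (x :* b)
                           := x :* (p :* a :+ q :* b)) refl p (1# - p) x _ _)

  𝔼-≤ : ∀ {m} (ρ : Knowledge m) {F} x → (∀ Y → ρ ⊑ Y → F Y ≤ x) → 𝔼 ρ F ≤ x
  𝔼-≤ ρ x F≤x = ≤-trans (𝔼-mono ρ F≤x) (≤-reflexive (𝔼-const ρ x))

  𝔼-≥ : ∀ {m} (ρ : Knowledge m) {F} x → (∀ Y → ρ ⊑ Y → x ≤ F Y) → x ≤ 𝔼 ρ F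
  𝔼-≥ ρ x x≤F = ≤-trans (≤-reflexive (sym (𝔼-const ρ x))) (𝔼-mono ρ x≤F)

  𝔼-reveal : ∀ {m} (ρ : Knowledge m) F {i} → lookup ρ i ≡ nothing →
             𝔼 ρ F ≈ p * 𝔼 (ρ [ i ]≔ just true) F + (1# - p) * 𝔼 (ρ [ i ]≔ just false) F
  𝔼-reveal (_       ∷ ρ) F {zero}  ≡.refl = refl
  𝔼-reveal (just b  ∷ ρ) F {suc i} eq     = 𝔼-reveal ρ _ eq
  𝔼-reveal (nothing ∷ ρ) F {suc i} eq     =
    trans (+-cong (*-congˡ (𝔼-reveal ρ _ eq)) (*-congˡ (𝔼-reveal ρ _ eq)))
      (solve 6 (λ p q a b c d → p :* (p :* a :+ q :* b) :+ q :* (p :* c :+ q :* d)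
                             := p :* (p :* a :+ q :* c) :+ q :* (p :* b :+ q :* d)) refl p (1# - p) _ _ _ _)

  𝔼-foldr-≤ : ∀ {m} {A : Set} (ρ : Knowledge m) (F : A → Subset m → Carrier) x →
              (∀ a → 𝔼 ρ (F a) ≤ x) → ∀ as →
              𝔼 ρ (λ Y → List.foldr (λ a s → F a Y + s) 0# as) ≤ fromℕ (List.length as) * x
  𝔼-foldr-≤ ρ F x F≤x []       = ≤-reflexive (trans (𝔼-const ρ 0#) (sym (zeroˡ x)))
  𝔼-foldr-≤ ρ F x F≤x (a ∷ as) = begin
    𝔼 ρ (λ Y → F a Y + List.foldr (λ a s → F a Y + s) 0# as)    ≈⟨ 𝔼-+ ρ _ _ ⟩
    𝔼 ρ (F a) + 𝔼 ρ (λ Y → List.foldr (λ a s → F a Y + s) 0# as) ≤⟨ +-mono-≤ (F≤x a) (𝔼-foldr-≤ ρ F x F≤x as) ⟩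
    x + fromℕ (List.length as) * x   ≈⟨ solve 2 (λ x k → x :+ k :* x := (con (+ 1) :+ k) :* x) refl x _ ⟩
    fromℕ (suc (List.length as)) * x ∎
    where open ≤-Reasoning

  indicator : Bool → Carrier
  indicator b = if b then 1# else 0#

  0≤indicator : ∀ b → 0# ≤ indicator b
  0≤indicator true  = 0≤1
  0≤indicator false = ≤-refl

  unknown : ∀ {m} → Knowledge m
  unknown = Vec.replicate _ nothing

  open Probability ℝ using (weight; Pr)

  private
    total : ∀ {m} → List (Subset m) → Carrier
    total = List.foldr _+_ 0# ∘ List.map (weight p)

    total-++ : ∀ {m} (xs ys : List (Subset m)) → total (xs ++ ys) ≈ total xs + total ys
    total-++ []       ys = sym (+-identityˡ _)
    total-++ (x ∷ xs) ys = trans (+-congˡ (total-++ xs ys)) (sym (+-assoc _ _ _))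

    factor : Bool → Carrier
    factor true  = p
    factor false = 1# - p

    weight-∷ : ∀ {m} b (ω : Subset m) → weight p (b ∷ ω) ≈ factor b * weight p ω
    weight-∷ true  ω = *-assoc _ _ _
    weight-∷ false ω = solve 3 (λ a q c → a :* (q :* c) := q :* (a :* c)) refl _ _ _

    total-filter-∷ : ∀ {m} {Q : Pred (Subset (suc m)) 0ℓ} (Q? : Decidable Q) b xs →
      total (List.filter Q? (List.map (b ∷_) xs)) ≈ factor b * total (List.filter (λ ω → Q? (b ∷ ω)) xs)
    total-filter-∷ Q? b []       = sym (zeroʳ _)
    total-filter-∷ Q? b (ω ∷ xs) with does (Q? (b ∷ ω))
    ... | true  = trans (+-cong (weight-∷ b ω) (total-filter-∷ Q? b xs)) (sym (distribˡ _ _ _))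
    ... | false = total-filter-∷ Q? b xs

  total≈𝔼 : ∀ {m} {Q : Pred (Subset m) 0ℓ} (Q? : Decidable Q) →
            total (List.filter Q? (subsets m)) ≈ 𝔼 unknown (indicator ∘ does ∘ Q?)
  total≈𝔼 {zero} Q? with does (Q? [])
  ... | true  = solve 0 (con (+ 1) :* con (+ 1) :+ con (+ 0) := con (+ 1)) refl
  ... | false = refl
  total≈𝔼 {suc m} Q? = begin
    total (List.filter Q? (ins ++ outs))                      ≡⟨ ≡.cong total (List.filter-++ Q? ins outs) ⟩
    total (List.filter Q? ins ++ List.filter Q? outs)         ≈⟨ total-++ (List.filter Q? ins) _ ⟩
    total (List.filter Q? ins) + total (List.filter Q? outs)
      ≈⟨ +-cong (total-filter-∷ Q? true (subsets m)) (total-filter-∷ Q? false (subsets m)) ⟩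
    p * total (List.filter (λ ω → Q? (true ∷ ω)) (subsets m)) +
    (1# - p) * total (List.filter (λ ω → Q? (false ∷ ω)) (subsets m))
      ≈⟨ +-cong (*-congˡ (total≈𝔼 λ ω → Q? (true ∷ ω))) (*-congˡ (total≈𝔼 λ ω → Q? (false ∷ ω))) ⟩
    𝔼 unknown (indicator ∘ does ∘ Q?)                         ∎
    where
    open import Relation.Binary.Reasoning.Setoid setoid
    ins outs : List (Subset (suc m))
    ins  = List.map (inside ∷_) (subsets m)
    outs = List.map (outside ∷_) (subsets m)

  Pr≈𝔼 : ∀ {d n} {E : Pred (Complex d n) 0ℓ} (E? : Decidable E) →
         Pr d n p E? ≈ 𝔼 unknown (λ ω → indicator (does (E? (complex ω))))
  Pr≈𝔼 E? = total≈𝔼 (λ ω → E? (complex ω))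

-- Adding a vertex to a finite set and removing one

x∉p-x : ∀ {n} {p : Subset n} {x} → x ∉ p ∖ x
x∉p-x {p = false ∷ p} {zero}  ()
x∉p-x {p = true ∷ p}  {zero}  ()
x∉p-x {p = _ ∷ p}     {suc x} (there x∈) = x∉p-x x∈

x∈p-y⇒x∈p : ∀ {n} {p : Subset n} {x y} → x ∈ p ∖ y → x ∈ p
x∈p-y⇒x∈p {p = p} {y = y} = p─q⊆p p ⁅ y ⁆

∣p∪⁅x⁆∣ : ∀ {n} {p : Subset n} {x} → x ∉ p → ∣ p ∪ ⁅ x ⁆ ∣ ≡ suc ∣ p ∣
∣p∪⁅x⁆∣ {p = true ∷ p}  {zero}  x∉p = ⊥-elim (x∉p here)
∣p∪⁅x⁆∣ {p = false ∷ p} {zero}  x∉p = ≡.cong (suc ∘ ∣_∣) (∪-identityʳ p)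
∣p∪⁅x⁆∣ {p = true ∷ p}  {suc x} x∉p = ≡.cong suc (∣p∪⁅x⁆∣ (x∉p ∘ there))
∣p∪⁅x⁆∣ {p = false ∷ p} {suc x} x∉p = ∣p∪⁅x⁆∣ (x∉p ∘ there)

∣p-x∣ : ∀ {n} {p : Subset n} {x} → x ∈ p → suc ∣ p ∖ x ∣ ≡ ∣ p ∣
∣p-x∣ {p = _ ∷ p}     here        = ≡.cong (suc ∘ ∣_∣) (p─⊥≡p p)
∣p-x∣ {p = true ∷ p}  (there x∈p) = ≡.cong suc (∣p-x∣ x∈p)
∣p-x∣ {p = false ∷ p} (there x∈p) = ∣p-x∣ x∈p

p⊆p∪⁅x⁆ : ∀ {n} {p : Subset n} {x} → p ⊆ p ∪ ⁅ x ⁆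
p⊆p∪⁅x⁆ y∈p = x∈p∪q⁺ (inj₁ y∈p)

x∈p∪⁅x⁆ : ∀ {n} {p : Subset n} {x} → x ∈ p ∪ ⁅ x ⁆
x∈p∪⁅x⁆ {x = x} = x∈p∪q⁺ (inj₂ (x∈⁅x⁆ x))

x∈p∪⁅y⁆⁻ : ∀ {n} {p : Subset n} {x y} → x ∈ p ∪ ⁅ y ⁆ → x ∈ p ⊎ x ≡ y
x∈p∪⁅y⁆⁻ {p = p} {y = y} x∈ with x∈p∪q⁻ p ⁅ y ⁆ x∈
... | inj₁ x∈p = inj₁ x∈p
... | inj₂ x∈y = inj₂ (x∈⁅y⁆⇒x≡y y x∈y)

∣p∣<∣q∣⇒∃∈q∉p : ∀ {n} {p q : Subset n} → ∣ p ∣ ℕ.< ∣ q ∣ → ∃ λ x → x ∈ q × x ∉ p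
∣p∣<∣q∣⇒∃∈q∉p {p = p} {q} p<q with Fin.any? (λ x → (x ∈? q) ×-dec ¬? (x ∈? p))
... | yes found = found
... | no none   = ⊥-elim (ℕ.<⇒≱ p<q (p⊆q⇒∣p∣≤∣q∣ q⊆p))
  where
  q⊆p : q ⊆ p
  q⊆p {x} x∈q with x ∈? p
  ... | yes x∈p = x∈p
  ... | no x∉p  = ⊥-elim (none (x , x∈q , x∉p))

elements : ∀ {n} → Subset n → List (Fin n)
elements p = List.filter (_∈? p) (List.allFin _)

∈-elements⁻ : ∀ {n} {p : Subset n} {x} → x ∈ˡ elements p → x ∈ p
∈-elements⁻ {p = p} x∈ = proj₂ (∈-filter⁻ (_∈? p) {xs = List.allFin _} x∈)

unique-elements : ∀ {n} (p : Subset n) → Unique (elements p)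
unique-elements p = Unique.filter⁺ (_∈? p) (Unique.allFin⁺ _)

private
  length-filter-map-suc : ∀ {n} s (p : Subset n) xs →
    List.length (List.filter (_∈? (s ∷ p)) (List.map suc xs)) ≡ List.length (List.filter (_∈? p) xs)
  length-filter-map-suc s p []       = ≡.refl
  length-filter-map-suc s p (x ∷ xs) with does (x ∈? p)
  ... | true  = ≡.cong suc (length-filter-map-suc s p xs)
  ... | false = length-filter-map-suc s p xs

length-elements : ∀ {n} (p : Subset n) → List.length (elements p) ≡ ∣ p ∣
length-elements []      = ≡.refl
length-elements (s ∷ p) = begin
  List.length (elements (s ∷ p))                       ≡⟨⟩
  List.length (List.filter (_∈? (s ∷ p)) (zero ∷ List.tabulate suc)) ≡⟨ head s ⟩
  ∣ s ∷ [] ∣ ℕ.+ List.length (List.filter (_∈? (s ∷ p)) (List.tabulate suc))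
    ≡⟨ ≡.cong (λ xs → ∣ s ∷ [] ∣ ℕ.+ List.length (List.filter (_∈? (s ∷ p)) xs)) (List.map-tabulate
        (λ i → i) suc) ⟨
  ∣ s ∷ [] ∣ ℕ.+ List.length (List.filter (_∈? (s ∷ p)) (List.map suc (List.allFin _)))
    ≡⟨ ≡.cong (∣ s ∷ [] ∣ ℕ.+_) (length-filter-map-suc s p (List.allFin _)) ⟩
  ∣ s ∷ [] ∣ ℕ.+ List.length (elements p)              ≡⟨ ≡.cong (∣ s ∷ [] ∣ ℕ.+_) (length-elements p) ⟩
  ∣ s ∷ [] ∣ ℕ.+ ∣ p ∣                                 ≡⟨ ∣s∷p∣ s ⟩
  ∣ s ∷ p ∣                                            ∎
  where
  open ≡.≡-Reasoning
  head : ∀ s → List.length (List.filter (_∈? (s ∷ p)) (zero ∷ List.tabulate suc)) ≡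
         ∣ s ∷ [] ∣ ℕ.+ List.length (List.filter (_∈? (s ∷ p)) (List.tabulate suc))
  head true  = ≡.refl
  head false = ≡.refl
  ∣s∷p∣ : ∀ s → ∣ s ∷ [] ∣ ℕ.+ ∣ p ∣ ≡ ∣ s ∷ p ∣
  ∣s∷p∣ true  = ≡.refl
  ∣s∷p∣ false = ≡.refl

-- Branches and the invariants of the exploration

module Exploration {d n m : ℕ} (V : Fin m → Subset n)
  (V-size : ∀ i → ∣ V i ∣ ≡ suc d)
  (V-injective : ∀ {i j} → V i ≡ V j → i ≡ j) where

  -- Survive k τ x says that the branch growing from the face τ, away from
  -- the d-simplex τ ∪ {x}, is not collapsed onto τ within k rounds.
  Survive : ℕ → Subset n → Fin n → Subset m → Set
  Survive zero    τ x Y = ⊤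
  Survive (suc k) τ x Y = ∃ λ i →
    (i ∈ Y × τ ⊆ V i × x ∉ V i) × All (λ w → Survive k (V i ∖ w) w Y) (elements τ)

  survive? : ∀ k τ x Y → Dec (Survive k τ x Y)
  survive? zero    τ x Y = yes tt
  survive? (suc k) τ x Y = Fin.any? λ i →
    ((i ∈? Y) ×-dec (τ ⊆? V i) ×-dec ¬? (x ∈? V i)) ×-dec
    All.all? (λ w → survive? k (V i ∖ w) w Y) (elements τ)

  -- (τ , x) stands for the branch at τ, reached through the d-simplex τ ∪ {x}.
  Branch : Set
  Branch = Subset n × Fin n

  children : Fin m → List (Fin n) → List Branch
  children e = List.map (λ w → V e ∖ w , w)

  -- ρ is the revealed part of the complex and U the set of vertices met so far.
  record Explored (ρ : Knowledge m) (U : Subset n) : Set where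
    field
      present⊆    : ∀ i → lookup ρ i ≡ just true → V i ⊆ U
      far-unknown : ∀ i {v v′} → v ∈ V i → v′ ∈ V i → v ∉ U → v′ ∉ U → ¬ (v ≡ v′) →
                    lookup ρ i ≡ nothing
  open Explored public

  -- A branch that has not been explored, apart from the d-simplex through which
  -- it was discovered.
  record Pending (ρ : Knowledge m) (U : Subset n) (b : Branch) : Set where
    field
      size   : ∣ proj₁ b ∣ ≡ d
      within : proj₁ b ⊆ U
      fresh  : ∀ i {v} → proj₁ b ⊆ V i → v ∈ V i → v ∉ U → lookup ρ i ≡ nothing
      parent : ∀ i → proj₁ b ⊆ V i → lookup ρ i ≡ just true → proj₂ b ∈ V i
  open Pending public

  _≢ᵇ_ : Branch → Branch → Set
  a ≢ᵇ b = ¬ (proj₁ a ≡ proj₁ b)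

  record State (ρ : Knowledge m) (U : Subset n) (L : List Branch) : Set where
    constructor state
    field
      explored : Explored ρ U
      pending  : All (Pending ρ U) L
      distinct : AllPairs _≢ᵇ_ L
  open State public

  State-drop : ∀ {ρ U} L {L′} → State ρ U (L ++ L′) → State ρ U L′
  State-drop []      s                                = s
  State-drop (_ ∷ L) (state ex (_ ∷ pend) (_ ∷ dist)) = State-drop L (state ex pend dist)

  -- Revealing one simplex through a pending face

  module Step {ρ U τ e v} (∣τ∣ : ∣ τ ∣ ≡ d) (τ⊆U : τ ⊆ U) (v∉τ : v ∉ τ)
    (Ve≡ : V e ≡ τ ∪ ⁅ v ⁆) (ex : Explored ρ U) where

    τ⊆Ve : τ ⊆ V e
    τ⊆Ve = ≡.subst (τ ⊆_) (≡.sym Ve≡) p⊆p∪⁅x⁆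

    v∈Ve : v ∈ V e
    v∈Ve = ≡.subst (v ∈_) (≡.sym Ve≡) x∈p∪⁅x⁆

    ∈Ve⁻ : ∀ {u} → u ∈ V e → u ∈ τ ⊎ u ≡ v
    ∈Ve⁻ {u} u∈Ve = x∈p∪⁅y⁆⁻ (≡.subst (u ∈_) Ve≡ u∈Ve)

    Ve⊆U+v : V e ⊆ U ∪ ⁅ v ⁆
    Ve⊆U+v u∈Ve with ∈Ve⁻ u∈Ve
    ... | inj₁ u∈τ    = p⊆p∪⁅x⁆ (τ⊆U u∈τ)
    ... | inj₂ ≡.refl = x∈p∪⁅x⁆

    ∉U⇒≡v : ∀ {u} → u ∈ V e → u ∉ U → u ≡ v
    ∉U⇒≡v u∈Ve u∉U with ∈Ve⁻ u∈Ve
    ... | inj₁ u∈τ = ⊥-elim (u∉U (τ⊆U u∈τ))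
    ... | inj₂ u≡v = u≡v

    v∈U⇒Ve⊆U : v ∈ U → V e ⊆ U
    v∈U⇒Ve⊆U v∈U u∈Ve with ∈Ve⁻ u∈Ve
    ... | inj₁ u∈τ    = τ⊆U u∈τ
    ... | inj₂ ≡.refl = v∈U

    e-unique : ∀ {i} → τ ⊆ V i → v ∈ V i → i ≡ e
    e-unique {i} τ⊆Vi v∈Vi = ≡.sym (V-injective (⊆∧∣∣≥⇒≡ Ve⊆Vi
      (ℕ.≤-reflexive (≡.trans (V-size i) (≡.sym (V-size e))))))
      where
      Ve⊆Vi : V e ⊆ V i
      Ve⊆Vi u∈Ve with ∈Ve⁻ u∈Ve
      ... | inj₁ u∈τ    = τ⊆Vi u∈τ
      ... | inj₂ ≡.refl = v∈Vi

    -- `τ` is the facet of `V e` opposite `v`, the only one that misses `v`. With it, distinctness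
    -- of the pending faces shows how revealing `e` can affect them.
    other-facet∋v : ∀ {τ′} → ∣ τ′ ∣ ≡ d → ¬ (τ′ ≡ τ) → τ′ ⊆ V e → v ∈ τ′
    other-facet∋v {τ′} ∣τ′∣ τ′≢τ τ′⊆Ve with v ∈? τ′
    ... | yes v∈τ′ = v∈τ′
    ... | no v∉τ′  = ⊥-elim (τ′≢τ (⊆∧∣∣≥⇒≡ τ′⊆τ (ℕ.≤-reflexive (≡.trans ∣τ∣ (≡.sym ∣τ′∣)))))
      where
      τ′⊆τ : τ′ ⊆ τ
      τ′⊆τ u∈τ′ with ∈Ve⁻ (τ′⊆Ve u∈τ′)
      ... | inj₁ u∈τ    = u∈τ
      ... | inj₂ ≡.refl = ⊥-elim (v∉τ′ u∈τ′)

    lookup-other : ∀ {i b} → ¬ (i ≡ e) → lookup (ρ [ e ]≔ b) i ≡ lookup ρ i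
    lookup-other {i} i≢e = Vec.lookup∘update′ i≢e ρ _

    lookup-e : ∀ {b} → lookup (ρ [ e ]≔ b) e ≡ b
    lookup-e = Vec.lookup∘update e ρ _

    just-old : ∀ {i b c} → ¬ (b ≡ c) → lookup (ρ [ e ]≔ just b) i ≡ just c → lookup ρ i ≡ just c
    just-old {i} {b} {c} b≢c eq with i Fin.≟ e
    ... | yes ≡.refl = ⊥-elim (b≢c (just-injective (≡.trans (≡.sym lookup-e) eq)))
    ... | no i≢e     = ≡.trans (≡.sym (lookup-other i≢e)) eq

    nothing-old : ∀ {i b} → lookup (ρ [ e ]≔ just b) i ≡ nothing → lookup ρ i ≡ nothing
    nothing-old {i} {b} eq with i Fin.≟ e
    ... | yes ≡.refl with () ← ≡.trans (≡.sym lookup-e) eq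
    ... | no i≢e     = ≡.trans (≡.sym (lookup-other i≢e)) eq

    explored-absent : Explored (ρ [ e ]≔ just false) U
    explored-absent .present⊆ i eq = present⊆ ex i (just-old (λ ()) eq)
    explored-absent .far-unknown i {u} {u′} u∈ u′∈ u∉U u′∉U u≢u′ with i Fin.≟ e
    ... | yes ≡.refl = ⊥-elim (u≢u′ (≡.trans (∉U⇒≡v u∈ u∉U) (≡.sym (∉U⇒≡v u′∈ u′∉U))))
    ... | no i≢e     = ≡.trans (lookup-other i≢e) (far-unknown ex i u∈ u′∈ u∉U u′∉U u≢u′)

    -- If another pending face lies in `V e`, it contains `v`; pending faces lie in `U`, so all of
    -- `V e` does, and `fresh` claims nothing about `e`.
    pending-absent : ∀ {b} → ¬ (proj₁ b ≡ τ) → Pending ρ U b → Pending (ρ [ e ]≔ just false) U b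
    pending-absent τ′≢τ pb .size = size pb
    pending-absent τ′≢τ pb .within = within pb
    pending-absent τ′≢τ pb .fresh i {u} τ′⊆ u∈ u∉U with i Fin.≟ e
    ... | yes ≡.refl = ⊥-elim (u∉U (v∈U⇒Ve⊆U (within pb (other-facet∋v (size pb) τ′≢τ τ′⊆)) u∈))
    ... | no i≢e     = ≡.trans (lookup-other i≢e) (fresh pb i τ′⊆ u∈ u∉U)
    pending-absent τ′≢τ pb .parent i τ′⊆ eq = parent pb i τ′⊆ (just-old (λ ()) eq)

    state-absent : ∀ {L} → All (λ b → ¬ (proj₁ b ≡ τ)) L → State ρ U L → State (ρ [ e ]≔ just false) U L
    state-absent ≢τ (state _ pend dist) = state explored-absent
      (All.zipWith (λ (≢ , pb) → pending-absent ≢ pb) (≢τ , pend)) dist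

    module Present (v∉U : v ∉ U) where

      ∉U+v : ∀ {u} → u ∉ U ∪ ⁅ v ⁆ → u ∉ U
      ∉U+v u∉ u∈U = u∉ (p⊆p∪⁅x⁆ u∈U)

      explored-present : Explored (ρ [ e ]≔ just true) (U ∪ ⁅ v ⁆)
      explored-present .present⊆ i eq with i Fin.≟ e
      ... | yes ≡.refl = Ve⊆U+v
      ... | no i≢e     = p⊆p∪⁅x⁆ ∘ present⊆ ex i (≡.trans (≡.sym (lookup-other i≢e)) eq)
      explored-present .far-unknown i {u} {u′} u∈ u′∈ u∉ u′∉ u≢u′ with i Fin.≟ e
      ... | yes ≡.refl = ⊥-elim (u∉ (Ve⊆U+v u∈))
      ... | no i≢e     = ≡.trans (lookup-other i≢e) (far-unknown ex i u∈ u′∈ (∉U+v u∉) (∉U+v u′∉) u≢u′)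

      -- A pending face other than `τ` inside `V e` would contain `v`, but it lies in `U` and `v`
      -- does not. Hence `e` is not a simplex through it.
      pending-present : ∀ {b} → ¬ (proj₁ b ≡ τ) → Pending ρ U b → Pending (ρ [ e ]≔ just true) (U ∪ ⁅ v ⁆) b
      pending-present {b} τ′≢τ pb = go
        where
        ⊈Ve : ¬ (proj₁ b ⊆ V e)
        ⊈Ve τ′⊆ = v∉U (within pb (other-facet∋v (size pb) τ′≢τ τ′⊆))
        go : Pending (ρ [ e ]≔ just true) (U ∪ ⁅ v ⁆) b
        go .size = size pb
        go .within = p⊆p∪⁅x⁆ ∘ within pb
        go .fresh i {u} τ′⊆ u∈ u∉ with i Fin.≟ e
        ... | yes ≡.refl = ⊥-elim (⊈Ve τ′⊆)
        ... | no i≢e     = ≡.trans (lookup-other i≢e) (fresh pb i τ′⊆ u∈ (∉U+v u∉))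
        go .parent i τ′⊆ eq with i Fin.≟ e
        ... | yes ≡.refl = ⊥-elim (⊈Ve τ′⊆)
        ... | no i≢e     = parent pb i τ′⊆ (≡.trans (≡.sym (lookup-other i≢e)) eq)

      v∈child : ∀ {w} → w ∈ τ → v ∈ V e ∖ w
      v∈child w∈τ = x∈p∧x≢y⇒x∈p-y v∈Ve λ where ≡.refl → v∉τ w∈τ

      -- Each child face contains the new vertex `v`. Simplices found present earlier lie in `U`, so
      -- `e` is the only present one through the child. A simplex through the child with a vertex
      -- outside `U ∪ ⁅ v ⁆` has two vertices outside `U`, which is the situation covered by
      -- `far-unknown`.
      pending-child : ∀ {w} → w ∈ τ → Pending (ρ [ e ]≔ just true) (U ∪ ⁅ v ⁆) (V e ∖ w , w)
      pending-child w∈τ .size = ℕ.suc-injective (≡.trans (∣p-x∣ (τ⊆Ve w∈τ)) (V-size e))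
      pending-child w∈τ .within = Ve⊆U+v ∘ x∈p-y⇒x∈p
      pending-child w∈τ .fresh i {u} ⊆Vi u∈ u∉ with i Fin.≟ e
      ... | yes ≡.refl = ⊥-elim (u∉ (Ve⊆U+v u∈))
      ... | no i≢e     = ≡.trans (lookup-other i≢e)
        (far-unknown ex i u∈ (⊆Vi (v∈child w∈τ)) (∉U+v u∉) v∉U λ where ≡.refl → u∉ x∈p∪⁅x⁆)
      pending-child w∈τ .parent i ⊆Vi eq with i Fin.≟ e
      ... | yes ≡.refl = τ⊆Ve w∈τ
      ... | no i≢e     = ⊥-elim (v∉U
        (present⊆ ex i (≡.trans (≡.sym (lookup-other i≢e)) eq) (⊆Vi (v∈child w∈τ))))

      distinct-children : ∀ {ws} → All (_∈ τ) ws → Unique ws → AllPairs _≢ᵇ_ (children e ws)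
      distinct-children []          []          = []
      distinct-children (w∈τ ∷ ws∈) (w∉ ∷ uniq) =
        All.map⁺ (All.map (λ w≢w′ eq → x∉p-x (≡.subst (_ ∈_) (≡.sym eq) (x∈p∧x≢y⇒x∈p-y (τ⊆Ve w∈τ) w≢w′))) w∉)
        ∷ distinct-children ws∈ uniq

      state-present : ∀ {L} → All (λ b → ¬ (proj₁ b ≡ τ)) L → State ρ U L →
                      State (ρ [ e ]≔ just true) (U ∪ ⁅ v ⁆) (children e (elements τ) ++ L)
      state-present ≢τ (state _ pend dist) = state explored-present
        (All.++⁺ (All.map⁺ (All.map pending-child elements⊆))
                 (All.zipWith (λ (≢ , pb) → pending-present ≢ pb) (≢τ , pend)))
        (AllPairs.++⁺ (distinct-children elements⊆ (unique-elements τ)) dist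
          -- Children contain `v`, whereas the older pending faces lie in `U`.
          (All.map⁺ (All.map (λ w∈τ → All.map (λ pb eq → v∉U (within pb (≡.subst (v ∈_) eq
              (v∈child w∈τ)))) pend) elements⊆)))
        where
        elements⊆ : All (_∈ τ) (elements τ)
        elements⊆ = All.tabulate ∈-elements⁻

      children≢τ : All (λ b → ¬ (proj₁ b ≡ τ)) (children e (elements τ))
      children≢τ = All.map⁺ (All.tabulate λ w∈ eq → v∉τ (≡.subst (v ∈_) eq (v∈child (∈-elements⁻ w∈))))

-- The probability that a branch survives

module SurvivalBound (ℝ : CompleteOrderedField) (p : CompleteOrderedField.Carrier ℝ)
  (0≤p : CompleteOrderedField._≤_ ℝ (CompleteOrderedField.0# ℝ) p)
  (p≤1 : CompleteOrderedField._≤_ ℝ p (CompleteOrderedField.1# ℝ))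
  {d n m : ℕ} (V : Fin m → Subset n)
  (V-size : ∀ i → ∣ V i ∣ ≡ suc d)
  (V-injective : ∀ {i j} → V i ≡ V j → i ≡ j)
  (V-surjective : ∀ σ → ∣ σ ∣ ≡ suc d → ∃ λ i → V i ≡ σ) where
  open CompleteOrderedField ℝ hiding (zero)
  open OrderedFieldProperties ℝ
  open Expectation ℝ p 0≤p p≤1
  open Exploration V V-size V-injective

  -- A continuation: the Boolean is the fate of the branch under exploration, and the dependence on
  -- `Y` carries whatever is decided later. `G≤1` caps the loss when a vertex recurs, and `Gf≤Gt`
  -- allows survival to be overestimated.
  record Payoff (G : Bool → Subset m → Carrier) : Set where
    field
      0≤G   : ∀ b Y → 0# ≤ G b Y
      G≤1   : ∀ b Y → G b Y ≤ 1#
      Gf≤Gt : ∀ Y → G false Y ≤ G true Y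
  open Payoff

  mix : Carrier → (Bool → Carrier) → Carrier
  mix q r = q * r true + (1# - q) * r false

  -- Each vertex of U is met again with probability p.  The weight 2^|U| dominates
  -- |U|, and its expectation grows only by a bounded factor while U grows.
  error : Carrier → Subset n → Carrier
  error B U = p * (B * (1# + 1#) ^ ∣ U ∣)

  0≤2^ : ∀ k → 0# ≤ (1# + 1#) ^ k
  0≤2^ k = 0≤^ k (<⇒≤ 0<2)

  error-mono : ∀ {B C} U → B ≤ C → error B U ≤ error C U
  error-mono U B≤C = *-monoʳ-≤ 0≤p (*-monoˡ-≤ (0≤2^ ∣ U ∣) B≤C)

  0≤error : ∀ {B} U → 1# ≤ B → 0# ≤ error B U
  0≤error U 1≤B = 0≤x*y 0≤p (0≤x*y (≤-trans 0≤1 1≤B) (0≤2^ ∣ U ∣))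

  -- r bounds the expected payoff once the branches in L are all that is left to
  -- explore, whatever has been revealed so far.
  Bounds : List Branch → (Bool → Subset m → Carrier) → (Bool → Carrier) → Carrier → Set
  Bounds L G r B = ∀ {ρ U} → State ρ U L → ∀ b → 𝔼 ρ (G b) ≤ r b + error B U

  -- Up to the error term, Survive behaves like an event of probability q that is
  -- independent of everything else.
  SurvivalBound : ℕ → Carrier → Carrier → Set
  SurvivalBound k q K = ∀ {τ x L G r B} → Payoff G → r false ≤ r true → 0# ≤ r false → 1# ≤ B →
    Bounds L G r B → ∀ {ρ U} → State ρ U ((τ , x) ∷ L) →
    𝔼 ρ (λ Y → G (does (survive? k τ x Y)) Y) ≤ mix q r + error (K * B) U

  survivalBound-zero : SurvivalBound zero 1# 1#
  survivalBound-zero {r = r} {B} pay rf≤rt 0≤rf 1≤B bounds {ρ} {U} s = ≤-trans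
    (bounds (State-drop (_ ∷ []) s) true)
    (≤-reflexive (solve 5 (λ t f p B u → t :+ p :* (B :* u)
      := con (+ 1) :* t :+ (con (+ 1) :- con (+ 1)) :* f :+ p :* (con (+ 1) :* B :* u))
          refl (r true) (r false) p B _))

  module Inductive (k : ℕ) (q K : Carrier) (0≤q : 0# ≤ q) (q≤1 : q ≤ 1#) (1≤K : 1# ≤ K)
    (bound : SurvivalBound k q K) where

    mix-true : ∀ {x} r → x ≤ 1# → r false ≤ r true → mix x r ≤ r true
    mix-true {x} r x≤1 rf≤rt = ≤-by (0≤x*y (0≤y-x x≤1) (0≤y-x rf≤rt))
      (solve 3 (λ x t f → t := x :* t :+ (con (+ 1) :- x) :* f :+ (con (+ 1) :- x) :* (t :- f))
          refl x (r true) (r false))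

    mix-false : ∀ {x} r → 0# ≤ x → r false ≤ r true → r false ≤ mix x r
    mix-false {x} r 0≤x rf≤rt = ≤-by (0≤x*y 0≤x (0≤y-x rf≤rt))
      (solve 3 (λ x t f → x :* t :+ (con (+ 1) :- x) :* f := f :+ x :* (t :- f)) refl x (r true) (r false))

    B≤K^*B : ∀ j {B} → 1# ≤ B → B ≤ K ^ j * B
    B≤K^*B j {B} 1≤B = ≤-trans (≤-reflexive (sym (*-identityˡ B))) (*-monoˡ-≤ (≤-trans 0≤1 1≤B) (1≤^ j 1≤K))

    1≤K^*B : ∀ j {B} → 1# ≤ B → 1# ≤ K ^ j * B
    1≤K^*B j 1≤B = ≤-trans 1≤B (B≤K^*B j 1≤B)

    allSurvive? : ∀ e ws Y → Dec (All (λ w → Survive k (V e ∖ w) w Y) ws)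
    allSurvive? e ws Y = All.all? (λ w → survive? k (V e ∖ w) w Y) ws

    -- The remaining children and the list `L` act as the continuation of the first child. The
    -- factors `q` multiply because `Bounds` holds in every state that the first exploration may
    -- leave behind; each child also costs one factor `K` in the error.
    all-bound : ∀ {e L G r B} ws → Payoff G → r false ≤ r true → 0# ≤ r false → 1# ≤ B →
      Bounds L G r B → ∀ {ρ U} → State ρ U (children e ws ++ L) →
      𝔼 ρ (λ Y → G (does (allSurvive? e ws Y)) Y) ≤
        mix (q ^ List.length ws) r + error (K ^ List.length ws * B) U
    all-bound {r = r} {B} [] pay rf≤rt 0≤rf 1≤B bounds s = ≤-trans (bounds s true)
      (≤-reflexive (solve 5 (λ t f p B u → t :+ p :* (B :* u)
        := con (+ 1) :* t :+ (con (+ 1) :- con (+ 1)) :* f :+ p :* (con (+ 1) :* B :* u))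
            refl (r true) (r false) p B _))
    all-bound {e} {L} {G} {r} {B} (w ∷ ws) pay rf≤rt 0≤rf 1≤B bounds {ρ} {U} s = ≤-trans
      (bound {r = r′} pay′ (mix-false r (0≤^ j 0≤q) rf≤rt) 0≤rf (1≤K^*B j 1≤B) bounds′ s)
      (≤-reflexive (solve 8 (λ t f p B u q qj X →
        q :* (qj :* t :+ (con (+ 1) :- qj) :* f) :+ (con (+ 1) :- q) :* f :+ p :* (X :* u)
        := q :* qj :* t :+ (con (+ 1) :- q :* qj) :* f :+ p :* (X :* u))
        refl (r true) (r false) p B _ q (q ^ j) (K * (K ^ j * B)) ⟨ trans ⟩ +-congˡ
            (*-congˡ (*-congʳ (sym (*-assoc K _ B))))))
      where
      j : ℕ
      j = List.length ws
      G′ : Bool → Subset m → Carrier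
      G′ b Y = G (b ∧ does (allSurvive? e ws Y)) Y
      r′ : Bool → Carrier
      r′ b = if b then mix (q ^ j) r else r false
      pay′ : Payoff G′
      pay′ .0≤G b Y = 0≤G pay _ Y
      pay′ .G≤1 b Y = G≤1 pay _ Y
      pay′ .Gf≤Gt Y with does (allSurvive? e ws Y)
      ... | true  = Gf≤Gt pay Y
      ... | false = ≤-refl
      bounds′ : Bounds (children e ws ++ L) G′ r′ (K ^ j * B)
      bounds′ s′ true  = all-bound ws pay rf≤rt 0≤rf 1≤B bounds s′
      -- Once one child has died the conjunction is decided, and its siblings are dropped
      -- unexplored.
      bounds′ {U = U′} s′ false = ≤-trans (bounds (State-drop (children e ws) s′) false)
        (+-monoʳ-≤ _ (error-mono U′ (B≤K^*B j 1≤B)))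

    module _ (τ : Subset n) (∣τ∣ : ∣ τ ∣ ≡ d) where

      ws : List (Fin n)
      ws = elements τ

      ∣ws∣ : List.length ws ≡ d
      ∣ws∣ = ≡.trans (length-elements τ) ∣τ∣

      M s : Carrier
      M = K ^ d
      s = 1# - q ^ d

      0≤s : 0# ≤ s
      0≤s = 0≤y-x (^≤1 d 0≤q q≤1)

      s≤1 : s ≤ 1#
      s≤1 = x-y≤x (0≤^ d 0≤q)

      1≤M : 1# ≤ M
      1≤M = 1≤^ d 1≤K

      grandchildren : List (Fin m) → List Branch
      grandchildren = List.concatMap λ e → children e ws

      anySurvives? : ∀ es Y → Dec (Any (λ e → All (λ w → Survive k (V e ∖ w) w Y) ws) es)
      anySurvives? es Y = any? (λ e → allSurvive? e ws Y) es

      -- `s` bounds the chance that some child of one simplex dies, from the side of the estimate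
      -- that matters; the disjunction behaves as if these failures were independent. A simplex has
      -- `d` children, which turns the error factor `K` into `M`.
      any-bound : ∀ {L G r B} es → Payoff G → r false ≤ r true → 0# ≤ r false → 1# ≤ B →
        Bounds L G r B → ∀ {ρ U} → State ρ U (grandchildren es ++ L) →
        𝔼 ρ (λ Y → G (does (anySurvives? es Y)) Y) ≤
          mix (1# - s ^ List.length es) r + error (M ^ List.length es * B) U
      any-bound {r = r} {B} [] pay rf≤rt 0≤rf 1≤B bounds st = ≤-trans (bounds st false)
        (≤-reflexive (solve 5 (λ t f p B u → f :+ p :* (B :* u)
          := (con (+ 1) :- con (+ 1)) :* t :+ (con (+ 1) :- (con (+ 1) :- con (+ 1))) :* f :+ p :*
              (con (+ 1) :* B :* u)) refl (r true) (r false) p B _))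
      any-bound {L} {G} {r} {B} (e ∷ es) pay rf≤rt 0≤rf 1≤B bounds {ρ} {U} st = begin
        𝔼 ρ (λ Y → G′ (does (allSurvive? e ws Y)) Y)
          ≤⟨ all-bound {r = r′} ws pay′ (mix-true r (x-y≤x (0≤^ j 0≤s)) rf≤rt)
               (≤-trans 0≤rf (mix-false r (0≤y-x (^≤1 j 0≤s s≤1)) rf≤rt))
               (≤-trans 1≤B B≤) bounds′
               (≡.subst (State ρ U) (List.++-assoc (children e ws) (grandchildren es) L) st) ⟩
        mix (q ^ List.length ws) r′ + error (K ^ List.length ws * (M ^ j * B)) U
          ≡⟨ ≡.cong (λ l → mix (q ^ l) r′ + error (K ^ l * (M ^ j * B)) U) ∣ws∣ ⟩
        mix (q ^ d) r′ + error (M * (M ^ j * B)) U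
          ≈⟨ +-cong (solve 4 (λ q t f sj → q :* t :+ (con (+ 1) :- q) :* ((con (+ 1) :- sj) :* t :+
              (con (+ 1) :- (con (+ 1) :- sj)) :* f)
               := (con (+ 1) :- (con (+ 1) :- q) :* sj) :* t :+ (con (+ 1) :- (con (+ 1) :-
                   (con (+ 1) :- q) :* sj)) :* f)
               refl (q ^ d) (r true) (r false) (s ^ j))
             (*-congˡ (*-congʳ (sym (*-assoc M _ B)))) ⟩
        mix (1# - s ^ suc j) r + error (M ^ suc j * B) U ∎
        where
        open ≤-Reasoning
        j : ℕ
        j = List.length es
        B≤ : B ≤ M ^ j * B
        B≤ = ≤-trans (≤-reflexive (sym (*-identityˡ B))) (*-monoˡ-≤ (≤-trans 0≤1 1≤B) (1≤^ j 1≤M))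
        G′ : Bool → Subset m → Carrier
        G′ b Y = G (b ∨ does (anySurvives? es Y)) Y
        r′ : Bool → Carrier
        r′ b = if b then r true else mix (1# - s ^ j) r
        pay′ : Payoff G′
        pay′ .0≤G b Y = 0≤G pay _ Y
        pay′ .G≤1 b Y = G≤1 pay _ Y
        pay′ .Gf≤Gt Y with does (anySurvives? es Y)
        ... | true  = ≤-refl
        ... | false = Gf≤Gt pay Y
        bounds′ : Bounds (grandchildren es ++ L) G′ r′ (M ^ j * B)
        bounds′ {U = U′} st′ true = ≤-trans (bounds (State-drop (grandchildren es) st′) true)
          (+-monoʳ-≤ _ (error-mono U′ B≤))
        bounds′ st′ false = any-bound es pay rf≤rt 0≤rf 1≤B bounds st′

      count : List (Fin n) → Subset n → ℕ
      count vs U = List.length (List.filter (_∈? U) vs)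

      count-∉ : ∀ {v U} vs → v ∉ U → count (v ∷ vs) U ≡ count vs U
      count-∉ {U = U} vs v∉U = ≡.cong List.length (List.filter-reject (_∈? U) v∉U)

      count-∈ : ∀ {v U} vs → v ∈ U → count (v ∷ vs) U ≡ suc (count vs U)
      count-∈ {U = U} vs v∈U = ≡.cong List.length (List.filter-accept (_∈? U) v∈U)

      count-∪ : ∀ {v U} vs → v ∉ˡ vs → count vs (U ∪ ⁅ v ⁆) ≡ count vs U
      count-∪ []               v∉vs = ≡.refl
      count-∪ {v} {U} (u ∷ vs) v∉vs with u ∈? U
      ... | yes u∈U = ≡.trans (count-∈ vs (p⊆p∪⁅x⁆ u∈U)) (≡.cong suc (count-∪ vs (v∉vs ∘ there)))
      ... | no u∉U  = ≡.trans (count-∉ vs u∉U+v) (count-∪ vs (v∉vs ∘ there))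
        where
        u∉U+v : u ∉ U ∪ ⁅ v ⁆
        u∉U+v u∈ with x∈p∪⁅y⁆⁻ u∈
        ... | inj₁ u∈U = u∉U u∈U
        ... | inj₂ u≡v = v∉vs (here (≡.sym u≡v))

      module _ (x : Fin n) (L : List Branch) where

        -- The edges through τ and a vertex of vs are still to be revealed; N collects
        -- those found to be present.
        record Revealing (vs : List (Fin n)) (N : List (Fin m)) (ρ : Knowledge m) (U : Subset n) : Set where
          field
            current    : State ρ U (grandchildren N ++ L)
            ≢τ         : All (λ b → ¬ (proj₁ b ≡ τ)) (grandchildren N ++ L)
            τ⊆U        : τ ⊆ U
            fresh-vs   : ∀ {v} i → v ∈ˡ vs → v ∉ U → τ ⊆ V i → v ∈ V i → lookup ρ i ≡ nothing
            found      : ∀ i → τ ⊆ V i → lookup ρ i ≡ just true → x ∈ V i ⊎ i ∈ˡ N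
            unknown-vs : ∀ i → τ ⊆ V i → lookup ρ i ≡ nothing → ∃ λ v → v ∈ˡ vs × v ∈ V i × v ∉ τ
            unique     : Unique vs
        open Revealing

        skip : ∀ {v vs N ρ U} → (∀ i → τ ⊆ V i → v ∈ V i → v ∉ τ → ¬ (lookup ρ i ≡ nothing)) →
               Revealing (v ∷ vs) N ρ U → Revealing vs N ρ U
        skip known R .current = current R
        skip known R .≢τ = ≢τ R
        skip known R .τ⊆U = τ⊆U R
        skip known R .fresh-vs i v∈ = fresh-vs R i (there v∈)
        skip known R .found = found R
        skip known R .unknown-vs i τ⊆ eq with unknown-vs R i τ⊆ eq
        ... | _ , here ≡.refl , v∈ , v∉τ = ⊥-elim (known i τ⊆ v∈ v∉τ eq)
        ... | u , there u∈ , rest        = u , u∈ , rest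
        skip known R .unique = AllPairs.tail (unique R)

        module _ {v vs N ρ U e} (R : Revealing (v ∷ vs) N ρ U) (v∉τ : v ∉ τ)
          (Ve≡ : V e ≡ τ ∪ ⁅ v ⁆) where
          open Step {ρ} {U} {τ} {e} {v} ∣τ∣ (τ⊆U R) v∉τ Ve≡ (explored (current R))

          private
            later-≢e : ∀ {i u} → u ∈ˡ vs → u ∉ U → u ∈ V i → ¬ (i ≡ e)
            later-≢e u∈ u∉U u∈Vi ≡.refl with ∈Ve⁻ u∈Vi
            ... | inj₁ u∈τ    = u∉U (τ⊆U R u∈τ)
            ... | inj₂ ≡.refl = Unique.Unique[x∷xs]⇒x∉xs (unique R) u∈

            still-unknown : ∀ {b} i → τ ⊆ V i → lookup (ρ [ e ]≔ just b) i ≡ nothing →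
                            ∃ λ u → u ∈ˡ vs × u ∈ V i × u ∉ τ
            still-unknown i τ⊆ eq with unknown-vs R i τ⊆ (nothing-old eq)
            ... | u , there u∈ , rest          = u , u∈ , rest
            ... | _ , here ≡.refl , v∈Vi , _ with e-unique τ⊆ v∈Vi
            ...   | ≡.refl with () ← ≡.trans (≡.sym lookup-e) eq

          absent : Revealing vs N (ρ [ e ]≔ just false) U
          absent .current = state-absent (≢τ R) (current R)
          absent .≢τ = ≢τ R
          absent .τ⊆U = τ⊆U R
          absent .fresh-vs i u∈ u∉U τ⊆ u∈Vi = ≡.trans (lookup-other (later-≢e u∈ u∉U u∈Vi))
            (fresh-vs R i (there u∈) u∉U τ⊆ u∈Vi)
          absent .found i τ⊆ eq = found R i τ⊆ (just-old (λ ()) eq)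
          absent .unknown-vs = still-unknown
          absent .unique = AllPairs.tail (unique R)

          present : v ∉ U → Revealing vs (e ∷ N) (ρ [ e ]≔ just true) (U ∪ ⁅ v ⁆)
          present v∉U = go
            where
            open Present v∉U
            assoc : (children e ws ++ grandchildren N) ++ L ≡ children e ws ++ (grandchildren N ++ L)
            assoc = List.++-assoc (children e ws) (grandchildren N) L
            go : Revealing vs (e ∷ N) (ρ [ e ]≔ just true) (U ∪ ⁅ v ⁆)
            go .current = ≡.subst (State _ _) (≡.sym assoc) (state-present (≢τ R) (current R))
            go .≢τ = ≡.subst (All _) (≡.sym assoc) (All.++⁺ children≢τ (≢τ R))
            go .τ⊆U = p⊆p∪⁅x⁆ ∘ τ⊆U R
            go .fresh-vs i u∈ u∉ τ⊆ u∈Vi = ≡.trans (lookup-other (later-≢e u∈ (∉U+v u∉) u∈Vi))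
              (fresh-vs R i (there u∈) (∉U+v u∉) τ⊆ u∈Vi)
            go .found i τ⊆ eq with i Fin.≟ e
            ... | yes ≡.refl = inj₂ (here ≡.refl)
            ... | no i≢e with found R i τ⊆ (≡.trans (≡.sym (lookup-other i≢e)) eq)
            ...   | inj₁ x∈ = inj₁ x∈
            ...   | inj₂ i∈ = inj₂ (there i∈)
            go .unknown-vs = still-unknown
            go .unique = AllPairs.tail (unique R)

        reveal-none : ∀ {ρ U} → State ρ U ((τ , x) ∷ L) → Revealing (List.allFin n) [] ρ U
        reveal-none (state ex (pb ∷ pend) (≢s ∷ dist)) = λ where
          .current → state ex pend dist
          .≢τ → All.map (λ ≢ eq → ≢ (≡.sym eq)) ≢s
          .τ⊆U → within pb
          .fresh-vs i _ u∉U τ⊆ u∈ → fresh pb i τ⊆ u∈ u∉U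
          .found i τ⊆ eq → inj₁ (parent pb i τ⊆ eq)
          .unknown-vs i τ⊆ _ →
            let u , u∈ , u∉τ = ∣p∣<∣q∣⇒∃∈q∉p (ℕ.≤-reflexive (≡.trans (≡.cong suc ∣τ∣) (≡.sym (V-size i))))
            in  u , ∈-allFin u , u∈ , u∉τ
          .unique → Unique.allFin⁺ n

        module _ {G r B} (pay : Payoff G) (rf≤rt : r false ≤ r true) (0≤rf : 0# ≤ r false) (1≤B : 1# ≤ B)
          (bounds : Bounds L G r B) where

          F : Subset m → Carrier
          F Y = G (does (survive? (suc k) τ x Y)) Y

          -- When `vs` is exhausted, every simplex through `τ` is known. A witness of survival is
          -- present and avoids `x`, so it is one of `N`; monotonicity of the payoff then replaces
          -- survival by the disjunction over `N`.
          finish : ∀ {N ρ U} → Revealing [] N ρ U →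
                   𝔼 ρ F ≤ mix (1# - s ^ List.length N) r + error (M ^ List.length N * B) U
          finish {N} {ρ} R = ≤-trans (𝔼-mono ρ below) (any-bound N pay rf≤rt 0≤rf 1≤B bounds (current R))
            where
            below : ∀ Y → ρ ⊑ Y → F Y ≤ G (does (anySurvives? N Y)) Y
            below Y ρ⊑Y with survive? (suc k) τ x Y | anySurvives? N Y
            ... | no _  | no _  = ≤-refl
            ... | no _  | yes _ = Gf≤Gt pay Y
            ... | yes _ | yes _ = ≤-refl
            ... | yes (i , (i∈Y , τ⊆ , x∉) , all) | no none = ⊥-elim (none (Any.map (λ { ≡.refl → all }) i∈N))
              where
              i∈N : i ∈ˡ N
              i∈N with lookup ρ i in eq
              ... | nothing with _ , () , _ ← unknown-vs R i τ⊆ eq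
              ... | just false with () ← ≡.trans (≡.sym (Vec.[]=⇒lookup i∈Y)) (ρ⊑Y i false eq)
              ... | just true with found R i τ⊆ eq
              ...   | inj₁ x∈ = ⊥-elim (x∉ x∈)
              ...   | inj₂ i∈ = i∈

          -- These are average factors for revealing one simplex with a new vertex. The power of `s`
          -- changes by (1 - p) + p s = 1 - p q^d, which is `t`. The weight M^|N| 2^|U| gains a
          -- factor 2M if the simplex is present, on average 1 - p + 2pM, and `a` lies above this.
          t a D : Carrier
          t = 1# - p * q ^ d
          a = 1# + p * ((1# + 1#) * M)
          D = r true - r false

          0≤D : 0# ≤ D
          0≤D = 0≤y-x rf≤rt

          0≤pq : 0# ≤ p * q ^ d
          0≤pq = 0≤x*y 0≤p (0≤^ d 0≤q)

          0≤t : 0# ≤ t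
          0≤t = 0≤y-x (≤-trans (*-mono-≤ 0≤p (0≤^ d 0≤q) p≤1 (^≤1 d 0≤q q≤1)) (≤-reflexive (*-identityˡ 1#)))

          0≤p2M : 0# ≤ p * ((1# + 1#) * M)
          0≤p2M = 0≤x*y 0≤p (0≤x*y (<⇒≤ 0<2) (≤-trans 0≤1 1≤M))

          0≤a : 0# ≤ a
          0≤a = 0≤x+y 0≤1 0≤p2M

          -- A potential that dominates its average after one more reveal. For empty `vs` it is the
          -- bound of `any-bound`, since `mix (1# - S) r` equals `r true - D * S`. Vertices still to
          -- come are charged in advance: by a factor `t` and a factor `a` each, and by an extra `p`
          -- for each that already lies in `U`.
          revealBound : List (Fin n) → List (Fin m) → Subset n → Carrier
          revealBound vs N U =
            (r true - D * (s ^ List.length N * t ^ List.length vs)) +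
            p * (fromℕ (count vs U) + M ^ List.length N * B * (1# + 1#) ^ ∣ U ∣ * a ^ List.length vs)

          0≤W : ∀ (N : List (Fin m)) (U : Subset n) → 0# ≤ M ^ List.length N * B * (1# + 1#) ^ ∣ U ∣
          0≤W N U = 0≤x*y (0≤x*y (0≤^ (List.length N) (≤-trans 0≤1 1≤M)) (≤-trans 0≤1 1≤B)) (0≤2^ ∣ U ∣)

          slack : ∀ (vs : List (Fin n)) (N : List (Fin m)) (U : Subset n)
              → 0# ≤ D * (s ^ List.length N * t ^ List.length vs * (p * q ^ d)) +
            p * (M ^ List.length N * B * (1# + 1#) ^ ∣ U ∣ * a ^ List.length vs * (p * ((1# + 1#) * M)))
          slack vs N U = 0≤x+y
            (0≤x*y 0≤D (0≤x*y (0≤x*y (0≤^ (List.length N) 0≤s) (0≤^ (List.length vs) 0≤t)) 0≤pq))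
            (0≤x*y 0≤p (0≤x*y (0≤x*y (0≤W N U) (0≤^ (List.length vs) 0≤a)) 0≤p2M))

          skip-≤ : ∀ v vs N U → v ∉ U → revealBound vs N U ≤ revealBound (v ∷ vs) N U
          skip-≤ v vs N U v∉U = ≤-by (slack vs N U)
            (+-congˡ (*-congˡ (+-congʳ (reflexive (≡.cong fromℕ (count-∉ vs v∉U))))) ⟨ trans ⟩
             solve 10 (λ rt D S T p Q c W A M →
               (rt :- D :* (S :* ((con (+ 1) :- p :* Q) :* T))) :+ p :*
                   (c :+ W :* ((con (+ 1) :+ p :* (con (+ 2) :* M)) :* A))
               := ((rt :- D :* (S :* T)) :+ p :* (c :+ W :* A)) :+ (D :* (S :* T :* (p :* Q)) :+ p :*
                   (W :* A :* (p :* (con (+ 2) :* M)))))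
               refl (r true) D (s ^ List.length N) (t ^ List.length vs) p (q ^ d) (fromℕ (count vs U)) _
                   (a ^ List.length vs) M)

          -- If v has been met before, independence is lost; this is paid for by its probability.
          bad-≤ : ∀ v vs N U → v ∈ U → p + revealBound vs N U ≤ revealBound (v ∷ vs) N U
          bad-≤ v vs N U v∈U = ≤-by (slack vs N U)
            (+-congˡ (*-congˡ (+-congʳ (reflexive (≡.cong fromℕ (count-∈ vs v∈U))))) ⟨ trans ⟩
             solve 10 (λ rt D S T p Q c W A M →
               (rt :- D :* (S :* ((con (+ 1) :- p :* Q) :* T))) :+ p :* ((con (+ 1) :+ c) :+ W :*
                   ((con (+ 1) :+ p :* (con (+ 2) :* M)) :* A))
               := (p :+ ((rt :- D :* (S :* T)) :+ p :* (c :+ W :* A))) :+ (D :* (S :* T :* (p :* Q)) :+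
                   p :* (W :* A :* (p :* (con (+ 2) :* M)))))
               refl (r true) D (s ^ List.length N) (t ^ List.length vs) p (q ^ d) (fromℕ (count vs U)) _
                   (a ^ List.length vs) M)

          -- The main term is preserved exactly by the choice of `t`. The weighted error has room to
          -- spare, because `a` has 1 where the average has 1 - p. As `v` does not recur in `vs`,
          -- adding it to `U` leaves the count unchanged.
          branch-≤ : ∀ v vs N e U → v ∉ U → v ∉ˡ vs →
            p * revealBound vs (e ∷ N) (U ∪ ⁅ v ⁆) + (1# - p) * revealBound vs N U ≤ revealBound (v ∷ vs) N U
          branch-≤ v vs N e U v∉U v∉vs = ≤-by
            (0≤x*y 0≤p (0≤x*y 0≤p (0≤x*y (0≤W N U) (0≤^ (List.length vs) 0≤a))))
            (+-congˡ (*-congˡ (+-congʳ (reflexive (≡.cong fromℕ (count-∉ vs v∉U))))) ⟨ trans ⟩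
             solve 12 (λ rt D S T p Q c W B u A M →
               (rt :- D :* (S :* ((con (+ 1) :- p :* Q) :* T))) :+ p :* (c :+ W :* B :* u :*
                   ((con (+ 1) :+ p :* (con (+ 2) :* M)) :* A))
               := (p :* ((rt :- D :* ((con (+ 1) :- Q) :* S :* T)) :+ p :* (c :+ M :* W :* B :*
                   (con (+ 2) :* u) :* A))
                   :+ (con (+ 1) :- p) :* ((rt :- D :* (S :* T)) :+ p :* (c :+ W :* B :* u :* A)))
                  :+ p :* (p :* (W :* B :* u :* A)))
               refl (r true) D (s ^ List.length N) (t ^ List.length vs) p (q ^ d) (fromℕ (count vs U))
               (M ^ List.length N) B ((1# + 1#) ^ ∣ U ∣) (a ^ List.length vs) M ⟨ trans ⟩
             +-congʳ (+-congʳ (*-congˡ (+-congˡ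
                 (*-congˡ (+-cong (reflexive (≡.cong fromℕ (≡.sym (count-∪ vs v∉vs))))
               (*-congʳ (*-congˡ (reflexive (≡.cong ((1# + 1#) ^_) (≡.sym (∣p∪⁅x⁆∣ v∉U))))))))))))

          known-≤ : ∀ v vs N U → revealBound vs N U ≤ revealBound (v ∷ vs) N U
          known-≤ v vs N U = by-cases (v ∈? U)
            where
            by-cases : Dec (v ∈ U) → revealBound vs N U ≤ revealBound (v ∷ vs) N U
            by-cases (yes v∈U) = ≤-trans (≤-by 0≤p (+-comm p _)) (bad-≤ v vs N U v∈U)
            by-cases (no v∉U)  = skip-≤ v vs N U v∉U

          reveal-bound : ∀ vs N {ρ U} → Revealing vs N ρ U → 𝔼 ρ F ≤ revealBound vs N U
          reveal-bound [] N {ρ} {U} R = ≤-trans (finish R) (≤-reflexive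
            (solve 6 (λ rt rf S p W u →
              (con (+ 1) :- S) :* rt :+ (con (+ 1) :- (con (+ 1) :- S)) :* rf :+ p :* (W :* u)
              := (rt :- (rt :- rf) :* (S :* con (+ 1))) :+ p :* (con (+ 0) :+ W :* u :* con (+ 1)))
              refl (r true) (r false) (s ^ List.length N) p _ _))
          reveal-bound (v ∷ vs) N {ρ} {U} R with v ∈? τ
          ... | yes v∈τ = ≤-trans (reveal-bound vs N (skip (λ _ _ _ v∉τ _ → v∉τ v∈τ) R)) (known-≤ v vs N U)
          ... | no v∉τ with V-surjective (τ ∪ ⁅ v ⁆) (≡.trans (∣p∪⁅x⁆∣ v∉τ) (≡.cong suc ∣τ∣))
          ...   | e , Ve≡ with lookup ρ e in eq
          ...     | just _ = ≤-trans (reveal-bound vs N (skip known R)) (known-≤ v vs N U)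
            where
            open Step {ρ} {U} {τ} {e} {v} ∣τ∣ (τ⊆U R) v∉τ Ve≡ (explored (current R))
            known : ∀ i → τ ⊆ V i → v ∈ V i → v ∉ τ → ¬ (lookup ρ i ≡ nothing)
            known i τ⊆ v∈ _ unknown with e-unique τ⊆ v∈
            ... | ≡.refl with () ← ≡.trans (≡.sym eq) unknown
          ...     | nothing = by-cases (v ∈? U)
            where
            open ≤-Reasoning
            by-cases : Dec (v ∈ U) → 𝔼 ρ F ≤ revealBound (v ∷ vs) N U
            -- If the simplex is present, exploration is abandoned and the payoff bounded by 1; if
            -- it is absent, exploration continues with the factor `1# - p` rounded up to 1.
            by-cases (yes v∈U) = begin
              𝔼 ρ F                                               ≈⟨ 𝔼-reveal ρ F eq ⟩
              p * 𝔼 (ρ [ e ]≔ just true) F + (1# - p) * 𝔼 (ρ [ e ]≔ just false) F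
                ≤⟨ +-mono-≤ (*-monoʳ-≤ 0≤p (𝔼-≤ (ρ [ e ]≔ just true) {F} 1# λ Y _ → G≤1 pay
                    (does (survive? (suc k) τ x Y)) Y))
                            (*-monoˡ-≤ (𝔼-≥ (ρ [ e ]≔ just false) {F} 0# λ Y _ → 0≤G pay
                                (does (survive? (suc k) τ x Y)) Y) (x-y≤x 0≤p)) ⟩
              p * 1# + 1# * 𝔼 (ρ [ e ]≔ just false) F            ≈⟨ +-cong (*-identityʳ p) (*-identityˡ _) ⟩
              p + 𝔼 (ρ [ e ]≔ just false) F                       ≤⟨ +-monoʳ-≤ p (reveal-bound vs N
                  (absent R v∉τ Ve≡)) ⟩
              p + revealBound vs N U                              ≤⟨ bad-≤ v vs N U v∈U ⟩
              revealBound (v ∷ vs) N U                            ∎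
            by-cases (no v∉U) = begin
              𝔼 ρ F                                               ≈⟨ 𝔼-reveal ρ F eq ⟩
              p * 𝔼 (ρ [ e ]≔ just true) F + (1# - p) * 𝔼 (ρ [ e ]≔ just false) F
                ≤⟨ +-mono-≤ (*-monoʳ-≤ 0≤p (reveal-bound vs (e ∷ N) (present R v∉τ Ve≡ v∉U)))
                            (*-monoʳ-≤ 0≤1-p (reveal-bound vs N (absent R v∉τ Ve≡))) ⟩
              p * revealBound vs (e ∷ N) (U ∪ ⁅ v ⁆) + (1# - p) * revealBound vs N U
                ≤⟨ branch-≤ v vs N e U v∉U (Unique.Unique[x∷xs]⇒x∉xs (unique R)) ⟩
              revealBound (v ∷ vs) N U                            ∎

    fromℕ≤2^ : ∀ j → fromℕ j ≤ (1# + 1#) ^ j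
    fromℕ≤2^ zero    = 0≤1
    fromℕ≤2^ (suc j) = ≤-trans (+-mono-≤ (1≤^ j 1≤2) (fromℕ≤2^ j))
      (≤-reflexive (solve 1 (λ x → x :+ x := con (+ 2) :* x) refl _))

    -- Revealing starts from all `n` vertices with nothing found, which explains the exponents `n`.
    -- The initial count is the size of `U`; it is at most `B` times the weight 2^|U|, and this is
    -- the final `+ 1#` of the error factor.
    survivalBound-suc : SurvivalBound (suc k) (1# - (1# - p * q ^ d) ^ n)
                          ((1# + p * ((1# + 1#) * K ^ d)) ^ n + 1#)
    survivalBound-suc {τ} {x} {L} {G} {r} {B} pay rf≤rt 0≤rf 1≤B bounds {ρ} {U} s = begin
      𝔼 ρ F′
        ≤⟨ reveal-bound τ ∣τ∣ x L {r = r} pay rf≤rt 0≤rf 1≤B bounds (List.allFin n) [] (reveal-none τ ∣τ∣ x L s) ⟩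
      revealBound τ ∣τ∣ x L {r = r} pay rf≤rt 0≤rf 1≤B bounds (List.allFin n) [] U
        ≡⟨ ≡.cong₂ (λ l c → (r true - (r true - r false) * (1# * (1# - p * q ^ d) ^ l)) +
                          p * (fromℕ c + 1# * B * (1# + 1#) ^ ∣ U ∣ * (1# + p * ((1# + 1#) * K ^ d)) ^ l))
             {x = List.length (List.allFin n)} {y = n} {u = count τ ∣τ∣ (List.allFin n) U} {v = ∣ U ∣}
             (List.length-tabulate {n = n} (λ i → i)) (length-elements U) ⟩
      (r true - (r true - r false) * (1# * T)) + p * (fromℕ ∣ U ∣ + 1# * B * u * A)
        ≤⟨ +-monoʳ-≤ _ (*-monoʳ-≤ 0≤p (+-monoˡ-≤ _ (≤-trans (fromℕ≤2^ ∣ U ∣)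
             (≤-trans (≤-reflexive (sym (*-identityˡ u))) (*-monoˡ-≤ (0≤2^ ∣ U ∣) 1≤B))))) ⟩
      (r true - (r true - r false) * (1# * T)) + p * (B * u + 1# * B * u * A)
        ≈⟨ solve 7 (λ t f T p B u A →
             (t :- (t :- f) :* (con (+ 1) :* T)) :+ p :* (B :* u :+ con (+ 1) :* B :* u :* A)
             := (con (+ 1) :- T) :* t :+ (con (+ 1) :- (con (+ 1) :- T)) :* f :+ p :*
                 ((A :+ con (+ 1)) :* B :* u))
             refl (r true) (r false) T p B u A ⟩
      mix (1# - T) r + error ((A + 1#) * B) U ∎
      where
      open ≤-Reasoning
      ∣τ∣ : ∣ τ ∣ ≡ d
      ∣τ∣ = size (All.head (pending s))
      T A u : Carrier
      T = (1# - p * q ^ d) ^ n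
      A = (1# + p * ((1# + 1#) * K ^ d)) ^ n
      u = (1# + 1#) ^ ∣ U ∣
      F′ : Subset m → Carrier
      F′ Y = G (does (survive? (suc k) τ x Y)) Y

-- Enumerating the d-simplices; core simplices survive

lookup-injective : ∀ {A : Set} {xs : List A} → Unique xs → ∀ {i j} →
                   List.lookup xs i ≡ List.lookup xs j → i ≡ j
lookup-injective (_  ∷ _) {zero}  {zero}  eq = ≡.refl
lookup-injective (x≢ ∷ _) {zero}  {suc j} eq = ⊥-elim (All.lookup x≢ (∈-lookup j) eq)
lookup-injective (x≢ ∷ _) {suc i} {zero}  eq = ⊥-elim (All.lookup x≢ (∈-lookup i) (≡.sym eq))
lookup-injective (_  ∷ u) {suc i} {suc j} eq = ≡.cong suc (lookup-injective u eq)

unique-subsets : ∀ n → Unique (subsets n)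
unique-subsets zero    = [] ∷ []
unique-subsets (suc n) = Unique.++⁺
  (Unique.map⁺ Vec.∷-injectiveʳ (unique-subsets n))
  (Unique.map⁺ Vec.∷-injectiveʳ (unique-subsets n))
  λ (∈ins , ∈outs) → disjoint (∈-map⁻ (inside ∷_) ∈ins) (∈-map⁻ (outside ∷_) ∈outs)
  where
  disjoint : ∀ {σ : Subset (suc n)} → (∃ λ τ → τ ∈ˡ subsets n × σ ≡ inside ∷ τ) →
             (∃ λ τ → τ ∈ˡ subsets n × σ ≡ outside ∷ τ) → ⊥
  disjoint (_ , _ , ≡.refl) (_ , _ , ())

other-member : ∀ {A : Set} {xs : List A} {x} → Unique xs → x ∈ˡ xs → ¬ (List.length xs ≡ 1) →
               ∃ λ y → y ∈ˡ xs × ¬ (y ≡ x)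
other-member {xs = _ ∷ []}     _        _             ≢1 = ⊥-elim (≢1 ≡.refl)
other-member {xs = _ ∷ y ∷ _} (x≢ ∷ _) (here ≡.refl) _  = y , there (here ≡.refl) , λ y≡x → All.head x≢
    (≡.sym y≡x)
other-member {xs = y ∷ _}     (y≢ ∷ _) (there x∈)    _  = y , here ≡.refl , All.lookup y≢ x∈

module DSimplices (d n : ℕ) where

  V : Fin (List.length (dSimplices d n)) → Subset n
  V = List.lookup (dSimplices d n)

  private
    size? : Decidable (λ (σ : Subset n) → ∣ σ ∣ ≡ suc d)
    size? σ = ∣ σ ∣ ℕ.≟ suc d

  V-size : ∀ i → ∣ V i ∣ ≡ suc d
  V-size i = proj₂ (∈-filter⁻ size? {xs = subsets n} (∈-lookup i))

  V-injective : ∀ {i j} → V i ≡ V j → i ≡ j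
  V-injective = lookup-injective (Unique.filter⁺ size? (unique-subsets n))

  V-surjective : ∀ σ → ∣ σ ∣ ≡ suc d → ∃ λ i → V i ≡ σ
  V-surjective σ ∣σ∣ = Any.index σ∈ , ≡.sym (Any.lookup-index σ∈)
    where
    σ∈ : σ ∈ˡ dSimplices d n
    σ∈ = ∈-filter⁺ size? (∈-subsets σ) ∣σ∣

  R^⊆ : ∀ i (Y : Complex d n) {σ} → Face (R^ i Y) σ → Face Y σ
  R^⊆ zero    Y σ∈ = σ∈
  R^⊆ (suc i) Y σ∈ = R^⊆ i Y (proj₁ σ∈)

  module NoFreeFaces (0<d : 0 ℕ.< d) (ω : Outcome d n) (Z : Complex d n)
    (Z⊆ω : ∀ {σ} → Face Z σ → Face (complex {d} {n} ω) σ) (noFreeFace : NoFreeFace Z) where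
    open Exploration {d} {n} V V-size V-injective

    core⊆ω : ∀ {σ} → Simplex Z d σ → Included {d} {n} ω σ
    core⊆ω {σ} (σ∈Z , ∣σ∣) = large (proj₂ (Z⊆ω σ∈Z))
      where
      large : ∣ σ ∣ ℕ.≤ d ⊎ Included {d} {n} ω σ → Included {d} {n} ω σ
      large (inj₁ ∣σ∣≤d) = ⊥-elim (ℕ.<⇒≱ (ℕ.≤-reflexive (≡.sym ∣σ∣)) ∣σ∣≤d)
      large (inj₂ inc)   = inc

    core⇒∈ : ∀ {e} → Face Z (V e) → e ∈ ω
    core⇒∈ {e} e∈Z with core⊆ω (e∈Z , V-size e)
    ... | i , i∈ω , Vi≡Ve = ≡.subst (_∈ ω) (V-injective Vi≡Ve) i∈ω

    another-coface : ∀ {e w} → Face Z (V e) → w ∈ V e → ∃ λ i →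
      Face Z (V i) × i ∈ ω × V e ∖ w ⊆ V i × ¬ (V i ≡ V e)
    another-coface {e} {w} e∈Z w∈ =
      let σ , σ∈cofaces , σ≢Ve = other-member unique-cofaces e∈cofaces degree≢1
          σ∈simplices , τ⊆σ    = ∈-filter⁻ (τ ⊆?_) {xs = simplices Z d} σ∈cofaces
          _ , σ∈Z , ∣σ∣        = ∈-filter⁻ (simplex? Z d) {xs = subsets n} σ∈simplices
          i , i∈ω , Vi≡σ       = core⊆ω (σ∈Z , ∣σ∣)
      in  i , ≡.subst (Face Z) (≡.sym Vi≡σ) σ∈Z , i∈ω , ≡.subst (τ ⊆_) (≡.sym Vi≡σ) τ⊆σ ,
          λ Vi≡Ve → σ≢Ve (≡.trans (≡.sym Vi≡σ) Vi≡Ve)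
      where
      τ : Subset n
      τ = V e ∖ w
      ∣τ∣ : ∣ τ ∣ ≡ d
      ∣τ∣ = ℕ.suc-injective (≡.trans (∣p-x∣ w∈) (V-size e))
      τ∈Z : Face Z τ
      -- Complexes omit the empty face, so positivity of `d` is what makes the facet a face of `Z`.
      τ∈Z with ∣p∣<∣q∣⇒∃∈q∉p {p = Subset.⊥} {τ} (≡.subst₂ ℕ._<_ (≡.sym (∣⊥∣≡0 n)) (≡.sym ∣τ∣) 0<d)
      ... | u , u∈τ , _ = closed Z e∈Z x∈p-y⇒x∈p (u , u∈τ)
      cofaces : List (Subset n)
      cofaces = List.filter (τ ⊆?_) (simplices Z d)
      unique-cofaces : Unique cofaces
      unique-cofaces = Unique.filter⁺ (τ ⊆?_) (Unique.filter⁺ (simplex? Z d) (unique-subsets n))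
      e∈cofaces : V e ∈ˡ cofaces
      e∈cofaces = ∈-filter⁺ (τ ⊆?_) (∈-filter⁺ (simplex? Z d) (∈-subsets (V e)) (e∈Z , V-size e)) x∈p-y⇒x∈p
      degree≢1 : ¬ (List.length cofaces ≡ 1)
      degree≢1 deg≡1 = noFreeFace τ (τ∈Z , ∣τ∣ , deg≡1)

    core⇒Survive : ∀ k {e w} → Face Z (V e) → w ∈ V e → Survive k (V e ∖ w) w ω
    core⇒Survive zero            _   _  = tt
    core⇒Survive (suc k) {e} {w} e∈Z w∈ with another-coface e∈Z w∈
    ... | i , i∈Z , i∈ω , τ⊆Vi , Vi≢Ve = i , (i∈ω , (λ {x} → τ⊆Vi {x}) , w∉Vi) ,
      All.tabulate λ w′∈ → core⇒Survive k i∈Z (τ⊆Vi (∈-elements⁻ w′∈))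
      where
      -- A second coface containing the removed vertex would contain all of `V e`, and the two have
      -- equal size.
      w∉Vi : w ∉ V i
      w∉Vi w∈Vi = Vi≢Ve (≡.sym (⊆∧∣∣≥⇒≡ Ve⊆Vi (ℕ.≤-reflexive (≡.trans (V-size i) (≡.sym (V-size e))))))
        where
        Ve⊆Vi : V e ⊆ V i
        Ve⊆Vi {u} u∈ with u Fin.≟ w
        ... | yes ≡.refl = w∈Vi
        ... | no u≢w     = τ⊆Vi (x∈p∧x≢y⇒x∈p-y u∈ u≢w)

-- Counting simplices and the first moment

-- Moves the count of core simplices from `subsets n`, where `f` takes it, to the list
-- `dSimplices d n` that indexes outcomes.
length-filter-filter : ∀ {A : Set} {P Q : Pred A 0ℓ} (P? : Decidable P) (Q? : Decidable Q) →
  (∀ {x} → P x → Q x) → ∀ xs →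
  List.length (List.filter P? xs) ℕ.≤ List.length (List.filter P? (List.filter Q? xs))
length-filter-filter P? Q? P⇒Q []       = z≤n
length-filter-filter P? Q? P⇒Q (x ∷ xs) with Q? x
... | yes _ with P? x
...   | yes _ = s≤s (length-filter-filter P? Q? P⇒Q xs)
...   | no _  = length-filter-filter P? Q? P⇒Q xs
length-filter-filter P? Q? P⇒Q (x ∷ xs) | no ¬q with P? x
...   | yes p = ⊥-elim (¬q (P⇒Q p))
...   | no _  = length-filter-filter P? Q? P⇒Q xs

private
  choose : ℕ → ∀ n → ℕ
  choose k n = List.length (List.filter (λ σ → ∣ σ ∣ ℕ.≟ k) (subsets n))

  length-filter-map : ∀ {A B : Set} {P : Pred B 0ℓ} {Q : Pred A 0ℓ} (P? : Decidable P)
      (Q? : Decidable Q) (g : A → B) →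
    (∀ x → P (g x) → Q x) → ∀ xs →
    List.length (List.filter P? (List.map g xs)) ℕ.≤ List.length (List.filter Q? xs)
  length-filter-map P? Q? g P⇒Q []       = z≤n
  length-filter-map P? Q? g P⇒Q (x ∷ xs) with P? (g x) | Q? x
  ... | yes _ | yes _ = s≤s (length-filter-map P? Q? g P⇒Q xs)
  ... | yes p | no ¬q = ⊥-elim (¬q (P⇒Q x p))
  ... | no _  | yes _ = ℕ.m≤n⇒m≤1+n (length-filter-map P? Q? g P⇒Q xs)
  ... | no _  | no _  = length-filter-map P? Q? g P⇒Q xs

  length-filter-none : ∀ {n} (xs : List (Subset n)) →
    List.length (List.filter (λ σ → ∣ σ ∣ ℕ.≟ 0) (List.map (true ∷_) xs)) ≡ 0
  length-filter-none []       = ≡.refl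
  length-filter-none (_ ∷ xs) = length-filter-none xs

  -- Pascal's rule: subsets with and without the first vertex number at most (n+1)^k and n (n+1)^k,
  -- and these add up to (n+1)^(k+1).
  choose≤n^k : ∀ k n → choose k n ℕ.≤ n ℕ.^ k
  choose≤n^k zero    zero    = ℕ.≤-refl
  choose≤n^k (suc k) zero    = z≤n
  choose≤n^k k       (suc n) = ℕ.≤-trans (ℕ.≤-reflexive split) (bound k)
    where
    open ℕ.≤-Reasoning
    split : choose k (suc n) ≡
      List.length (List.filter (λ σ → ∣ σ ∣ ℕ.≟ k) (List.map (inside ∷_) (subsets n))) ℕ.+
      List.length (List.filter (λ σ → ∣ σ ∣ ℕ.≟ k) (List.map (outside ∷_) (subsets n)))
    split = ≡.trans (≡.cong List.length (List.filter-++ (λ σ → ∣ σ ∣ ℕ.≟ k) (List.map (inside ∷_) (subsets n)) _))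
                    (List.length-++ (List.filter (λ σ → ∣ σ ∣ ℕ.≟ k) (List.map (inside ∷_) (subsets n))))
    bound : ∀ k →
      List.length (List.filter (λ σ → ∣ σ ∣ ℕ.≟ k) (List.map (inside ∷_) (subsets n))) ℕ.+
      List.length (List.filter (λ σ → ∣ σ ∣ ℕ.≟ k) (List.map (outside ∷_) (subsets n))) ℕ.≤ suc n ℕ.^ k
    bound zero    = ℕ.+-mono-≤ (ℕ.≤-reflexive (length-filter-none (subsets n)))
      (ℕ.≤-trans (length-filter-map (λ σ → ∣ σ ∣ ℕ.≟ 0) (λ σ → ∣ σ ∣ ℕ.≟ 0) (outside ∷_) (λ _ eq → eq)
          (subsets n)) (choose≤n^k 0 n))
    bound (suc k) = ℕ.+-mono-≤
      (ℕ.≤-trans (length-filter-map (λ σ → ∣ σ ∣ ℕ.≟ suc k) (λ σ → ∣ σ ∣ ℕ.≟ k) (inside ∷_)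
          (λ _ → ℕ.suc-injective) (subsets n))
        (ℕ.≤-trans (choose≤n^k k n) (ℕ.^-monoˡ-≤ k (ℕ.n≤1+n n))))
      (ℕ.≤-trans (length-filter-map (λ σ → ∣ σ ∣ ℕ.≟ suc k) (λ σ → ∣ σ ∣ ℕ.≟ suc k) (outside ∷_)
          (λ _ eq → eq) (subsets n))
        (ℕ.≤-trans (choose≤n^k (suc k) n) (ℕ.*-monoʳ-≤ n (ℕ.^-monoˡ-≤ k (ℕ.n≤1+n n)))))

length-dSimplices≤ : ∀ d n → List.length (dSimplices d n) ℕ.≤ n ℕ.^ suc d
length-dSimplices≤ d n = choose≤n^k (suc d) n

module FirstMoment (ℝ : CompleteOrderedField) (p : CompleteOrderedField.Carrier ℝ)
  (0≤p : CompleteOrderedField._≤_ ℝ (CompleteOrderedField.0# ℝ) p)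
  (p≤1 : CompleteOrderedField._≤_ ℝ p (CompleteOrderedField.1# ℝ)) {d n : ℕ} (0<d : 0 ℕ.< d) where
  open CompleteOrderedField ℝ hiding (zero)
  open OrderedFieldProperties ℝ
  open Expectation ℝ p 0≤p p≤1
  open DSimplices d n
  open SurvivalBound ℝ p 0≤p p≤1 {d} {n} V V-size V-injective V-surjective public
  open Exploration {d} {n} V V-size V-injective
  open Probability ℝ using (Pr)

  private
    m : ℕ
    m = List.length (dSimplices d n)

    apex : ∀ e → ∃ (_∈ V e)
    apex e with ∣p∣<∣q∣⇒∃∈q∉p {p = Subset.⊥} {V e} (≡.subst₂ ℕ._<_ (≡.sym (∣⊥∣≡0 n)) (≡.sym (V-size e)) (s≤s z≤n))
    ... | w , w∈ , _ = w , w∈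

  -- A single facet of V e already gives a strong enough bound.
  survives : ℕ → Fin m → Subset m → Bool
  survives k e Y = lookup Y e ∧ does (survive? k (V e ∖ proj₁ (apex e)) (proj₁ (apex e)) Y)

  initial-state : ∀ e → State (unknown [ e ]≔ just true) (V e) ((V e ∖ proj₁ (apex e) , proj₁ (apex e)) ∷ [])
  initial-state e = state
    (record
      { present⊆    = λ i eq → present⊆′ i (only-e i eq)
      ; far-unknown = λ i u∈ _ u∉ _ _ → else-unknown i λ where ≡.refl → u∉ u∈
      })
    (record
      { size   = ℕ.suc-injective (≡.trans (∣p-x∣ (proj₂ (apex e))) (V-size e))
      ; within = x∈p-y⇒x∈p
      ; fresh  = λ i _ u∈ u∉ → else-unknown i λ where ≡.refl → u∉ u∈
      ; parent = λ i _ eq → ≡.subst (λ j → proj₁ (apex e) ∈ V j) (≡.sym (only-e i eq)) (proj₂ (apex e))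
      } ∷ [])
    ([] ∷ [])
    where
    else-unknown : ∀ i → ¬ (i ≡ e) → lookup (unknown [ e ]≔ just true) i ≡ nothing
    else-unknown i i≢e = ≡.trans (Vec.lookup∘update′ i≢e unknown _) (Vec.lookup-replicate i nothing)
    only-e : ∀ i → lookup (unknown [ e ]≔ just true) i ≡ just true → i ≡ e
    only-e i eq with i Fin.≟ e
    ... | yes i≡e = i≡e
    ... | no i≢e with () ← ≡.trans (≡.sym (else-unknown i i≢e)) eq
    present⊆′ : ∀ i → i ≡ e → V i ⊆ V e
    present⊆′ i ≡.refl u∈ = u∈

  module _ {k q K} (1≤K : 1# ≤ K) (bound : SurvivalBound k q K) where

    edgeBound : Carrier
    edgeBound = p * (q + p * (K * (1# + 1#) ^ suc d))

    -- Revealing `V e` itself contributes the outer factor `p`, which later cancels one of the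
    -- `suc d` powers of n from the number of simplices. Given its presence, the exploration starts
    -- with `U` equal to `V e`, whence the power `suc d` of 2.
    survives-bound : ∀ e → 𝔼 unknown (indicator ∘ survives k e) ≤ edgeBound
    survives-bound e = begin
      𝔼 unknown (indicator ∘ survives k e)
        ≈⟨ 𝔼-reveal unknown (indicator ∘ survives k e) (Vec.lookup-replicate e nothing) ⟩
      p * 𝔼 (unknown [ e ]≔ just true) (indicator ∘ survives k e) +
      (1# - p) * 𝔼 (unknown [ e ]≔ just false) (indicator ∘ survives k e)
        ≤⟨ +-mono-≤ (*-monoʳ-≤ 0≤p present) (*-monoʳ-≤ 0≤1-p absent) ⟩
      p * (mix q indicator + error (K * 1#) (V e)) + (1# - p) * 0#
        ≡⟨ ≡.cong (λ l → p * (mix q indicator + p * (K * 1# * (1# + 1#) ^ l)) + (1# - p) * 0#) (V-size e) ⟩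
      p * (mix q indicator + p * (K * 1# * (1# + 1#) ^ suc d)) + (1# - p) * 0#
        ≈⟨ solve 4 (λ p q K u → p :* (q :* con (+ 1) :+ (con (+ 1) :- q) :* con (+ 0) :+ p :*
            (K :* con (+ 1) :* u))
             :+ (con (+ 1) :- p) :* con (+ 0) := p :* (q :+ p :* (K :* u))) refl p q K _ ⟩
      edgeBound ∎
      where
      open ≤-Reasoning
      w : Fin n
      w = proj₁ (apex e)
      pay : Payoff (λ b _ → indicator b)
      pay = record
        { 0≤G   = λ b _ → 0≤indicator b
        ; G≤1   = λ where
            true  _ → ≤-refl
            false _ → 0≤1
        ; Gf≤Gt = λ _ → 0≤1
        }
      present : 𝔼 (unknown [ e ]≔ just true) (indicator ∘ survives k e) ≤ mix q indicator + error (K * 1#) (V e)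
      present = ≤-trans
        (𝔼-mono (unknown [ e ]≔ just true) {indicator ∘ survives k e}
          {λ Y → indicator (does (survive? k (V e ∖ w) w Y))}
          λ Y ρ⊑Y → ≤-reflexive (reflexive (≡.cong (λ b → indicator (b ∧ does (survive? k (V e ∖ w) w Y)))
            (ρ⊑Y e true (Vec.lookup∘update e unknown _)))))
        (bound {r = indicator} pay 0≤1 ≤-refl ≤-refl
          (λ {ρ} {U} _ b → ≤-trans (≤-reflexive (𝔼-const ρ (indicator b))) (≤-by (0≤error U ≤-refl) refl))
          (initial-state e))
      absent : 𝔼 (unknown [ e ]≔ just false) (indicator ∘ survives k e) ≤ 0#
      absent = 𝔼-≤ (unknown [ e ]≔ just false) {indicator ∘ survives k e} 0# λ Y ρ⊑Y →
        ≤-reflexive (reflexive (≡.cong (λ b → indicator (b ∧ does (survive? k (V e ∖ w) w Y)))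
          (ρ⊑Y e false (Vec.lookup∘update e unknown _))))

    private
      count-≤-sum : ∀ {A : Set} {P : Pred (Subset n) 0ℓ} (P? : Decidable P) (F : A → Carrier) →
        (∀ a → 0# ≤ F a) → ∀ xs (g : Fin (List.length xs) → A) → (∀ i → P (List.lookup xs i) → 1# ≤ F (g i)) →
        fromℕ (List.length (List.filter P? xs)) ≤ List.foldr (λ a s → F a + s) 0# (List.tabulate g)
      count-≤-sum P? F 0≤F []       g P⇒ = ≤-refl
      count-≤-sum P? F 0≤F (x ∷ xs) g P⇒ with P? x
      ... | yes px = +-mono-≤ (P⇒ zero px) (count-≤-sum P? F 0≤F xs (g ∘ suc) (P⇒ ∘ suc))
      ... | no _   = ≤-trans (count-≤-sum P? F 0≤F xs (g ∘ suc) (P⇒ ∘ suc))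
                             (≤-by (0≤F (g zero)) (+-comm _ _))

    f-R∞≤ : ∀ ω → fromℕ (f (R∞ (complex {d} {n} ω)) d) ≤
            List.foldr (λ e s → indicator (survives k e ω) + s) 0# (List.allFin m)
    f-R∞≤ ω = ≤-trans
      (fromℕ-mono-≤ (length-filter-filter (simplex? (R∞ (complex ω)) d) (λ σ → ∣ σ ∣ ℕ.≟ suc d) proj₂
          (subsets n)))
      (count-≤-sum (simplex? (R∞ (complex ω)) d) (λ e → indicator (survives k e ω))
        (λ e → 0≤indicator (survives k e ω)) (dSimplices d n) (λ i → i) one)
      where
      X : Complex d n
      X = complex ω
      open NoFreeFaces 0<d ω (R∞ X) (R^⊆ (f X d) X) (R∞-noFreeFace X)
      one : ∀ e → Simplex (R∞ (complex ω)) d (V e) → 1# ≤ indicator (survives k e ω)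
      one e (e∈Z , _) with survive? k (V e ∖ proj₁ (apex e)) (proj₁ (apex e)) ω
      ... | yes _ = ≤-reflexive (reflexive (≡.cong (λ b → indicator (b ∧ true))
        (≡.sym (Vec.[]=⇒lookup (core⇒∈ e∈Z)))))
      ... | no ¬s = ⊥-elim (¬s (core⇒Survive k e∈Z (proj₂ (apex e))))

    0≤Pr : ∀ {E : Pred (Complex d n) 0ℓ} (E? : Decidable E) → 0# ≤ Pr d n p E?
    0≤Pr E? = ≤-trans (𝔼-≥ unknown 0# λ ω _ → 0≤indicator (does (E? (complex ω)))) (≤-reflexive (sym (Pr≈𝔼 E?)))

    markov : ∀ x → x * Pr d n p (λ Y → x <? fromℕ (f (R∞ Y) d)) ≤ fromℕ m * edgeBound
    markov x = begin
      x * Pr d n p (λ Y → x <? fromℕ (f (R∞ Y) d))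
        ≈⟨ *-congˡ (Pr≈𝔼 {d} {n} (λ Y → x <? fromℕ (f (R∞ Y) d))) ⟩
      x * 𝔼 unknown (λ ω → indicator (does (x <? fromℕ (f (R∞ (complex {d} {n} ω)) d))))
        ≈⟨ 𝔼-* unknown x (λ ω → indicator (does (x <? fromℕ (f (R∞ (complex {d} {n} ω)) d)))) ⟨
      𝔼 unknown (λ ω → x * indicator (does (x <? fromℕ (f (R∞ (complex {d} {n} ω)) d))))
        ≤⟨ 𝔼-mono unknown (λ ω _ → below ω) ⟩
      𝔼 unknown (λ ω → List.foldr (λ e s → indicator (survives k e ω) + s) 0# (List.allFin m))
        ≤⟨ 𝔼-foldr-≤ unknown (λ e ω → indicator (survives k e ω)) edgeBound survives-bound (List.allFin m) ⟩
      fromℕ (List.length (List.allFin m)) * edgeBound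
        ≡⟨ ≡.cong (λ l → fromℕ l * edgeBound) (List.length-tabulate {n = m} (λ i → i)) ⟩
      fromℕ m * edgeBound ∎
      where
      open ≤-Reasoning
      below : ∀ ω → x * indicator (does (x <? fromℕ (f (R∞ (complex {d} {n} ω)) d))) ≤
              List.foldr (λ e s → indicator (survives k e ω) + s) 0# (List.allFin m)
      below ω with x <? fromℕ (f (R∞ (complex {d} {n} ω)) d)
      ... | yes x<f = ≤-trans (≤-reflexive (*-identityʳ x)) (≤-trans (<⇒≤ x<f) (f-R∞≤ ω))
      ... | no _    = ≤-trans (≤-reflexive (zeroʳ x)) (≤-trans (0≤fromℕ (f (R∞ (complex {d} {n} ω)) d)) (f-R∞≤ ω))

-- Limits of sequences

module Limits (ℝ : CompleteOrderedField) where
  open CompleteOrderedField ℝ hiding (zero)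
  open OrderedFieldProperties ℝ

  Small : Carrier → Carrier → Set
  Small ε x = - ε < x × x < ε

  small-cong : ∀ {ε x y} → x ≈ y → Small ε x → Small ε y
  small-cong x≈y (lo , hi) = proj₁ STO.<-resp-≈ x≈y lo , proj₂ STO.<-resp-≈ x≈y hi

  small-+ : ∀ {ε δ x y} → Small ε x → Small δ y → Small (ε + δ) (x + y)
  small-+ {ε} {δ} {x} {y} (lo , hi) (lo′ , hi′) =
    <-by (0<x+y (0<y-x lo) (0<y-x lo′))
      (solve 4 (λ e d x y → x :+ y := :- (e :+ d) :+ ((x :- :- e) :+ (y :- :- d))) refl ε δ x y) ,
    <-by (0<x+y (0<y-x hi) (0<y-x hi′))
      (solve 4 (λ e d x y → e :+ d := (x :+ y) :+ ((e :- x) :+ (d :- y))) refl ε δ x y)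
    where
    0<x+y : ∀ {x y} → 0# < x → 0# < y → 0# < x + y
    0<x+y 0<x 0<y = <-≤-trans 0<x (≤-by (<⇒≤ 0<y) refl)

  -- Absolute values are avoided by writing twice each gap as a sum of two products of positive
  -- numbers, for instance 2(xy + εδ) = (x + ε)(y + δ) + (ε - x)(δ - y).
  small-* : ∀ {ε δ x y} → Small ε x → Small δ y → Small (ε * δ) (x * y)
  small-* {ε} {δ} {x} {y} (lo , hi) (lo′ , hi′) =
    halve (≤-by (<⇒≤ (*-pos (0<y-x hi) (0<y-x hi′))) refl) (*-pos (0<y-x lo) (0<y-x lo′))
      (solve 4 (λ e d x y → (x :* y :- :- (e :* d)) :+ (x :* y :- :- (e :* d))
          := ((x :- :- e) :* (y :- :- d)) :+ ((e :- x) :* (d :- y))) refl ε δ x y) ,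
    halve (≤-by (<⇒≤ (*-pos (0<y-x hi) (0<y-x lo′))) refl) (*-pos (0<y-x lo) (0<y-x hi′))
      (solve 4 (λ e d x y → (e :* d :- x :* y) :+ (e :* d :- x :* y) := ((x :- :- e) :* (d :- y)) :+
          ((e :- x) :* (y :- :- d))) refl ε δ x y)
    where
    halve : ∀ {a b u v} → u ≤ u + v → 0# < u → (b - a) + (b - a) ≈ u + v → a < b
    halve {a} {b} u≤u+v 0<u eq with a <? b
    ... | yes a<b = a<b
    ... | no b≤a  = ⊥-elim (2[b-a]≤0 (<-≤-trans 0<u (≤-trans u≤u+v (≤-reflexive (sym eq)))))
      where
      2[b-a]≤0 : (b - a) + (b - a) ≤ 0#
      2[b-a]≤0 = ≤-by (0≤x+y (0≤y-x b≤a) (0≤y-x b≤a))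
        (solve 2 (λ a b → con (+ 0) := ((b :- a) :+ (b :- a)) :+ ((a :- b) :+ (a :- b))) refl a b)

  small-neg : ∀ {ε x} → Small ε x → Small ε (- x)
  small-neg {ε} {x} (lo , hi) = neg-mono-< hi ,
    <-≤-trans (neg-mono-< lo) (≤-reflexive (solve 1 (λ e → :- :- e := e) refl ε))

  bounded : ∀ x → ∃ λ K → 0# < K × Small K x
  bounded x =
    let m , x<m  = archimedean x
        n , -x<n = archimedean (- x)
        K        = fromℕ (suc (m ℕ.+ n))
    in  K , 0<fromℕ-suc (m ℕ.+ n) ,
        (<-≤-trans (neg-mono-< (<-≤-trans -x<n (fromℕ-mono-≤ (ℕ.m≤n⇒m≤1+n (ℕ.m≤n+m n m)))))
          (≤-reflexive (solve 1 (λ x → :- :- x := x) refl x)) ,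
         <-≤-trans x<m (fromℕ-mono-≤ (ℕ.m≤n⇒m≤1+n (ℕ.m≤m+n m n))))

  Eventually : (ℕ → Set) → Set
  Eventually P = ∃ λ N → ∀ n → N ℕ.≤ n → P n

  eventually-∧ : ∀ {P Q : ℕ → Set} → Eventually P → Eventually Q → Eventually (λ n → P n × Q n)
  eventually-∧ (M , p) (N , q) = M ℕ.⊔ N , λ n le →
    p n (ℕ.≤-trans (ℕ.m≤m⊔n M N) le) , q n (ℕ.≤-trans (ℕ.m≤n⊔m M N) le)

  eventually-map : ∀ {P Q : ℕ → Set} → (∀ n → P n → Q n) → Eventually P → Eventually Q
  eventually-map P⇒Q (N , p) = N , λ n le → P⇒Q n (p n le)

  lim⁻ : ∀ {u l} → u ⟶ l → ∀ {ε} → 0# < ε → Eventually (λ n → Small ε (u n - l))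
  lim⁻ {u} {l} u⟶l {ε} 0<ε = eventually-map (λ n (lo , hi) →
    <-by (0<y-x lo) (solve 3 (λ u l e → u :- l := :- e :+ (u :- (l :- e))) refl (u n) l ε) ,
    <-by (0<y-x hi) (solve 3 (λ u l e → e := (u :- l) :+ ((l :+ e) :- u)) refl (u n) l ε)) (u⟶l ε 0<ε)

  lim⁺ : ∀ {u l} → (∀ {ε} → 0# < ε → Eventually (λ n → Small ε (u n - l))) → u ⟶ l
  lim⁺ {u} {l} small ε 0<ε = eventually-map (λ n (lo , hi) →
    <-by (0<y-x lo) (solve 3 (λ u l e → u := (l :- e) :+ ((u :- l) :- :- e)) refl (u n) l ε) ,
    <-by (0<y-x hi) (solve 3 (λ u l e → l :+ e := u :+ (e :- (u :- l))) refl (u n) l ε)) (small 0<ε)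

  lim-const : ∀ x → (λ _ → x) ⟶ x
  lim-const x = lim⁺ λ 0<ε → 0 , λ _ _ → small-cong (sym (-‿inverseʳ x))
    (<-≤-trans (neg-mono-< 0<ε) (≤-reflexive (solve 0 (:- con (+ 0) := con (+ 0)) refl)) , 0<ε)

  lim-cong : ∀ {u v l l′} → Eventually (λ n → u n ≈ v n) → l ≈ l′ → u ⟶ l → v ⟶ l′
  lim-cong u≈v l≈l′ u⟶l = lim⁺ λ 0<ε → eventually-map
    (λ n (eq , small) → small-cong (+-cong eq (-‿cong l≈l′)) small) (eventually-∧ u≈v (lim⁻ u⟶l 0<ε))

  lim-+ : ∀ {u v a b} → u ⟶ a → v ⟶ b → (λ n → u n + v n) ⟶ (a + b)
  lim-+ {u} {v} {a} {b} u⟶a v⟶b = lim⁺ λ {ε} 0<ε → eventually-map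
    (λ n (su , sv) → ≡small ε (small-cong
      (solve 4 (λ u v a b → (u :- a) :+ (v :- b) := (u :+ v) :- (a :+ b)) refl (u n) (v n) a b) (small-+ su sv)))
    (eventually-∧ (lim⁻ u⟶a (half-pos 0<ε)) (lim⁻ v⟶b (half-pos 0<ε)))
    where
    ≡small : ∀ ε {x} → Small (ε * (1# + 1#) ⁻¹ + ε * (1# + 1#) ⁻¹) x → Small ε x
    ≡small ε (lo , hi) = ≤-<-trans (≤-reflexive (-‿cong (sym (half+half ε)))) lo ,
                         <-≤-trans hi (≤-reflexive (half+half ε))

  small-mono : ∀ {ε δ x} → ε ≤ δ → Small ε x → Small δ x
  small-mono ε≤δ (lo , hi) = ≤-<-trans (neg-mono-≤ ε≤δ) lo , <-≤-trans hi ε≤δ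

  lim-* : ∀ {u v a b} → u ⟶ a → v ⟶ b → (λ n → u n * v n) ⟶ (a * b)
  lim-* {u} {v} {a} {b} u⟶a v⟶b = lim⁺ λ {ε} 0<ε →
    let A , 0<A , sa = bounded a
        B , 0<B , sb = bounded b
        -- The summands pay for (u - a)(v - b), (v - b)a and (u - a)b; the first product uses that v
        -- - b is eventually between -1 and 1.
        C            = 1# + A + B
        0<C          = <-≤-trans 0<1 (≤-by (0≤x+y (<⇒≤ 0<A) (<⇒≤ 0<B)) (+-assoc 1# A B))
        η            = ε * C ⁻¹
        0<η          = *-pos 0<ε (⁻¹-pos 0<C)
    in  eventually-map (λ n (su , sv , sv1) →
          small-mono (≤-reflexive (trans (solve 3 (λ h A B → h :* con (+ 1) :+ (h :* A :+ h :* B)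
              := h :* (con (+ 1) :+ A :+ B)) refl η A B) (x*y⁻¹*y≈x ε 0<C)))
            (small-cong (solve 4 (λ u v a b → (u :- a) :* (v :- b) :+ ((v :- b) :* a :+ (u :- a) :* b)
                := u :* v :- a :* b) refl (u n) (v n) a b)
              (small-+ (small-* su sv1) (small-+ (small-* sv sa) (small-* su sb)))))
        (eventually-∧ (lim⁻ u⟶a 0<η) (eventually-∧ (lim⁻ v⟶b 0<η) (lim⁻ v⟶b 0<1)))

  lim-neg : ∀ {u a} → u ⟶ a → (λ n → - u n) ⟶ (- a)
  lim-neg {u} {a} u⟶a = lim⁺ λ 0<ε → eventually-map
    (λ n s → small-cong (solve 2 (λ u a → :- (u :- a) := :- u :- :- a) refl (u n) a) (small-neg s)) (lim⁻ u⟶a 0<ε)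

  lim-≤ : ∀ {u v a b} → u ⟶ a → v ⟶ b → Eventually (λ n → u n ≤ v n) → a ≤ b
  lim-≤ {u} {v} {a} {b} u⟶a v⟶b u≤v b<a =
    let ε                              = (a - b) * (1# + 1#) ⁻¹
        0<ε                            = half-pos (0<y-x b<a)
        N , at                         = eventually-∧ u≤v (eventually-∧ (u⟶a ε 0<ε) (v⟶b ε 0<ε))
        u≤v , (a-ε<u , _) , (_ , v<b+ε) = at N ℕ.≤-refl
    in  u≤v (begin-strict
          v N       <⟨ v<b+ε ⟩
          b + ε     ≈⟨ solve 2 (λ b e → b :+ e := (b :+ (e :+ e)) :- e) refl b ε ⟩
          (b + (ε + ε)) - ε ≈⟨ +-congʳ (+-congˡ (half+half (a - b))) ⟩
          (b + (a - b)) - ε ≈⟨ solve 3 (λ a b e → (b :+ (a :- b)) :- e := a :- e) refl a b ε ⟩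
          a - ε     <⟨ a-ε<u ⟩
          u N       ∎)
    where open ≤-Reasoning

  lim-unique : ∀ {u a b} → u ⟶ a → u ⟶ b → a ≈ b
  lim-unique u⟶a u⟶b = ≤-antisym (lim-≤ u⟶a u⟶b (0 , λ _ _ → ≤-refl)) (lim-≤ u⟶b u⟶a (0 , λ _ _ → ≤-refl))

  -- n ⁻¹ is unspecified at n = 0.
  lim-n⁻¹ : (λ n → fromℕ n ⁻¹) ⟶ 0#
  lim-n⁻¹ = lim⁺ λ {ε} 0<ε → eventually-map (λ n (1<εn , 0<n) → small-cong
      (solve 1 (λ x → x := x :- con (+ 0)) refl (fromℕ n ⁻¹))
      (<-≤-trans (neg-mono-< 0<ε) (≤-trans (≤-reflexive (solve 0 (:- con (+ 0) := con (+ 0)) refl))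
          (<⇒≤ (⁻¹-pos (0<fromℕ 0<n)))) ,
       (x⁻¹<ε 0<ε (0<fromℕ 0<n) 1<εn)))
    (eventually-∧ (eventually-small 1# 0<ε) (1 , λ n le → le))
    where
    open ≤-Reasoning
    x⁻¹<ε : ∀ {ε x} → 0# < ε → 0# < x → 1# < ε * x → x ⁻¹ < ε
    x⁻¹<ε {ε} {x} 0<ε 0<x 1<εx = begin-strict
      x ⁻¹            ≈⟨ *-identityʳ _ ⟨
      x ⁻¹ * 1#       <⟨ *-monoʳ-< (⁻¹-pos 0<x) 1<εx ⟩
      x ⁻¹ * (ε * x)  ≈⟨ solve 3 (λ i e x → i :* (e :* x) := e :* i :* x) refl (x ⁻¹) ε x ⟩
      ε * x ⁻¹ * x    ≈⟨ x*y⁻¹*y≈x ε 0<x ⟩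
      ε               ∎

-- The exponential series and powers of 1 - z/n

module Exponential (ℝ : CompleteOrderedField) where
  open CompleteOrderedField ℝ hiding (zero)
  open OrderedFieldProperties ℝ
  open Limits ℝ
  open SumProperties +-commutativeMonoid using (sum-init-last; sum-cong-≋)

  -- The k-th term C(j,k) x^k of the binomial expansion of (1 + x)^j.
  binomialTerm : Carrier → ℕ → ℕ → Carrier
  binomialTerm x zero    j       = 1#
  binomialTerm x (suc k) zero    = 0#
  binomialTerm x (suc k) (suc j) = binomialTerm x (suc k) j + x * binomialTerm x k j

  binomialSum : Carrier → ℕ → ℕ → Carrier
  binomialSum x zero    j = 0#
  binomialSum x (suc N) j = binomialSum x N j + binomialTerm x N j

  -- The ratio of consecutive binomial terms in division-free form. The difference is taken in the
  -- field, so the vanishing terms with `k` above `j` are included.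
  binomialTerm-suc : ∀ x k j →
    fromℕ (suc k) * binomialTerm x (suc k) j ≈ x * (fromℕ j - fromℕ k) * binomialTerm x k j
  binomialTerm-suc x zero    zero    = solve 1 (λ x → (con (+ 1) :+ con (+ 0)) :* con (+ 0)
      := x :* (con (+ 0) :- con (+ 0)) :* con (+ 1)) refl x
  binomialTerm-suc x (suc k) zero    = solve 2 (λ x k → (con (+ 1) :+ k) :* con (+ 0)
      := x :* (con (+ 0) :- k) :* con (+ 0)) refl x (fromℕ (suc k))
  binomialTerm-suc x zero    (suc j) = begin
    (1# + 0#) * (binomialTerm x 1 j + x * 1#)      ≈⟨ distribˡ _ _ _ ⟩
    (1# + 0#) * binomialTerm x 1 j + (1# + 0#) * (x * 1#) ≈⟨ +-congʳ (binomialTerm-suc x zero j) ⟩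
    x * (fromℕ j - 0#) * 1# + (1# + 0#) * (x * 1#)
      ≈⟨ solve 2 (λ x j → x :* (j :- con (+ 0)) :* con (+ 1) :+ (con (+ 1) :+ con (+ 0)) :*
          (x :* con (+ 1)) := x :* ((con (+ 1) :+ j) :- con (+ 0)) :* con (+ 1)) refl x (fromℕ j) ⟩
    x * (fromℕ (suc j) - 0#) * 1# ∎
    where open import Relation.Binary.Reasoning.Setoid setoid
  binomialTerm-suc x (suc k) (suc j) = begin
    K * (b₂ + x * b₁)                            ≈⟨ distribˡ _ _ _ ⟩
    K * b₂ + K * (x * b₁)                        ≈⟨ +-congʳ (binomialTerm-suc x (suc k) j) ⟩
    x * (J - (1# + k′)) * b₁ + (1# + (1# + k′)) * (x * b₁)
      ≈⟨ solve 4 (λ x J k b → x :* (J :- (con (+ 1) :+ k)) :* b :+ (con (+ 1) :+ (con (+ 1) :+ k)) :* (x :* b)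
                          := x :* (J :- k) :* b :+ x :* ((con (+ 1) :+ k) :* b)) refl x J k′ b₁ ⟩
    x * (J - k′) * b₁ + x * ((1# + k′) * b₁)     ≈⟨ +-congˡ (*-congˡ (binomialTerm-suc x k j)) ⟩
    x * (J - k′) * b₁ + x * (x * (J - k′) * b₀)
      ≈⟨ solve 5 (λ x J k b a → x :* (J :- k) :* b :+ x :* (x :* (J :- k) :* a)
                            := x :* ((con (+ 1) :+ J) :- (con (+ 1) :+ k)) :* (b :+ x :* a)) refl x J k′ b₁ b₀ ⟩
    x * (fromℕ (suc j) - fromℕ (suc k)) * (b₁ + x * b₀) ∎
    where
    open import Relation.Binary.Reasoning.Setoid setoid
    K J k′ b₀ b₁ b₂ : Carrier
    K  = fromℕ (suc (suc k))
    J  = fromℕ j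
    k′ = fromℕ k
    b₀ = binomialTerm x k j
    b₁ = binomialTerm x (suc k) j
    b₂ = binomialTerm x (suc (suc k)) j

  binomialSum-suc : ∀ x N j → binomialSum x (suc N) (suc j) ≈ binomialSum x (suc N) j + x * binomialSum x N j
  binomialSum-suc x zero    j = solve 1 (λ x → con (+ 0) :+ con (+ 1) := con (+ 0) :+ con (+ 1) :+ x :*
      con (+ 0)) refl x
  binomialSum-suc x (suc N) j = trans (+-congʳ (binomialSum-suc x N j))
    (solve 5 (λ x s s′ b b′ → (s′ :+ x :* s) :+ (b′ :+ x :* b) := (s′ :+ b′) :+ x :* (s :+ b)) refl x
      (binomialSum x N j) (binomialSum x (suc N) j) (binomialTerm x N j) (binomialTerm x (suc N) j))

  -- The alternating expansion of (1 - h)^j is off by at most the first omitted term. In the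
  -- induction on `j`, Pascal's rule multiplies the estimate for `N` by -h, which swaps upper and
  -- lower bound; so both are proved together.
  bonferroni : ∀ {h} → 0# ≤ h → h ≤ 1# → ∀ N j →
    (1# - h) ^ j ≤ binomialSum (- h) N j + binomialTerm h N j ×
    binomialSum (- h) N j ≤ (1# - h) ^ j + binomialTerm h N j
  bonferroni {h} 0≤h h≤1 zero j =
    ≤-trans (^≤1 j (0≤y-x h≤1) (x-y≤x 0≤h)) (≤-reflexive (sym (+-identityˡ 1#))) ,
    0≤x+y (0≤^ j (0≤y-x h≤1)) 0≤1
  bonferroni {h} 0≤h h≤1 (suc N) zero =
    ≤-reflexive (trans (sym (sum-at-0 N)) (sym (+-identityʳ _))) ,
    ≤-reflexive (trans (sum-at-0 N) (sym (+-identityʳ _)))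
    where
    sum-at-0 : ∀ N → binomialSum (- h) (suc N) zero ≈ 1#
    sum-at-0 zero    = +-identityˡ 1#
    sum-at-0 (suc N) = trans (+-identityʳ _) (sum-at-0 N)
  bonferroni {h} 0≤h h≤1 (suc N) (suc j) =
    let u₁ , l₁ = bonferroni 0≤h h≤1 (suc N) j
        u₀ , l₀ = bonferroni 0≤h h≤1 N j
        P₁      = binomialSum (- h) (suc N) j
        P₀      = binomialSum (- h) N j
        b₁      = binomialTerm h (suc N) j
        b₀      = binomialTerm h N j
        E       = (1# - h) ^ j
    in  (begin
          (1# - h) * E                        ≈⟨ solve 2 (λ h E → (con (+ 1) :- h) :* E
              := E :+ h :* (:- E)) refl h E ⟩
          E + h * (- E)                       ≤⟨ +-mono-≤ u₁ (*-monoʳ-≤ 0≤h (≤-by (0≤y-x l₀)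
            (solve 3 (λ E b P → :- P :+ b := :- E :+ ((E :+ b) :- P)) refl E b₀ P₀))) ⟩
          (P₁ + b₁) + h * (- P₀ + b₀)         ≈⟨ solve 5 (λ h P₁ b₁ P₀ b₀ → (P₁ :+ b₁) :+ h :*
              (:- P₀ :+ b₀) := (P₁ :+ (:- h) :* P₀) :+ (b₁ :+ h :* b₀)) refl h P₁ b₁ P₀ b₀ ⟩
          (P₁ + - h * P₀) + (b₁ + h * b₀)     ≈⟨ +-congʳ (binomialSum-suc (- h) N j) ⟨
          binomialSum (- h) (suc N) (suc j) + (b₁ + h * b₀) ∎) ,
        (begin
          binomialSum (- h) (suc N) (suc j)   ≈⟨ binomialSum-suc (- h) N j ⟩
          P₁ + - h * P₀                       ≈⟨ solve 3 (λ h P₁ P₀ → P₁ :+ (:- h) :* P₀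
              := P₁ :+ h :* (:- P₀)) refl h P₁ P₀ ⟩
          P₁ + h * (- P₀)                     ≤⟨ +-mono-≤ l₁ (*-monoʳ-≤ 0≤h (≤-by (0≤y-x u₀)
            (solve 3 (λ E b P → :- E :+ b := :- P :+ ((P :+ b) :- E)) refl E b₀ P₀))) ⟩
          (E + b₁) + h * (- E + b₀)           ≈⟨ solve 4 (λ h E b₁ b₀ → (E :+ b₁) :+ h :* (:- E :+ b₀)
              := (con (+ 1) :- h) :* E :+ (b₁ :+ h :* b₀)) refl h E b₁ b₀ ⟩
          (1# - h) * E + (b₁ + h * b₀) ∎)
    where open ≤-Reasoning

  expTerm : Carrier → ℕ → Carrier
  expTerm z k = z ^ k * fromℕ (k ℕ.!) ⁻¹

  0<fromℕ! : ∀ k → 0# < fromℕ (k ℕ.!)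
  0<fromℕ! k = 0<fromℕ (ℕ.1≤n! k)

  expTerm-suc : ∀ z k → expTerm z (suc k) ≈ z * expTerm z k * fromℕ (suc k) ⁻¹
  expTerm-suc z k = *-cancelʳ (0<fromℕ! (suc k)) (begin
    z * z ^ k * fromℕ (suc k ℕ.!) ⁻¹ * fromℕ (suc k ℕ.!)   ≈⟨ x*y⁻¹*y≈x _ (0<fromℕ! (suc k)) ⟩
    z * z ^ k                                              ≈⟨ *-congˡ (x*y⁻¹*y≈x _ (0<fromℕ! k)) ⟨
    z * (z ^ k * A ⁻¹ * A)                                 ≈⟨ *-assoc z _ A ⟨
    z * expTerm z k * A                                    ≈⟨ *-congʳ (x*y⁻¹*y≈x _ (0<fromℕ-suc k)) ⟨
    z * expTerm z k * B ⁻¹ * B * A                         ≈⟨ *-assoc _ B A ⟩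
    z * expTerm z k * B ⁻¹ * (B * A)                       ≈⟨ *-congˡ (fromℕ-* (suc k) (k ℕ.!)) ⟨
    z * expTerm z k * B ⁻¹ * fromℕ (suc k ℕ.!) ∎)
    where
    open import Relation.Binary.Reasoning.Setoid setoid
    A B : Carrier
    A = fromℕ (k ℕ.!)
    B = fromℕ (suc k)
    *-cancelʳ : ∀ {x y z} → 0# < z → x * z ≈ y * z → x ≈ y
    *-cancelʳ {x} {y} {z} 0<z eq = ≤-antisym (cancel eq) (cancel (sym eq))
      where
      cancel : ∀ {x y} → x * z ≈ y * z → x ≤ y
      cancel {x} {y} eq = *-cancelˡ-≤ 0<z (≤-reflexive (trans (*-comm z x) (trans eq (*-comm y z))))

  expSum-suc : ∀ z N → expSum z (suc N) ≈ expSum z N + expTerm z N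
  expSum-suc z N = trans (sum-init-last {N} (λ k → expTerm z (toℕ k)))
    (+-cong (sum-cong-≋ {N} (λ i → reflexive (≡.cong (expTerm z) (Fin.toℕ-inject₁ i))))
            (reflexive (≡.cong (expTerm z) (Fin.toℕ-fromℕ N))))

  expSum-cong : ∀ {y z} → y ≈ z → ∀ N → expSum y N ≈ expSum z N
  expSum-cong y≈z N = sum-cong-≋ {N} (λ i → *-congʳ (^-congˡ (toℕ i) y≈z))

  Exp-cong : ∀ {y z v w} → y ≈ z → v ≈ w → Exp y v → Exp z w
  Exp-cong y≈z v≈w = lim-cong (0 , λ N _ → expSum-cong y≈z N) v≈w

  -- By the term ratio at x = y/n, passing from `k` to `suc k` multiplies by (y - yk/n)/(k+1), which
  -- tends to y/(k+1).
  lim-binomialTerm : ∀ y k → (λ n → binomialTerm (y * fromℕ n ⁻¹) k n) ⟶ expTerm y k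
  lim-binomialTerm y zero    = lim-cong (0 , λ _ _ → refl) 1≈ (lim-const 1#)
    where
    1≈ : 1# ≈ expTerm y 0
    1≈ = sym (trans (*-congˡ (sym (*-identityʳ _))) (trans (sym (*-assoc _ _ _))
           (trans (*-congˡ (sym (+-identityʳ 1#))) (x*y⁻¹*y≈x 1# (0<fromℕ-suc 0)))))
  lim-binomialTerm y (suc k) = lim-cong (1 , step) (sym (expTerm-suc y k))
    (lim-* (lim-cong (0 , λ _ _ → refl) limit (lim-* (lim-+ (lim-const y)
        (lim-neg (lim-* (lim-const (y * fromℕ k)) lim-n⁻¹))) (lim-binomialTerm y k)))
           (lim-const (fromℕ (suc k) ⁻¹)))
    where
    open import Relation.Binary.Reasoning.Setoid setoid
    limit : (y + - (y * fromℕ k * 0#)) * expTerm y k ≈ y * expTerm y k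
    limit = solve 3 (λ y k t → (y :+ :- (y :* k :* con (+ 0))) :* t := y :* t) refl y (fromℕ k) (expTerm y k)
    step : ∀ n → 1 ℕ.≤ n →
      (y - y * fromℕ k * fromℕ n ⁻¹) * binomialTerm (y * fromℕ n ⁻¹) k n * fromℕ (suc k) ⁻¹ ≈
      binomialTerm (y * fromℕ n ⁻¹) (suc k) n
    step n 1≤n = begin
      (y - y * fromℕ k * i) * b * s ⁻¹             ≈⟨ *-congʳ (*-congʳ (+-congʳ (x*y⁻¹*y≈x y (0<fromℕ 1≤n)))) ⟨
      (y * i * fromℕ n - y * fromℕ k * i) * b * s ⁻¹ ≈⟨ *-congʳ
          (solve 5 (λ y i n k b → (y :* i :* n :- y :* k :* i) :* b := y :* i :* (n :- k) :* b)
          refl y i (fromℕ n) (fromℕ k) b) ⟩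
      y * i * (fromℕ n - fromℕ k) * b * s ⁻¹       ≈⟨ *-congʳ (binomialTerm-suc (y * i) k n) ⟨
      s * b′ * s ⁻¹                                ≈⟨ solve 3 (λ s b i → s :* b :* i := b :* i :* s)
          refl s b′ (s ⁻¹) ⟩
      b′ * s ⁻¹ * s                                ≈⟨ x*y⁻¹*y≈x b′ (0<fromℕ-suc k) ⟩
      b′                                           ∎
      where
      i b s b′ : Carrier
      i  = fromℕ n ⁻¹
      b  = binomialTerm (y * i) k n
      b′ = binomialTerm (y * i) (suc k) n
      s  = fromℕ (suc k)

  lim-binomialSum : ∀ y N → (λ n → binomialSum (y * fromℕ n ⁻¹) N n) ⟶ expSum y N
  lim-binomialSum y zero    = lim-const 0#
  lim-binomialSum y (suc N) = lim-cong (0 , λ _ _ → refl) (sym (expSum-suc y N))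
    (lim-+ (lim-binomialSum y N) (lim-binomialTerm y N))

  0≤n⁻¹ : ∀ {n} → 1 ℕ.≤ n → 0# ≤ fromℕ n ⁻¹
  0≤n⁻¹ 1≤n = <⇒≤ (⁻¹-pos (0<fromℕ 1≤n))

  n*[z*n⁻¹] : ∀ z {n} → 1 ℕ.≤ n → fromℕ n * (z * fromℕ n ⁻¹) ≈ z
  n*[z*n⁻¹] z {n} 1≤n = trans (*-comm _ _) (x*y⁻¹*y≈x z (0<fromℕ 1≤n))

  eventually-z/n≤1 : ∀ z → Eventually (λ n → 1 ℕ.≤ n × z * fromℕ n ⁻¹ ≤ 1#)
  eventually-z/n≤1 z = eventually-map
    (λ n (1≤n , z<n) → 1≤n , x≤y*z⇒x*z⁻¹≤y (0<fromℕ 1≤n) (<⇒≤ z<n))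
    (eventually-∧ (1 , λ _ le → le) (eventually-small z 0<1))

  compound : Carrier → ℕ → Carrier
  compound z n = (1# - z * fromℕ n ⁻¹) ^ n

  x<y+ε⇒x-ε<y : ∀ {x y ε} → x < y + ε → x - ε < y
  x<y+ε⇒x-ε<y {x} {y} {ε} lt = <-by (0<y-x lt) (solve 3 (λ x y e → y := (x :- e) :+ ((y :+ e) :- x)) refl x y ε)

  x-ε<y⇒x<y+ε : ∀ {x y ε} → x - ε < y → x < y + ε
  x-ε<y⇒x<y+ε {x} {y} {ε} lt = <-by (0<y-x lt) (solve 3 (λ x y e → y :+ e := x :+ (y :- (x :- e))) refl x y ε)

  x-ε≤y⇒x≤y+ε : ∀ {x y ε} → x - ε ≤ y → x ≤ y + ε
  x-ε≤y⇒x≤y+ε {x} {y} {ε} le = ≤-by (0≤y-x le) (solve 3 (λ x y e → y :+ e := x :+ (y :- (x :- e))) refl x y ε)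

  -- The budget is four quarters `η` of `ε`: one for the strict step and three for the two
  -- truncation errors. It is used in both directions, with the roles of the errors exchanged.
  chain : ∀ ε {w x y z a b} → let η = ε * (1# + 1#) ⁻¹ * (1# + 1#) ⁻¹ in
          x ≤ y + a → y < z + η → z ≤ w + b → a + b ≤ η + η + η → x < w + ε
  chain ε {w} {x} {y} {z} {a} {b} x≤ y< z≤ a+b≤ = begin-strict
    x                         ≤⟨ x≤ ⟩
    y + a                     <⟨ +-monoˡ-< a y< ⟩
    z + η + a                 ≤⟨ +-monoˡ-≤ a (+-monoˡ-≤ η z≤) ⟩
    w + b + η + a             ≈⟨ solve 4 (λ w b h a → w :+ b :+ h :+ a := w :+ (a :+ b :+ h)) refl w b η a ⟩
    w + (a + b + η)           ≤⟨ +-monoʳ-≤ w (+-monoˡ-≤ η a+b≤) ⟩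
    w + (η + η + η + η)       ≈⟨ +-congˡ (solve 1 (λ h → h :+ h :+ h :+ h := (h :+ h) :+ (h :+ h)) refl η) ⟩
    w + ((η + η) + (η + η))   ≈⟨ +-congˡ (trans (+-cong (half+half _) (half+half _)) (half+half ε)) ⟩
    w + ε                     ∎
    where
    open ≤-Reasoning
    η : Carrier
    η = ε * (1# + 1#) ⁻¹ * (1# + 1#) ⁻¹

  separate : ∀ (a b : ℕ → Carrier) → (∀ M N → a M ≤ b N) → ∃ λ v → (∀ N → a N ≤ v) × (∀ N → v ≤ b N)
  separate a b a≤b =
    let v , upper , least = complete (λ y → ∃ λ N → y ≈ a N) (a 0 , 0 , refl)
                              (b 0 , λ y (N , eq) → ≤-trans (≤-reflexive eq) (a≤b N 0))
    in  v , (λ N → upper (a N) (N , refl)) , λ N b<v →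
        let y , (M , eq) , b<y = least (b N) b<v
        in  a≤b M N (<-≤-trans b<y (≤-reflexive eq))

  module _ {E S τ : ℕ → Carrier} {P b : ℕ → ℕ → Carrier}
    (truncation : ∀ N → Eventually (λ n → E n ≤ P N n + b N n × P N n ≤ E n + b N n))
    (P⟶S : ∀ N → P N ⟶ S N) (b⟶τ : ∀ N → b N ⟶ τ N) (τ⟶0 : τ ⟶ 0#) where

    private
      -- Both sides are limits in n of bounds for the same number `E n`, one from below and one from
      -- above.
      S-τ≤S+τ : ∀ M N → S M - τ M ≤ S N + τ N
      S-τ≤S+τ M N = lim-≤ (lim-+ (P⟶S M) (lim-neg (b⟶τ M))) (lim-+ (P⟶S N) (b⟶τ N))
        (eventually-map (λ n ((_ , P≤) , (≤P , _)) → ≤-trans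
            (≤-by (0≤y-x P≤) (solve 3 (λ P b E → E := (P :- b) :+ ((E :+ b) :- P)) refl (P M n) (b M n)
                (E n))) ≤P)
          (eventually-∧ (truncation M) (truncation N)))

      τ-small : ∀ {ε} → 0# < ε → Eventually (λ N → τ N < ε)
      τ-small 0<ε = eventually-map (λ N (_ , hi) → <-≤-trans hi (≤-reflexive (+-identityˡ _))) (τ⟶0 _ 0<ε)

      module _ (v : Carrier) (S-τ≤v : ∀ N → S N - τ N ≤ v) (v≤S+τ : ∀ N → v ≤ S N + τ N) where

        S⟶v : S ⟶ v
        S⟶v = lim⁺ λ 0<ε → eventually-map (λ N τ<ε →
            <-≤-trans (neg-mono-< τ<ε) (≤-by (0≤y-x (v≤S+τ N)) (solve 3 (λ S v t → S :- v
                := :- t :+ ((S :+ t) :- v)) refl (S N) v (τ N))) ,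
            ≤-<-trans (≤-by (0≤y-x (S-τ≤v N)) (solve 3 (λ S v t → t := (S :- v) :+ (v :- (S :- t)))
                refl (S N) v (τ N))) τ<ε)
          (τ-small 0<ε)

        close : ∀ {ε} → 0# < ε → ∀ N → τ N ≤ ε * (1# + 1#) ⁻¹ * (1# + 1#) ⁻¹ →
                Eventually (λ n → v - ε < E n × E n < v + ε)
        close {ε} 0<ε N τ≤η = eventually-map
          (λ n ((E≤P+b , P≤E+b) , (S-η<P , P<S+η) , (_ , b<τ+η)) →
            let b≤2η = ≤-trans (<⇒≤ b<τ+η) (+-monoˡ-≤ η τ≤η)
            in  x<y+ε⇒x-ε<y (chain ε (v≤S+τ N) (x-ε<y⇒x<y+ε S-η<P) P≤E+b (≤-trans (+-mono-≤ τ≤η b≤2η)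
                (≤-reflexive (+-comm η _)))) ,
                chain ε E≤P+b P<S+η (x-ε≤y⇒x≤y+ε (S-τ≤v N)) (+-mono-≤ b≤2η τ≤η))
          (eventually-∧ (truncation N) (eventually-∧ (P⟶S N η 0<η) (b⟶τ N η 0<η)))
          where
          η : Carrier
          η = ε * (1# + 1#) ⁻¹ * (1# + 1#) ⁻¹
          0<η : 0# < η
          0<η = half-pos (half-pos 0<ε)

        E⟶v : E ⟶ v
        E⟶v ε 0<ε =
          let N , small-τ = τ-small (half-pos (half-pos 0<ε))
          in  close 0<ε N (<⇒≤ (small-τ N ℕ.≤-refl))

    -- Completeness gives a number between all lower values S - τ and all upper values S + τ. Since
    -- τ tends to 0 the series converges to it, and one sufficiently long truncation brings `E n`
    -- close to it for all large n; no exchange of limits is needed.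
    common-limit : ∃ λ v → S ⟶ v × E ⟶ v
    common-limit =
      let v , S-τ≤v , v≤S+τ = separate (λ N → S N - τ N) (λ N → S N + τ N) S-τ≤S+τ
      in  v , S⟶v v S-τ≤v v≤S+τ , E⟶v v S-τ≤v v≤S+τ

  module NonNegative {z} (0≤z : 0# ≤ z) where

    S τ : ℕ → Carrier
    S = expSum (- z)
    τ = expTerm z

    b P : ℕ → ℕ → Carrier
    b N n = binomialTerm (z * fromℕ n ⁻¹) N n
    P N n = binomialSum (- (z * fromℕ n ⁻¹)) N n

    truncation : ∀ N → Eventually (λ n → compound z n ≤ P N n + b N n × P N n ≤ compound z n + b N n)
    truncation N = eventually-map
      (λ n (1≤n , h≤1) → bonferroni (0≤x*y 0≤z (0≤n⁻¹ 1≤n)) h≤1 N n) (eventually-z/n≤1 z)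

    P⟶S : ∀ N → P N ⟶ S N
    P⟶S N = lim-cong (0 , λ n _ → binomialSum-cong N n) refl (lim-binomialSum (- z) N)
      where
      term-cong : ∀ {x y} → x ≈ y → ∀ k j → binomialTerm x k j ≈ binomialTerm y k j
      term-cong eq zero    j       = refl
      term-cong eq (suc k) zero    = refl
      term-cong eq (suc k) (suc j) = +-cong (term-cong eq (suc k) j) (*-cong eq (term-cong eq k j))
      sum-cong : ∀ {x y} → x ≈ y → ∀ N j → binomialSum x N j ≈ binomialSum y N j
      sum-cong eq zero    j = refl
      sum-cong eq (suc N) j = +-cong (sum-cong eq N j) (term-cong eq N j)
      binomialSum-cong : ∀ N n → binomialSum (- z * fromℕ n ⁻¹) N n ≈ P N n
      binomialSum-cong N n = sum-cong (solve 2 (λ z i → :- z :* i := :- (z :* i)) refl z (fromℕ n ⁻¹)) N n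

    b⟶τ : ∀ N → b N ⟶ τ N
    b⟶τ N = lim-binomialTerm z N

    0≤τ : ∀ N → 0# ≤ τ N
    0≤τ N = 0≤x*y (0≤^ N 0≤z) (<⇒≤ (⁻¹-pos (0<fromℕ! N)))

    -- From an index a above `z` on, the terms do not increase. Then n times the n-th term, being
    -- `z` times its predecessor, is at most `z * τ a`, so the terms decay at least like 1/n.
    τ⟶0 : τ ⟶ 0#
    τ⟶0 = lim⁺ λ {ε} 0<ε →
      let a , z<a = archimedean z
          N , big = eventually-small (z * τ a) 0<ε
      in  suc a ℕ.+ N , λ n le → small-cong (solve 1 (λ x → x := x :- con (+ 0)) refl (τ n))
            (<-≤-trans (neg-mono-< 0<ε) (≤-trans (≤-reflexive (solve 0 (:- con (+ 0) := con (+ 0))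
                refl)) (0≤τ n)) ,
             τ<ε (<⇒≤ z<a) (ℕ.≤-trans (ℕ.m≤m+n (suc a) N) le) (big n (ℕ.≤-trans (ℕ.m≤n+m N (suc a)) le)))
      where
      open ≤-Reasoning
      τ-suc : ∀ k → fromℕ (suc k) * τ (suc k) ≈ z * τ k
      τ-suc k = trans (*-comm _ _) (trans (*-congʳ (expTerm-suc z k)) (x*y⁻¹*y≈x _ (0<fromℕ-suc k)))
      τ-decreasing : ∀ {a k} → z ≤ fromℕ a → a ℕ.≤ k → τ (suc k) ≤ τ k
      τ-decreasing {a} {k} z≤a a≤k = *-cancelˡ-≤ (0<fromℕ-suc k) (begin
        fromℕ (suc k) * τ (suc k) ≈⟨ τ-suc k ⟩
        z * τ k                   ≤⟨ *-monoˡ-≤ (0≤τ k) (≤-trans z≤a (fromℕ-mono-≤ (ℕ.m≤n⇒m≤1+n a≤k))) ⟩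
        fromℕ (suc k) * τ k       ∎)
      τ≤τa : ∀ {a} → z ≤ fromℕ a → ∀ j → τ (j ℕ.+ a) ≤ τ a
      τ≤τa z≤a zero    = ≤-refl
      τ≤τa {a} z≤a (suc j) = ≤-trans (τ-decreasing z≤a (ℕ.m≤n+m a j)) (τ≤τa z≤a j)
      τ<ε : ∀ {a n ε} → z ≤ fromℕ a → suc a ℕ.≤ n → z * τ a < ε * fromℕ n → τ n < ε
      τ<ε {a} {suc n} {ε} z≤a (s≤s a≤n) zτ<εn with τ (suc n) <? ε
      ... | yes lt = lt
      ... | no ε≤τ = ⊥-elim (εn≤zτ zτ<εn)
        where
        εn≤zτ : ε * fromℕ (suc n) ≤ z * τ a
        εn≤zτ = begin
          ε * fromℕ (suc n)           ≤⟨ *-monoˡ-≤ (0≤fromℕ (suc n)) ε≤τ ⟩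
          τ (suc n) * fromℕ (suc n)   ≈⟨ trans (*-comm _ _) (τ-suc n) ⟩
          z * τ n                     ≤⟨ *-monoʳ-≤ 0≤z
              (≤-trans (≤-reflexive (reflexive (≡.cong τ (≡.sym (ℕ.m∸n+n≡m a≤n))))) (τ≤τa z≤a (n ℕ.∸ a))) ⟩
          z * τ a                     ∎

    exists : ∃ λ v → Exp (- z) v × compound z ⟶ v
    exists = common-limit truncation P⟶S b⟶τ τ⟶0

    compound⟶ : ∀ {v} → Exp (- z) v → compound z ⟶ v
    compound⟶ exp-v =
      let _ , exp-w , E⟶w = exists
      in  lim-cong (0 , λ _ _ → refl) (lim-unique exp-w exp-v) E⟶w

  -- Read off from (1 - y/n)^n and (1 - z/n)^n, which are ordered once z/n is at most 1; the
  -- alternating partial sums do not show monotonicity termwise.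
  exp-antitone : ∀ {y z u v} → 0# ≤ y → y ≤ z → Exp (- y) u → Exp (- z) v → v ≤ u
  exp-antitone {y} {z} 0≤y y≤z exp-u exp-v = lim-≤ (NonNegative.compound⟶ (≤-trans 0≤y y≤z) exp-v)
      (NonNegative.compound⟶ 0≤y exp-u)
    (eventually-map (λ n (1≤n , h≤1) → ^-mono-≤ n (0≤y-x h≤1)
        (+-monoʳ-≤ 1# (neg-mono-≤ (*-monoˡ-≤ (0≤n⁻¹ 1≤n) y≤z)))) (eventually-z/n≤1 z))

  0≤exp : ∀ {z v} → 0# ≤ z → Exp (- z) v → 0# ≤ v
  0≤exp {z} 0≤z exp-v = lim-≤ (lim-const 0#) (NonNegative.compound⟶ 0≤z exp-v)
    (eventually-map (λ n (1≤n , h≤1) → 0≤^ n (0≤y-x h≤1)) (eventually-z/n≤1 z))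

-- The recursion for survival rates and its fixed point

module Recursion (ℝ : CompleteOrderedField) where
  open CompleteOrderedField ℝ hiding (zero)
  open OrderedFieldProperties ℝ
  open Limits ℝ
  open Exponential ℝ

  bernoulli : ∀ {h} j → 0# ≤ h → 1# + fromℕ j * h ≤ (1# + h) ^ j
  bernoulli {h} zero    0≤h = ≤-reflexive (solve 1 (λ h → con (+ 1) :+ con (+ 0) :* h := con (+ 1)) refl h)
  bernoulli {h} (suc j) 0≤h = ≤-trans
    (≤-by (0≤x*y (0≤fromℕ j) (0≤x*y 0≤h 0≤h))
      (solve 2 (λ j h → (con (+ 1) :+ h) :* (con (+ 1) :+ j :* h) := (con (+ 1) :+ (con (+ 1) :+ j) :*
          h) :+ j :* (h :* h)) refl (fromℕ j) h))
    (*-monoʳ-≤ (0≤x+y 0≤1 0≤h) (bernoulli j 0≤h))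

  reverse-bernoulli : ∀ {h} n → 0# ≤ h → fromℕ n * h + fromℕ n * h ≤ 1# →
                      ∀ j → j ℕ.≤ n → (1# + h) ^ j ≤ 1# + (fromℕ j * h + fromℕ j * h)
  reverse-bernoulli {h} n 0≤h 2nh≤1 zero    _   = ≤-reflexive (solve 1 (λ h → con (+ 1)
      := con (+ 1) :+ (con (+ 0) :* h :+ con (+ 0) :* h)) refl h)
  reverse-bernoulli {h} n 0≤h 2nh≤1 (suc j) j<n = ≤-trans
    (*-monoʳ-≤ (0≤x+y 0≤1 0≤h) (reverse-bernoulli n 0≤h 2nh≤1 j (ℕ.<⇒≤ j<n)))
    (≤-by (0≤x*y 0≤h (0≤y-x (≤-trans (+-mono-≤ jh≤nh jh≤nh) 2nh≤1)))
      (solve 2 (λ j h → con (+ 1) :+ ((con (+ 1) :+ j) :* h :+ (con (+ 1) :+ j) :* h)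
        := (con (+ 1) :+ h) :* (con (+ 1) :+ (j :* h :+ j :* h)) :+ h :* (con (+ 1) :-
            (j :* h :+ j :* h))) refl (fromℕ j) h))
    where
    jh≤nh : fromℕ j * h ≤ fromℕ n * h
    jh≤nh = *-monoˡ-≤ 0≤h (fromℕ-mono-≤ (ℕ.<⇒≤ j<n))

  -- Take a above 2z and h = z/(an). Bernoulli gives 1 + z/n = 1 + ah ≤ (1 + h)^a, and 2nh = 2z/a ≤
  -- 1 gives (1 + h)^n ≤ 2. Hence 2^a works for every n.
  compound-bounded : ∀ {z} → 0# ≤ z → ∃ λ C → ∀ n → 1 ℕ.≤ n → (1# + z * fromℕ n ⁻¹) ^ n ≤ C
  compound-bounded {z} 0≤z =
    let a , 2z<a = archimedean (z + z)
    in  (1# + 1#) ^ a , λ n 1≤n → bound a 2z<a (0<fromℕ (0<a a 2z<a)) n 1≤n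
    where
    open ≤-Reasoning
    0<a : ∀ a → z + z < fromℕ a → 0 ℕ.< a
    0<a zero    lt = ⊥-elim (0≤x+y 0≤z 0≤z lt)
    0<a (suc _) _  = s≤s z≤n
    bound : ∀ a → z + z < fromℕ a → 0# < fromℕ a → ∀ n → 1 ℕ.≤ n → (1# + z * fromℕ n ⁻¹) ^ n ≤ (1# + 1#) ^ a
    bound a 2z<a 0<a n 1≤n = begin
      (1# + z * fromℕ n ⁻¹) ^ n     ≈⟨ ^-congˡ n (+-congˡ (trans (*-congʳ (sym (n*h z)) )
          (solve 4 (λ a z i j → a :* (z :* i) :* j := a :* (z :* i :* j)) refl (fromℕ a) z (fromℕ a ⁻¹)
          (fromℕ n ⁻¹)))) ⟩
      (1# + fromℕ a * h) ^ n        ≤⟨ ^-mono-≤ n (0≤x+y 0≤1 (0≤x*y (0≤fromℕ a) 0≤h)) (bernoulli a 0≤h) ⟩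
      ((1# + h) ^ a) ^ n            ≈⟨ ^-assocʳ (1# + h) a n ⟩
      (1# + h) ^ (a ℕ.* n)          ≡⟨ ≡.cong ((1# + h) ^_) (ℕ.*-comm a n) ⟩
      (1# + h) ^ (n ℕ.* a)          ≈⟨ ^-assocʳ (1# + h) n a ⟨
      ((1# + h) ^ n) ^ a            ≤⟨ ^-mono-≤ a (0≤^ n (0≤x+y 0≤1 0≤h))
        (≤-trans (reverse-bernoulli n 0≤h 2nh≤1 n ℕ.≤-refl) (+-monoʳ-≤ 1# 2nh≤1)) ⟩
      (1# + 1#) ^ a                 ∎
      where
      n*h : ∀ x → fromℕ a * (x * fromℕ a ⁻¹) ≈ x
      n*h x = trans (*-comm _ _) (x*y⁻¹*y≈x x 0<a)
      h : Carrier
      h = z * fromℕ a ⁻¹ * fromℕ n ⁻¹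
      0≤h : 0# ≤ h
      0≤h = 0≤x*y (0≤x*y 0≤z (<⇒≤ (⁻¹-pos 0<a))) (0≤n⁻¹ 1≤n)
      2nh≤1 : fromℕ n * h + fromℕ n * h ≤ 1#
      2nh≤1 = begin
        fromℕ n * h + fromℕ n * h               ≈⟨ +-cong (n*[z*n⁻¹] _ 1≤n) (n*[z*n⁻¹] _ 1≤n) ⟩
        z * fromℕ a ⁻¹ + z * fromℕ a ⁻¹         ≈⟨ distribʳ _ z z ⟨
        (z + z) * fromℕ a ⁻¹                    ≤⟨ x≤y*z⇒x*z⁻¹≤y 0<a (≤-trans (<⇒≤ 2z<a) (≤-reflexive
            (sym (*-identityˡ _)))) ⟩
        1#                                      ∎

  -- The interval reaches 2 because the estimate is applied at points slightly above an infimum that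
  -- may be as large as 1.
  ^-lipschitz : ∀ d → ∃ λ L → 0# ≤ L × (∀ {x y} → 0# ≤ x → x ≤ y → y ≤ 1# + 1# → y ^ d - x ^ d ≤ L * (y - x))
  ^-lipschitz zero    = 0# , ≤-refl , λ {x} {y} _ _ _ →
    ≤-reflexive (solve 2 (λ x y → con (+ 1) :- con (+ 1) := con (+ 0) :* (y :- x)) refl x y)
  ^-lipschitz (suc d) =
    let L , 0≤L , lip = ^-lipschitz d
        T             = (1# + 1#) ^ d
    in  (1# + 1#) * L + T , 0≤x+y (0≤x*y (<⇒≤ 0<2) 0≤L) (0≤^ d (<⇒≤ 0<2)) , λ {x} {y} 0≤x x≤y y≤2 → begin
      y * y ^ d - x * x ^ d                         ≈⟨ solve 4 (λ x y X Y → y :* Y :- x :* X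
          := y :* (Y :- X) :+ X :* (y :- x)) refl x y (x ^ d) (y ^ d) ⟩
      y * (y ^ d - x ^ d) + x ^ d * (y - x)         ≤⟨ +-mono-≤
        (*-mono-≤ (≤-trans 0≤x x≤y) (0≤y-x (^-mono-≤ d 0≤x x≤y)) y≤2 (lip 0≤x x≤y y≤2))
        (*-monoˡ-≤ (0≤y-x x≤y) (^-mono-≤ d 0≤x (≤-trans x≤y y≤2))) ⟩
      (1# + 1#) * (L * (y - x)) + T * (y - x)       ≈⟨ solve 4 (λ L T x y → con (+ 2) :* (L :* (y :- x))
          :+ T :* (y :- x) := (con (+ 2) :* L :+ T) :* (y :- x)) refl L T x y ⟩
      ((1# + 1#) * L + T) * (y - x)                 ∎
    where open ≤-Reasoning

  -- On the unit interval the constant is `n` itself, which cancels against the edge probability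
  -- c/n.
  ^-lipschitz-1 : ∀ n {x y} → 0# ≤ x → x ≤ y → y ≤ 1# → y ^ n - x ^ n ≤ fromℕ n * (y - x)
  ^-lipschitz-1 zero    {x} {y} _ _ _ = ≤-reflexive (solve 2 (λ x y → con (+ 1) :- con (+ 1)
      := con (+ 0) :* (y :- x)) refl x y)
  ^-lipschitz-1 (suc n) {x} {y} 0≤x x≤y y≤1 = begin
    y * y ^ n - x * x ^ n                         ≈⟨ solve 4 (λ x y X Y → y :* Y :- x :* X
        := y :* (Y :- X) :+ X :* (y :- x)) refl x y (x ^ n) (y ^ n) ⟩
    y * (y ^ n - x ^ n) + x ^ n * (y - x)         ≤⟨ +-mono-≤
      (*-mono-≤ (≤-trans 0≤x x≤y) (0≤y-x (^-mono-≤ n 0≤x x≤y)) y≤1 (^-lipschitz-1 n 0≤x x≤y y≤1))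
      (*-monoˡ-≤ (0≤y-x x≤y) (^≤1 n 0≤x (≤-trans x≤y y≤1))) ⟩
    1# * (fromℕ n * (y - x)) + 1# * (y - x)       ≈⟨ solve 3 (λ k x y → con (+ 1) :* (k :* (y :- x)) :+
        con (+ 1) :* (y :- x) := (con (+ 1) :+ k) :* (y :- x)) refl (fromℕ n) x y ⟩
    fromℕ (suc n) * (y - x)                       ∎
    where open ≤-Reasoning

  infimum : ∀ (P : Carrier → Set) → (∃ λ x → P x) → (∃ λ b → ∀ x → P x → b ≤ x) → ∃ (IsInfimum P)
  infimum P (x , px) (b , b≤) =
    let s , upper , least = complete Negated (- x , x , px , refl)
          (- b , λ y (x , px , y≈-x) → ≤-trans (≤-reflexive y≈-x) (neg-mono-≤ (b≤ x px)))
    in  - s ,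
        (λ x px → ≤-trans (neg-mono-≤ (upper (- x) (x , px , refl))) (≤-reflexive (neg-neg x))) ,
        λ y -s<y →
          let y′ , (x , px , y′≈-x) , -y<y′ =
                least (- y) (<-≤-trans (neg-mono-< -s<y) (≤-reflexive (neg-neg s)))
          in  x , px , (begin-strict
                x     ≈⟨ neg-neg x ⟨
                - - x ≈⟨ -‿cong y′≈-x ⟨
                - y′  <⟨ neg-mono-< -y<y′ ⟩
                - - y ≈⟨ neg-neg y ⟩
                y     ∎)
    where
    open ≤-Reasoning
    Negated : Carrier → Set
    Negated y = ∃ λ x → P x × y ≈ - x
    neg-neg : ∀ x → - - x ≈ x
    neg-neg x = solve 1 (λ x → :- :- x := x) refl x

  module _ (d : ℕ) (c : Carrier) (0≤c : 0# ≤ c) where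

    edgeProbability : ℕ → Carrier
    edgeProbability n = c * fromℕ n ⁻¹

    -- With p = c/n, the parameters of SurvivalBound at depth k.
    survivalRate errorRate : ℕ → ℕ → Carrier
    survivalRate n zero    = 1#
    survivalRate n (suc k) = 1# - (1# - edgeProbability n * survivalRate n k ^ d) ^ n
    errorRate n zero    = 1#
    errorRate n (suc k) = (1# + edgeProbability n * ((1# + 1#) * errorRate n k ^ d)) ^ n + 1#

    0≤p : ∀ {n} → 1 ℕ.≤ n → 0# ≤ edgeProbability n
    0≤p 1≤n = 0≤x*y 0≤c (0≤n⁻¹ 1≤n)

    module _ {n} (1≤n : 1 ℕ.≤ n) (p≤1 : edgeProbability n ≤ 1#) where

      0≤1-px^d : ∀ {x} → 0# ≤ x → x ≤ 1# → 0# ≤ 1# - edgeProbability n * x ^ d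
      0≤1-px^d 0≤x x≤1 = 0≤y-x (≤-trans (*-mono-≤ (0≤p 1≤n) (0≤^ d 0≤x) p≤1 (^≤1 d 0≤x x≤1))
          (≤-reflexive (*-identityˡ 1#)))

      0≤rate : ∀ k → 0# ≤ survivalRate n k
      rate≤1 : ∀ k → survivalRate n k ≤ 1#
      0≤rate zero    = 0≤1
      0≤rate (suc k) = 0≤y-x (^≤1 n (0≤1-px^d (0≤rate k) (rate≤1 k)) (x-y≤x (0≤x*y (0≤p 1≤n) (0≤^ d (0≤rate k)))))
      rate≤1 zero    = ≤-refl
      rate≤1 (suc k) = x-y≤x (0≤^ n (0≤1-px^d (0≤rate k) (rate≤1 k)))

      1≤errorRate : ∀ k → 1# ≤ errorRate n k
      1≤errorRate zero    = ≤-refl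
      1≤errorRate (suc k) = ≤-by (0≤^ n (0≤x+y 0≤1 (0≤x*y (0≤p 1≤n) (0≤x*y (<⇒≤ 0<2)
        (0≤^ d (≤-trans 0≤1 (1≤errorRate k))))))) (+-comm _ 1#)

    errorRate-bounded : ∀ k → ∃ λ C → Eventually (λ n → errorRate n k ≤ C)
    errorRate-bounded zero    = 1# , 0 , λ _ _ → ≤-refl
    errorRate-bounded (suc k) =
      let C , below = errorRate-bounded k
          -- `1# + C * C` replaces `C` because `z` must be nonnegative before any n is at hand, and
          -- nothing is yet known about the sign of `C`.
          z         = c * ((1# + 1#) * (1# + C * C) ^ d)
          0≤1+CC    = 0≤square C
          D , bound = compound-bounded {z} (0≤x*y 0≤c (0≤x*y (<⇒≤ 0<2) (0≤^ d 0≤1+CC)))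
      in  D + 1# , eventually-map (λ n (K≤C , 1≤n , p≤1) → +-monoˡ-≤ 1# (≤-trans
            (^-mono-≤ n (0≤x+y 0≤1 (0≤x*y (0≤p 1≤n) (0≤x*y (<⇒≤ 0<2)
                (0≤^ d (≤-trans 0≤1 (1≤errorRate 1≤n p≤1 k))))))
              (+-monoʳ-≤ 1# (≤-trans
                (*-monoʳ-≤ (0≤p 1≤n) (*-monoʳ-≤ (<⇒≤ 0<2) (^-mono-≤ d (≤-trans 0≤1 (1≤errorRate 1≤n p≤1 k))
                  (≤-trans K≤C (C≤1+CC C (≤-trans 0≤1 (≤-trans (1≤errorRate 1≤n p≤1 k) K≤C)))))))
                (≤-reflexive (solve 3 (λ c i x → c :* i :* x := c :* x :* i) refl c (fromℕ n ⁻¹) _)))))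
            (bound n 1≤n))) (eventually-∧ below (eventually-z/n≤1 c))
      where
      0≤square : ∀ C → 0# ≤ 1# + C * C
      0≤square C with ≤-total 0# C
      ... | inj₁ 0≤C = 0≤x+y 0≤1 (0≤x*y 0≤C 0≤C)
      ... | inj₂ C≤0 = 0≤x+y 0≤1 (≤-trans (0≤x*y (0≤y-x C≤0) (0≤y-x C≤0))
        (≤-reflexive (solve 1 (λ C → (con (+ 0) :- C) :* (con (+ 0) :- C) := C :* C) refl C)))
      C≤1+CC : ∀ C → 0# ≤ C → C ≤ 1# + C * C
      C≤1+CC C 0≤C with ≤-total C 1#
      ... | inj₁ C≤1 = ≤-trans C≤1 (≤-by (0≤x*y 0≤C 0≤C) refl)
      ... | inj₂ 1≤C = ≤-by (0≤x+y 0≤1 (0≤x*y 0≤C (0≤y-x 1≤C))) (solve 1 (λ C → con (+ 1) :+ C :* C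
          := C :+ (con (+ 1) :+ C :* (C :- con (+ 1)))) refl C)

    exponent : Carrier → Carrier
    exponent x = c * x ^ d

    0≤exponent : ∀ {x} → 0# ≤ x → 0# ≤ exponent x
    0≤exponent 0≤x = 0≤x*y 0≤c (0≤^ d 0≤x)

    PreFixed : Carrier → Set
    PreFixed x = 0# ≤ x × x ≤ 1# × ∃ λ v → Exp (- exponent x) v × x ≤ 1# - v

    -- The largest x with x ≤ 1 - exp(-c x^d) is a fixed point, by monotonicity (Tarski);
    -- in the notation of the core equation it is 1 - x.
    solution : ∀ {x} → 0# < x → PreFixed x → CoreEquationSolvable d c
    solution {x} 0<x pre-x = 0≤c , v , v<1 ,
      Exp-cong (-‿cong (*-congˡ (^-congˡ d s≈1-v))) refl exp-v
      where
      supremum : ∃ (IsSupremum PreFixed)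
      supremum = complete PreFixed (x , pre-x) (1# , λ _ → proj₁ ∘ proj₂)
      s : Carrier
      s = proj₁ supremum
      upper : ∀ {y} → PreFixed y → y ≤ s
      upper = proj₁ (proj₂ supremum) _
      least : ∀ {b} → (∀ y → PreFixed y → y ≤ b) → s ≤ b
      least ≤b b<s with proj₂ (proj₂ supremum) _ b<s
      ... | y , pre-y , b<y = ≤b y pre-y b<y
      0≤s : 0# ≤ s
      0≤s = ≤-trans (<⇒≤ 0<x) (upper pre-x)
      image : ∃ λ v → Exp (- exponent s) v × compound (exponent s) ⟶ v
      image = NonNegative.exists (0≤exponent 0≤s)
      v : Carrier
      v = proj₁ image
      exp-v : Exp (- exponent s) v
      exp-v = proj₁ (proj₂ image)
      0≤v : 0# ≤ v
      0≤v = 0≤exp (0≤exponent 0≤s) exp-v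
      mono : ∀ {y z u w} → 0# ≤ y → y ≤ z → Exp (- exponent y) u → Exp (- exponent z) w → 1# - u ≤ 1# - w
      mono 0≤y y≤z exp-u exp-w = +-monoʳ-≤ 1# (neg-mono-≤
        (exp-antitone (0≤exponent 0≤y) (*-monoʳ-≤ 0≤c (^-mono-≤ d 0≤y y≤z)) exp-u exp-w))
      s≤1-v : s ≤ 1# - v
      s≤1-v = least λ y pre@(0≤y , _ , _ , exp-u , y≤) → ≤-trans y≤ (mono 0≤y (upper pre) exp-u exp-v)
      pre-image : PreFixed (1# - v)
      pre-image =
        let 0≤1-v         = ≤-trans 0≤s s≤1-v
            w , exp-w , _ = NonNegative.exists (0≤exponent 0≤1-v)
        in  0≤1-v , x-y≤x 0≤v , w , exp-w , mono 0≤s s≤1-v exp-v exp-w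
      s≈1-v : s ≈ 1# - v
      s≈1-v = ≤-antisym s≤1-v (upper pre-image)
      v<1 : v < 1#
      v<1 = <-by (<-≤-trans 0<x (≤-trans (upper pre-x) s≤1-v)) (solve 1 (λ v → con (+ 1)
          := v :+ (con (+ 1) :- v)) refl v)

    -- The infimum of these `y` stands in for the iterated limit of the rates, first in n and then
    -- in depth. The range of n may depend on the depth.
    EventualBound : Carrier → Set
    EventualBound y = ∃ λ k → Eventually (λ n → survivalRate n k ≤ y)

    module _ {i v L} (0≤i : 0# ≤ i) (i≤1 : i ≤ 1#) (E⟶v : compound (exponent i) ⟶ v) (0≤L : 0# ≤ L)
      (lipschitz : ∀ {x y} → 0# ≤ x → x ≤ y → y ≤ 1# + 1# → y ^ d - x ^ d ≤ L * (y - x)) where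

      -- If the rates stayed above i > 0, another round would lower them to 1 - exp(-c i^d).
      infimum≤image : IsInfimum EventualBound i → i ≤ 1# - v
      infimum≤image (lower , greatest) 1-v<i =
        let y , (k , N , rate≤y) , y<i+δ = greatest (i + δ) (<-by 0<δ refl)
        in  lower (i - (η + η)) (suc k , better {k} (lower y (k , N , rate≤y)) (<⇒≤ y<i+δ) (N , rate≤y))
              (<-by (<-≤-trans 0<η (≤-by (<⇒≤ 0<η) refl)) (solve 2 (λ i h → i := (i :- (h :+ h)) :+
                  (h :+ h)) refl i η))
        where
        open ≤-Reasoning
        -- `η` is a quarter of the supposed gap `ρ`: one quarter is lost in replacing y by i, one in
        -- replacing the power by its limit, and two remain as the improvement below i. In `D`, the
        -- summand `c * L` makes the first loss at most `η`, and `ρ` ensures that `δ` is at most 1.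
        ρ η D δ : Carrier
        ρ = i - (1# - v)
        η = ρ * (1# + 1#) ⁻¹ * (1# + 1#) ⁻¹
        D = 1# + c * L + ρ
        δ = η * D ⁻¹
        0<ρ : 0# < ρ
        0<ρ = 0<y-x 1-v<i
        0<η : 0# < η
        0<η = half-pos (half-pos 0<ρ)
        4η≈ρ : η + η + (η + η) ≈ ρ
        4η≈ρ = trans (+-cong (half+half _) (half+half _)) (half+half ρ)
        0≤cL : 0# ≤ c * L
        0≤cL = 0≤x*y 0≤c 0≤L
        0<D : 0# < D
        0<D = <-≤-trans 0<1 (≤-by (0≤x+y 0≤cL (<⇒≤ 0<ρ)) (+-assoc 1# (c * L) ρ))
        0<δ : 0# < δ
        0<δ = *-pos 0<η (⁻¹-pos 0<D)
        D*δ : D * δ ≈ η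
        D*δ = trans (*-comm D δ) (x*y⁻¹*y≈x η 0<D)
        η≤D : η ≤ D
        η≤D = ≤-trans (≤-by (0≤x+y (<⇒≤ 0<η) (0≤x+y (<⇒≤ 0<η) (<⇒≤ 0<η)))
            (trans (sym 4η≈ρ) (solve 1 (λ h → h :+ h :+ (h :+ h) := h :+ (h :+ (h :+ h))) refl η)))
          (≤-by (0≤x+y 0≤1 0≤cL) (+-comm _ ρ))
        cLδ≤η : c * L * δ ≤ η
        cLδ≤η = ≤-trans (≤-by (0≤x*y (0≤x+y 0≤1 (<⇒≤ 0<ρ)) (<⇒≤ 0<δ))
          (solve 3 (λ x r e → (con (+ 1) :+ x :+ r) :* e := x :* e :+ (con (+ 1) :+ r) :* e)
              refl (c * L) ρ δ)) (≤-reflexive D*δ)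

        -- One more round turns the bound y into 1 - Y. The Lipschitz estimates put `Y` at most `η`
        -- below `I`, and `I` is at least v - η. The condition on `exponent (1# + 1#)` keeps the
        -- base of `Y` nonnegative, as y may exceed 1.
        improve : ∀ {n k y} → 1 ℕ.≤ n → edgeProbability n ≤ 1# → exponent (1# + 1#) * fromℕ n ⁻¹ ≤ 1# →
          i ≤ y → y ≤ i + δ → y ≤ 1# + 1# → survivalRate n k ≤ y → v - η ≤ compound (exponent i) n →
          survivalRate n (suc k) ≤ i - (η + η)
        improve {n} {k} {y} 1≤n p≤1 z≤1 i≤y y≤i+δ y≤2 rate≤y v-η≤E = begin
          1# - (1# - p * survivalRate n k ^ d) ^ n   ≤⟨ +-monoʳ-≤ 1# (neg-mono-≤ (^-mono-≤ n 0≤1-py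
              (+-monoʳ-≤ 1# (neg-mono-≤
            (*-monoʳ-≤ (0≤p 1≤n) (^-mono-≤ d (0≤rate 1≤n p≤1 k) rate≤y)))))) ⟩
          1# - Y                                     ≤⟨ ≤-by (0≤x+y (0≤y-x step) (0≤y-x v-η≤E′))
            (solve 4 (λ Y I v h → con (+ 1) :- (v :- (h :+ h)) := (con (+ 1) :- Y) :+
                ((h :- (I :- Y)) :+ (I :- (v :- h)))) refl Y I v η) ⟩
          1# - (v - (η + η))                         ≈⟨ solve 3 (λ i v h → con (+ 1) :- (v :- (h :+ h))
              := i :- (i :- (con (+ 1) :- v)) :+ (h :+ h)) refl i v η ⟩
          i - ρ + (η + η)                            ≈⟨ +-congʳ (+-congˡ (-‿cong 4η≈ρ)) ⟨
          i - (η + η + (η + η)) + (η + η)            ≈⟨ solve 2 (λ i h → i :- (h :+ h :+ (h :+ h)) :+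
              (h :+ h) := i :- (h :+ h)) refl i η ⟩
          i - (η + η)                                ∎
          where
          p Y I : Carrier
          p = edgeProbability n
          Y = (1# - p * y ^ d) ^ n
          I = (1# - p * i ^ d) ^ n
          0≤y : 0# ≤ y
          0≤y = ≤-trans 0≤i i≤y
          py≤1 : p * y ^ d ≤ 1#
          py≤1 = ≤-trans (*-monoʳ-≤ (0≤p 1≤n) (^-mono-≤ d 0≤y y≤2))
            (≤-trans (≤-reflexive (solve 3 (λ c i x → c :* i :* x := c :* x :* i) refl c (fromℕ n ⁻¹) _)) z≤1)
          0≤1-py : 0# ≤ 1# - p * y ^ d
          0≤1-py = 0≤y-x py≤1
          v-η≤E′ : v - η ≤ I
          v-η≤E′ = ≤-trans v-η≤E (≤-reflexive (^-congˡ n (+-congˡ (-‿cong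
            (solve 3 (λ c i x → c :* x :* i := c :* i :* x) refl c (fromℕ n ⁻¹) (i ^ d))))))
          step : I - Y ≤ η
          step = begin
            I - Y                                                  ≤⟨ ^-lipschitz-1 n 0≤1-py
              (+-monoʳ-≤ 1# (neg-mono-≤ (*-monoʳ-≤ (0≤p 1≤n) (^-mono-≤ d 0≤i i≤y))))
                  (x-y≤x (0≤x*y (0≤p 1≤n) (0≤^ d 0≤i))) ⟩
            fromℕ n * ((1# - p * i ^ d) - (1# - p * y ^ d))        ≈⟨ solve 4 (λ n p a b → n :*
                ((con (+ 1) :- p :* a) :- (con (+ 1) :- p :* b)) := n :* p :* (b :- a)) refl (fromℕ n) p
                (i ^ d) (y ^ d) ⟩
            fromℕ n * p * (y ^ d - i ^ d)                          ≈⟨ *-congʳ (n*[z*n⁻¹] c 1≤n) ⟩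
            c * (y ^ d - i ^ d)                                    ≤⟨ *-monoʳ-≤ 0≤c (lipschitz 0≤i i≤y y≤2) ⟩
            c * (L * (y - i))                                      ≤⟨ *-monoʳ-≤ 0≤c (*-monoʳ-≤ 0≤L
              (≤-by (0≤y-x y≤i+δ) (solve 3 (λ i y e → e := (y :- i) :+ ((i :+ e) :- y)) refl i y δ))) ⟩
            c * (L * δ)                                            ≈⟨ *-assoc c L δ ⟨
            c * L * δ                                              ≤⟨ cLδ≤η ⟩
            η                                                      ∎

        δ≤1 : δ ≤ 1#
        δ≤1 = *-cancelˡ-≤ 0<D (≤-trans (≤-reflexive D*δ) (≤-trans η≤D (≤-reflexive (sym (*-identityʳ D)))))

        better : ∀ {k y} → i ≤ y → y ≤ i + δ → Eventually (λ n → survivalRate n k ≤ y) →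
                 Eventually (λ n → survivalRate n (suc k) ≤ i - (η + η))
        better {k} i≤y y≤i+δ rate≤y = eventually-map
          (λ n (rate≤y , (1≤n , p≤1) , (_ , z≤1) , (v-η<E , _)) →
            improve {n} {k} 1≤n p≤1 z≤1 i≤y y≤i+δ (≤-trans y≤i+δ (+-mono-≤ i≤1 δ≤1)) rate≤y (<⇒≤ v-η<E))
          (eventually-∧ rate≤y (eventually-∧ (eventually-z/n≤1 c)
            (eventually-∧ (eventually-z/n≤1 (exponent (1# + 1#))) (E⟶v η 0<η))))

    infimum-preFixed : ∀ {i} → 0# < i → IsInfimum EventualBound i → PreFixed i
    infimum-preFixed {i} 0<i isInf =
      let 0≤i                 = <⇒≤ 0<i
          i≤1                 = proj₁ isInf 1# (0 , 0 , λ _ _ → ≤-refl)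
          v , exp-v , E⟶v     = NonNegative.exists (0≤exponent 0≤i)
          L , 0≤L , lipschitz = ^-lipschitz d
      in  0≤i , i≤1 , v , exp-v , infimum≤image 0≤i i≤1 E⟶v 0≤L lipschitz isInf

    0≤eventualBound : ∀ y → EventualBound y → 0# ≤ y
    0≤eventualBound y (k , below) = at-one (eventually-∧ below (eventually-z/n≤1 c))
      where
      at-one : Eventually (λ n → survivalRate n k ≤ y × 1 ℕ.≤ n × edgeProbability n ≤ 1#) → 0# ≤ y
      at-one (M , at) = let le , 1≤M , p≤1 = at M ℕ.≤-refl in ≤-trans (0≤rate 1≤M p≤1 k) le

    survivalRate-small : ¬ CoreEquationSolvable d c → ∀ {η} → 0# < η → ∃ λ k → Eventually
        (λ n → survivalRate n k ≤ η)
    survivalRate-small unsolvable {η} 0<η = conclude (infimum EventualBound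
        (1# , 0 , 0 , λ _ _ → ≤-refl) (0# , 0≤eventualBound))
      where
      conclude : ∃ (IsInfimum EventualBound) → ∃ λ k → Eventually (λ n → survivalRate n k ≤ η)
      conclude (i , isInf) with i <? η
      ... | no η≤i  = ⊥-elim (unsolvable (solution 0<i (infimum-preFixed 0<i isInf)))
        where
        0<i : 0# < i
        0<i = <-≤-trans 0<η η≤i
      ... | yes i<η =
        let _ , (k , below) , y<η = proj₂ isInf η i<η
        in  k , eventually-map (λ n le → ≤-trans le (<⇒≤ y<η)) below

-- The core is sparse below the threshold

module CoreDensity (ℝ : CompleteOrderedField) where
  open CompleteOrderedField ℝ hiding (zero)
  open OrderedFieldProperties ℝ
  open Limits ℝ
  open Exponential ℝ
  open Recursion ℝ
  open Probability ℝ using (Pr)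

  module _ {d} (0<d : 0 ℕ.< d) {c} (0<c : 0# < c) where

    private
      0≤c : 0# ≤ c
      0≤c = <⇒≤ 0<c

      q K : ℕ → ℕ → Carrier
      q = survivalRate d c 0≤c
      K = errorRate d c 0≤c

    survivalBound : ∀ {n} (1≤n : 1 ℕ.≤ n) (p≤1 : edgeProbability d c 0≤c n ≤ 1#) k →
      FirstMoment.SurvivalBound ℝ (edgeProbability d c 0≤c n) (0≤p d c 0≤c 1≤n) p≤1 {d} {n} 0<d k (q n k) (K n k)
    survivalBound {n} 1≤n p≤1 k = bound k
      where
      open FirstMoment ℝ (edgeProbability d c 0≤c n) (0≤p d c 0≤c 1≤n) p≤1 {d} {n} 0<d
      bound : ∀ k → SurvivalBound k (q n k) (K n k)
      bound zero    = survivalBound-zero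
      bound (suc k) = Inductive.survivalBound-suc k (q n k) (K n k) (0≤rate d c 0≤c 1≤n p≤1 k)
        (rate≤1 d c 0≤c 1≤n p≤1 k) (1≤errorRate d c 0≤c 1≤n p≤1 k) (bound k)

    -- The at most n^(d+1) simplices carry a factor c/n each, so the first moment has the same order
    -- n^d as the threshold. What remains is c times two errors `η`, one from the survival rate and
    -- one from lost independence.
    Pr-large-core : ∀ {n k η θ δ} → 1 ℕ.≤ n → edgeProbability d c 0≤c n ≤ 1# → 0# < δ →
      q n k ≤ η → edgeProbability d c 0≤c n * (K n k * (1# + 1#) ^ suc d) ≤ η → c * (η + η) ≤ δ * θ →
      0# ≤ Pr d n (c * fromℕ n ⁻¹) (λ Y → δ * fromℕ n ^ d <? fromℕ (f (R∞ Y) d)) ×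
      Pr d n (c * fromℕ n ⁻¹) (λ Y → δ * fromℕ n ^ d <? fromℕ (f (R∞ Y) d)) ≤ θ
    Pr-large-core {n} {k} {η} {θ} {δ} 1≤n p≤1 0<δ q≤η pK≤η cη≤δθ =
      0≤Pr {k} {q n k} {K n k} 1≤K bound (λ Y → x <? fromℕ (f (R∞ Y) d)) ,
      *-cancelˡ-≤ 0<x (begin
        x * Pr d n P (λ Y → x <? fromℕ (f (R∞ Y) d))                       ≤⟨ markov {k} {q n k} {K n k}
            1≤K bound x ⟩
        fromℕ (List.length (dSimplices d n)) * (P * (q n k + P * (K n k * (1# + 1#) ^ suc d)))
          ≤⟨ *-mono-≤ (0≤fromℕ (List.length (dSimplices d n))) 0≤edge m≤ (*-monoʳ-≤ 0≤P (+-mono-≤ q≤η pK≤η)) ⟩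
        fromℕ n ^ suc d * (P * (η + η))                                    ≈⟨ solve 4
            (λ N T p h → N :* T :* (p :* (h :+ h)) := T :* (N :* p :* (h :+ h)))
            refl (fromℕ n) (fromℕ n ^ d) P η ⟩
        fromℕ n ^ d * (fromℕ n * P * (η + η))                              ≈⟨ *-congˡ
            (*-congʳ (n*[z*n⁻¹] c 1≤n)) ⟩
        fromℕ n ^ d * (c * (η + η))                                        ≤⟨ *-monoʳ-≤
            (0≤^ d (0≤fromℕ n)) cη≤δθ ⟩
        fromℕ n ^ d * (δ * θ)                                              ≈⟨ solve 3 (λ T e h → T :*
            (e :* h) := e :* T :* h) refl (fromℕ n ^ d) δ θ ⟩
        x * θ                                                              ∎)
      where
      open ≤-Reasoning
      P x : Carrier
      P = edgeProbability d c 0≤c n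
      x = δ * fromℕ n ^ d
      0≤P : 0# ≤ P
      0≤P = 0≤p d c 0≤c 1≤n
      open FirstMoment ℝ P 0≤P p≤1 {d} {n} 0<d
      bound : SurvivalBound k (q n k) (K n k)
      bound = survivalBound 1≤n p≤1 k
      1≤K : 1# ≤ K n k
      1≤K = 1≤errorRate d c 0≤c 1≤n p≤1 k
      0<x : 0# < x
      0<x = *-pos 0<δ (0<^ d (0<fromℕ 1≤n))
      m≤ : fromℕ (List.length (dSimplices d n)) ≤ fromℕ n ^ suc d
      m≤ = ≤-trans (fromℕ-mono-≤ (length-dSimplices≤ d n)) (≤-reflexive (fromℕ-^ n (suc d)))
      0≤edge : 0# ≤ P * (q n k + P * (K n k * (1# + 1#) ^ suc d))
      0≤edge = 0≤x*y 0≤P (0≤x+y (0≤rate d c 0≤c 1≤n p≤1 k) (0≤x*y 0≤P (0≤x*y (≤-trans 0≤1 1≤K)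
          (0≤^ (suc d) (<⇒≤ 0<2)))))

theorem8 : (ℝ : CompleteOrderedField) →
    let open CompleteOrderedField ℝ
        open Probability ℝ
    in
    (d : ℕ) → 2 ℕ.≤ d →
    (γ-d : Carrier) → IsThreshold d γ-d →
    (δ c : Carrier) → 0# < δ → 0# < c → c < γ-d →
    (λ n → Pr d n (c * fromℕ n ⁻¹)
             (λ Y → δ * fromℕ n ^ d <? fromℕ (f (R∞ Y) d))) ⟶ 0#
theorem8 ℝ d 2≤d γ-d (γ-lower , _) δ c 0<δ 0<c c<γ ε 0<ε =
  -- The depth is fixed by `η` alone, the constant `C` depends on that depth, and only then is n
  -- taken large.
  let k , rate-small = survivalRate-small d c 0≤c unsolvable 0<η
      C , K≤C        = errorRate-bounded d c 0≤c k
  in  conclude k C rate-small K≤C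
  where
  open CompleteOrderedField ℝ
  open Probability ℝ
  open OrderedFieldProperties ℝ
  open Limits ℝ
  open Exponential ℝ
  open Recursion ℝ
  0<d : 0 ℕ.< d
  0<d = ℕ.≤-trans (s≤s z≤n) 2≤d
  0≤c : 0# ≤ c
  0≤c = <⇒≤ 0<c
  unsolvable : ¬ CoreEquationSolvable d c
  unsolvable solvable = γ-lower c solvable c<γ
  -- `ζ` solves c ζ = δ θ and is shared equally by the two errors `η`; taking half of `ε` for `θ`
  -- makes the final bound strict.
  θ ζ η : Carrier
  θ = ε * (1# + 1#) ⁻¹
  ζ = δ * θ * c ⁻¹
  η = ζ * (1# + 1#) ⁻¹
  0<η : 0# < η
  0<η = half-pos (*-pos (*-pos 0<δ (half-pos 0<ε)) (⁻¹-pos 0<c))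
  cη≤ : c * (η + η) ≤ δ * θ
  cη≤ = ≤-reflexive (trans (*-congˡ (half+half ζ)) (trans (*-comm c ζ) (x*y⁻¹*y≈x (δ * θ) 0<c)))
  0-ε<0 : 0# - ε < 0#
  0-ε<0 = <-by 0<ε (solve 1 (λ e → con (+ 0) := (con (+ 0) :- e) :+ e) refl ε)
  half<0+ε : θ < 0# + ε
  half<0+ε = <-by (half-pos 0<ε) (trans (+-identityˡ ε) (sym (half+half ε)))

  conclude : ∀ k C → Eventually (λ n → survivalRate d c 0≤c n k ≤ η)
      → Eventually (λ n → errorRate d c 0≤c n k ≤ C) →
    Eventually (λ n →
      0# - ε < Pr d n (c * fromℕ n ⁻¹) (λ Y → δ * fromℕ n ^ d <? fromℕ (f (R∞ Y) d)) ×
      Pr d n (c * fromℕ n ⁻¹) (λ Y → δ * fromℕ n ^ d <? fromℕ (f (R∞ Y) d)) < 0# + ε)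
  conclude k C rate-small K≤C = eventually-map step
    (eventually-∧ rate-small (eventually-∧ K≤C (eventually-∧ (eventually-small (c * (C * T)) 0<η)
        (eventually-z/n≤1 c))))
    where
    T : Carrier
    T = (1# + 1#) ^ suc d
    step : ∀ n → survivalRate d c 0≤c n k ≤ η × errorRate d c 0≤c n k ≤ C × c * (C * T) < η * fromℕ n ×
                 1 ℕ.≤ n × c * fromℕ n ⁻¹ ≤ 1# → _
    step n (q≤η , K≤C , cCT<ηn , 1≤n , p≤1) =
      let 0≤Pr , Pr≤θ = CoreDensity.Pr-large-core ℝ 0<d 0<c {n} {k} 1≤n p≤1 0<δ q≤η pK≤η cη≤
      in  <-≤-trans 0-ε<0 0≤Pr , ≤-<-trans Pr≤θ half<0+ε
      where
      pK≤η : c * fromℕ n ⁻¹ * (errorRate d c 0≤c n k * T) ≤ η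
      pK≤η = ≤-trans
        (*-monoʳ-≤ (0≤p d c 0≤c 1≤n) (*-monoˡ-≤ (0≤^ (suc d) (<⇒≤ 0<2)) K≤C))
        (≤-trans (≤-reflexive (solve 4 (λ c i C T → c :* i :* (C :* T) := c :* (C :* T) :* i)
            refl c (fromℕ n ⁻¹) C T))
          (x≤y*z⇒x*z⁻¹≤y (0<fromℕ 1≤n) (<⇒≤ cCT<ηn)))
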